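{- Fix an integer $n>1$. Then the Dirichlet series $\zeta^R_{\mathbb{Z}^n}(s)$ diverges for all $s\in\mathbb{C}$ such that $$\operatorname{Re}(s) \leq \max_{0 \leq d \leq n-1} \left(\frac{d(n-1-d)}{n-1+d} + \frac{1}{n-1+d}\right),$$ where the maximum is over all integers $d$ with $0\le d\le n-1$.
   Context: A subring of $\mathbb{Z}^n$ is a sublattice (additive subgroup) of $\mathbb{Z}^n$ that contains the multiplicative identity $(1,1,\ldots,1)$ and is closed under componentwise multiplication. For a positive integer $k$, $f_n(k)$ denotes the number of subrings of $\mathbb{Z}^n$ of finite index $k$. The subring zeta function of $\mathbb{Z}^n$ is the Dirichlet series $\zeta^R_{\mathbb{Z}^n}(s) = \sum_{k=1}^\infty f_n(k)k^{ -s}$. -}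

module Defs where

open import Data.Nat as ℕ using (ℕ; zero; suc; _!)
import Data.Nat.Properties as ℕP
open import Data.Integer as ℤ using (ℤ) renaming (+_ to int)
import Data.Integer.Properties as ℤP
open import Data.Rational
open import Data.Rational.Properties
import Data.Rational.Unnormalised as ℚᵘ
import Data.Rational.Unnormalised.Properties as ℚᵘP
open import Data.Rational.Solver using (module +-*-Solver)
open import Data.Product using (∃; _×_; _,_; proj₁; proj₂)
open import Data.Sum using (inj₁; inj₂)
open import Data.Empty using (⊥-elim)
open import Data.Fin using (Fin; zero; suc; toℕ; fromℕ<)
import Data.Fin.Properties as FinP
open import Data.List as List using (List; []; _∷_)
open import Data.List.Membership.Propositional.Properties using (∈-lookup; ∈-allFin)
open import Data.List.Membership.Setoid.Properties using (∈-deduplicate⁺)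
open import Data.List.Relation.Unary.All as All using ([]; _∷_)
open import Data.List.Relation.Unary.AllPairs using ([]; _∷_)
open import Data.List.Relation.Unary.Any as Any using (Any; here; there)
import Data.List.Relation.Unary.Any.Properties as AnyP
open import Data.List.Relation.Unary.Enumerates.Setoid using (IsEnumeration)
open import Data.List.Relation.Unary.Unique.Setoid using (Unique)
open import Data.List.Relation.Unary.Unique.DecSetoid.Properties using (deduplicate-!)
open import Data.Nat.Divisibility using (_∣_; ∣-refl; ∣-trans; ∣m⇒∣m*n; m≤n⇒m!∣n!)
import Data.Nat.DivMod as ℕD
import Data.Integer.DivMod as ℤD
import Data.Integer.Solver
open import Data.Vec as Vec using (Vec; []; _∷_)
open import Function.Bundles using (Inverse)
open import Level using (0ℓ)
open import Relation.Binary.Bundles using (Setoid; DecSetoid)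
open import Relation.Nullary using (¬_; Dec; yes; no)
open import Relation.Nullary.Decidable using (map′; _×-dec_; _→-dec_)
open import Relation.Unary using (Pred; _∈_; _≐_)
open import Relation.Binary.PropositionalEquality
private module ℤS = Data.Integer.Solver.+-*-Solver
open +-*-Solver using (solve; _:+_; _:*_; _:-_; :-_; _:=_)

fromℕ : ℕ → ℚ
fromℕ n = int n / 1

abstract

  /-mult : ∀ a b c d → (int a / suc b) * (int c / suc d) ≡ int (a ℕ.* c) / (suc b ℕ.* suc d)
  /-mult a b c d = toℚᵘ-injective (begin
    toℚᵘ ((int a / suc b) * (int c / suc d))            ≈⟨ toℚᵘ-homo-* (int a / suc b) (int c / suc d) ⟩
    toℚᵘ (int a / suc b) ℚᵘ.* toℚᵘ (int c / suc d)      ≈⟨ ℚᵘP.*-cong (toℚᵘ-fromℚᵘ (ℚᵘ.mkℚᵘ (int a) b)) (toℚᵘ-fromℚᵘ (ℚᵘ.mkℚᵘ (int c) d)) ⟩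
    ℚᵘ.mkℚᵘ (int a) b ℚᵘ.* ℚᵘ.mkℚᵘ (int c) d            ≈⟨ ℚᵘ.*≡* (cong (ℤ._* int (suc b ℕ.* suc d)) (sym (ℤP.pos-* a c))) ⟩
    ℚᵘ.mkℚᵘ (int (a ℕ.* c)) (d ℕ.+ b ℕ.* suc d)       ≈⟨ ℚᵘP.≃-sym (toℚᵘ-fromℚᵘ (ℚᵘ.mkℚᵘ (int (a ℕ.* c)) (d ℕ.+ b ℕ.* suc d))) ⟩
    toℚᵘ (int (a ℕ.* c) / (suc b ℕ.* suc d))          ∎)
    where open ℚᵘP.≃-Reasoning

  fromℕ-suc : ∀ n → fromℕ (suc n) ≡ 1ℚ + fromℕ n
  fromℕ-suc n = toℚᵘ-injective (begin
    toℚᵘ (fromℕ (suc n))                       ≈⟨ toℚᵘ-fromℚᵘ (ℚᵘ.mkℚᵘ (int (suc n)) 0) ⟩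
    ℚᵘ.mkℚᵘ (int (suc n)) 0                        ≈⟨ ℚᵘ.*≡* (cong (ℤ._* int 1) (cong (ℤ._+_ (int 1)) (sym (ℤP.*-identityʳ (int n))))) ⟩
    ℚᵘ.mkℚᵘ (int 1) 0 ℚᵘ.+ ℚᵘ.mkℚᵘ (int n) 0       ≈⟨ ℚᵘP.+-cong (ℚᵘP.≃-refl {ℚᵘ.mkℚᵘ (int 1) 0}) (ℚᵘP.≃-sym (toℚᵘ-fromℚᵘ (ℚᵘ.mkℚᵘ (int n) 0))) ⟩
    toℚᵘ 1ℚ ℚᵘ.+ toℚᵘ (fromℕ n)                ≈⟨ ℚᵘP.≃-sym (toℚᵘ-homo-+ 1ℚ (fromℕ n)) ⟩
    toℚᵘ (1ℚ + fromℕ n)                        ∎)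
    where open ℚᵘP.≃-Reasoning

  fromℕ-+ : ∀ m n → fromℕ (m ℕ.+ n) ≡ fromℕ m + fromℕ n
  fromℕ-+ zero    n = sym (+-identityˡ (fromℕ n))
  fromℕ-+ (suc m) n = begin
    fromℕ (suc (m ℕ.+ n))      ≡⟨ fromℕ-suc (m ℕ.+ n) ⟩
    1ℚ + fromℕ (m ℕ.+ n)       ≡⟨ cong (1ℚ +_) (fromℕ-+ m n) ⟩
    1ℚ + (fromℕ m + fromℕ n)   ≡⟨ sym (+-assoc 1ℚ (fromℕ m) (fromℕ n)) ⟩
    (1ℚ + fromℕ m) + fromℕ n   ≡⟨ cong (_+ fromℕ n) (sym (fromℕ-suc m)) ⟩
    fromℕ (suc m) + fromℕ n    ∎
    where open ≡-Reasoning

  fromℕ-* : ∀ m n → fromℕ (m ℕ.* n) ≡ fromℕ m * fromℕ n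
  fromℕ-* m n = sym (/-mult m 0 n 0)

  fromℕ-*-1/ : ∀ n → fromℕ (suc n) * (int 1 / suc n) ≡ 1ℚ
  fromℕ-*-1/ n = trans (/-mult (suc n) 0 1 n) (fromℚᵘ-cong {ℚᵘ.mkℚᵘ (int (suc n ℕ.* 1)) (n ℕ.+ 0)} {ℚᵘ.mkℚᵘ (int 1) 0}
    (ℚᵘ.*≡* (trans (ℤP.*-identityʳ _) (trans (cong int (trans (ℕP.*-identityʳ (suc n)) (cong suc (sym (ℕP.+-identityʳ n))))) (sym (ℤP.*-identityˡ _))))))

  0≤fromℕ : ∀ n → 0ℚ ≤ fromℕ n
  0≤fromℕ n = nonNegative⁻¹ _ {{normalize-nonNeg n 1}}

  0<fromℕ-suc : ∀ n → 0ℚ < fromℕ (suc n)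
  0<fromℕ-suc n = positive⁻¹ _ {{normalize-pos (suc n) 1}}

  0<1/suc : ∀ n → 0ℚ < int 1 / suc n
  0<1/suc n = positive⁻¹ _ {{normalize-pos 1 (suc n)}}

  fromℕ-mono : ∀ {m n} → m ℕ.≤ n → fromℕ m ≤ fromℕ n
  fromℕ-mono {m} {n} m≤n = begin
    fromℕ m                        ≡⟨ sym (+-identityʳ (fromℕ m)) ⟩
    fromℕ m + 0ℚ                   ≤⟨ +-monoʳ-≤ (fromℕ m) (0≤fromℕ (n ℕ.∸ m)) ⟩
    fromℕ m + fromℕ (n ℕ.∸ m)      ≡⟨ sym (fromℕ-+ m (n ℕ.∸ m)) ⟩
    fromℕ (m ℕ.+ (n ℕ.∸ m))        ≡⟨ cong fromℕ (ℕP.m+[n∸m]≡n m≤n) ⟩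
    fromℕ n                        ∎
    where open ≤-Reasoning

  *-mono₂ : ∀ {a b c d} → 0ℚ ≤ a → 0ℚ ≤ d → a ≤ b → c ≤ d → a * c ≤ b * d
  *-mono₂ {a} {b} {c} {d} 0≤a 0≤d a≤b c≤d = ≤-trans
    (*-monoˡ-≤-nonNeg a {{nonNegative 0≤a}} c≤d)
    (*-monoʳ-≤-nonNeg d {{nonNegative 0≤d}} a≤b)

  0≤* : ∀ {a b} → 0ℚ ≤ a → 0ℚ ≤ b → 0ℚ ≤ a * b
  0≤* {a} {b} 0≤a 0≤b = subst (_≤ a * b) (*-zeroˡ 0ℚ) (*-mono₂ ≤-refl 0≤b 0≤a 0≤b)

  0<* : ∀ {a b} → 0ℚ < a → 0ℚ < b → 0ℚ < a * b
  0<* {a} {b} 0<a 0<b = positive⁻¹ (a * b) {{pos*pos⇒pos a {{positive 0<a}} b {{positive 0<b}}}}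

  0≤+ : ∀ {a b} → 0ℚ ≤ a → 0ℚ ≤ b → 0ℚ ≤ a + b
  0≤+ = +-mono-≤

  q≤fromℕ : ∀ q → ∃ λ N → q ≤ fromℕ N
  q≤fromℕ q@(mkℚ (int a) d _) = a , (begin
    q                          ≡⟨ sym (↥p/↧p≡p q) ⟩
    int a / suc d                ≡⟨ sym (trans (/-mult a 0 1 d) (fromℚᵘ-cong {ℚᵘ.mkℚᵘ (int (a ℕ.* 1)) (d ℕ.+ 0)} {ℚᵘ.mkℚᵘ (int a) d}
                                   (ℚᵘ.*≡* (cong₂ (λ x y → int x ℤ.* int (suc y)) (ℕP.*-identityʳ a) (sym (ℕP.+-identityʳ d)))))) ⟩
    fromℕ a * (int 1 / suc d)    ≤⟨ *-monoˡ-≤-nonNeg (fromℕ a) {{nonNegative (0≤fromℕ a)}} 1/≤1 ⟩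
    fromℕ a * 1ℚ               ≡⟨ *-identityʳ (fromℕ a) ⟩
    fromℕ a                    ∎)
    where
    open ≤-Reasoning
    1/≤1 : int 1 / suc d ≤ 1ℚ
    1/≤1 = *-cancelˡ-≤-pos (fromℕ (suc d)) {{positive (0<fromℕ-suc d)}}
      (subst₂ _≤_ (sym (fromℕ-*-1/ d)) (sym (*-identityʳ (fromℕ (suc d)))) (fromℕ-mono {1} {suc d} (ℕ.s≤s ℕ.z≤n)))
  q≤fromℕ q@(mkℚ (ℤ.-[1+ a ]) d _) = 0 , nonPositive⁻¹ q

  archimedean : ∀ q {ε} → 0ℚ < ε → ∃ λ N → q ≤ fromℕ N * ε
  archimedean q {ε} 0<ε = proj₁ (q≤fromℕ (q * inv)) , (begin
    q                                     ≡⟨ sym (*-identityʳ q) ⟩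
    q * 1ℚ                                ≡⟨ cong (q *_) (sym (*-inverseˡ ε {{ε≢0}})) ⟩
    q * (inv * ε)                         ≡⟨ sym (*-assoc q inv ε) ⟩
    q * inv * ε                           ≤⟨ *-monoʳ-≤-nonNeg ε {{nonNegative (<⇒≤ 0<ε)}} (proj₂ (q≤fromℕ (q * inv))) ⟩
    fromℕ (proj₁ (q≤fromℕ (q * inv))) * ε ∎)
    where
    open ≤-Reasoning
    ε≢0 : NonZero ε
    ε≢0 = pos⇒nonZero ε {{positive 0<ε}}
    inv : ℚ
    inv = (1/ ε) {{ε≢0}}

IsCauchy : (ℕ → ℚ) → Set
IsCauchy x = ∀ ε → 0ℚ < ε →
  ∃ λ N → ∀ m n → N ℕ.≤ m → N ℕ.≤ n → ∣ x m - x n ∣ ≤ ε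

record ℝ : Set where
  constructor mkℝ
  field
    seq    : ℕ → ℚ
    cauchy : IsCauchy seq
open ℝ public

abstract

  triangle : ∀ a b c → ∣ a - c ∣ ≤ ∣ a - b ∣ + ∣ b - c ∣
  triangle a b c = subst (λ x → ∣ x ∣ ≤ ∣ a - b ∣ + ∣ b - c ∣)
    (solve 3 (λ a b c → (a :- b) :+ (b :- c) := a :- c) refl a b c)
    (∣p+q∣≤∣p∣+∣q∣ (a - b) (b - c))

  ∣-∣-swap : ∀ a b → ∣ a - b ∣ ≡ ∣ b - a ∣
  ∣-∣-swap a b = trans (sym (∣-p∣≡∣p∣ (a - b)))
    (cong ∣_∣ (solve 2 (λ a b → :- (a :- b) := b :- a) refl a b))

  0<½* : ∀ {ε} → 0ℚ < ε → 0ℚ < ½ * ε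
  0<½* {ε} = 0<* (positive⁻¹ ½)

  ½+½ : ∀ ε → ½ * ε + ½ * ε ≡ ε
  ½+½ ε = trans (sym (*-distribʳ-+ ε ½ ½)) (*-identityˡ ε)

  shrink : ∀ C {ε} → 0ℚ < ε → ∃ λ δ → 0ℚ < δ × C * δ ≤ ε
  shrink C {ε} 0<ε = δ , 0<1/suc N , (begin
    C * δ                      ≤⟨ *-monoʳ-≤-nonNeg δ {{δ≥0}} (proj₂ (archimedean C 0<ε)) ⟩
    fromℕ N * ε * δ            ≤⟨ *-monoʳ-≤-nonNeg δ {{δ≥0}} (*-monoʳ-≤-nonNeg ε {{nonNegative (<⇒≤ 0<ε)}} (fromℕ-mono {N} {suc N} (ℕP.n≤1+n N))) ⟩
    fromℕ (suc N) * ε * δ      ≡⟨ solve 3 (λ r e d → r :* e :* d := r :* d :* e) refl (fromℕ (suc N)) ε δ ⟩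
    fromℕ (suc N) * δ * ε      ≡⟨ cong (_* ε) (fromℕ-*-1/ N) ⟩
    1ℚ * ε                     ≡⟨ *-identityˡ ε ⟩
    ε                          ∎)
    where
    open ≤-Reasoning
    N : ℕ
    N = proj₁ (archimedean C 0<ε)
    δ : ℚ
    δ = int 1 / suc N
    δ≥0 : NonNegative δ
    δ≥0 = nonNegative (<⇒≤ (0<1/suc N))

  sumOfAbs : (ℕ → ℚ) → ℕ → ℚ
  sumOfAbs x zero    = ∣ x 0 ∣
  sumOfAbs x (suc N) = sumOfAbs x N + ∣ x (suc N) ∣

  ∣x∣≤sumOfAbs : ∀ x N {m} → m ℕ.≤ N → ∣ x m ∣ ≤ sumOfAbs x N
  ∣x∣≤sumOfAbs x zero    ℕ.z≤n = ≤-refl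
  ∣x∣≤sumOfAbs x (suc N) {m} m≤1+N with ℕP.m≤n⇒m<n∨m≡n m≤1+N
  ... | inj₁ m<1+N = subst (_≤ sumOfAbs x N + ∣ x (suc N) ∣) (+-identityʳ ∣ x m ∣)
                       (+-mono-≤ (∣x∣≤sumOfAbs x N (ℕP.≤-pred m<1+N)) (0≤∣p∣ (x (suc N))))
  ... | inj₂ refl  = subst (_≤ sumOfAbs x N + ∣ x (suc N) ∣) (+-identityˡ ∣ x (suc N) ∣)
                       (+-monoˡ-≤ ∣ x (suc N) ∣ (≤-trans (0≤∣p∣ (x 0)) (∣x∣≤sumOfAbs x N {0} ℕ.z≤n)))

  bounded : ∀ x → IsCauchy x → ∃ λ B → 0ℚ ≤ B × (∀ m → ∣ x m ∣ ≤ B)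
  bounded x c with c 1ℚ (positive⁻¹ 1ℚ)
  ... | N , close = S + 1ℚ , 0≤+ S≥0 (nonNegative⁻¹ 1ℚ) , bound
    where
    open ≤-Reasoning
    S : ℚ
    S = sumOfAbs x N
    S≥0 : 0ℚ ≤ S
    S≥0 = ≤-trans (0≤∣p∣ (x 0)) (∣x∣≤sumOfAbs x N {0} ℕ.z≤n)
    bound : ∀ m → ∣ x m ∣ ≤ S + 1ℚ
    bound m with ℕP.≤-total m N
    ... | inj₁ m≤N = begin
      ∣ x m ∣       ≡⟨ sym (+-identityʳ ∣ x m ∣) ⟩
      ∣ x m ∣ + 0ℚ  ≤⟨ +-mono-≤ (∣x∣≤sumOfAbs x N m≤N) (nonNegative⁻¹ 1ℚ) ⟩
      S + 1ℚ        ∎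
    ... | inj₂ N≤m = begin
      ∣ x m ∣                    ≡⟨ cong ∣_∣ (solve 2 (λ a b → a := b :+ (a :- b)) refl (x m) (x N)) ⟩
      ∣ x N + (x m - x N) ∣      ≤⟨ ∣p+q∣≤∣p∣+∣q∣ (x N) (x m - x N) ⟩
      ∣ x N ∣ + ∣ x m - x N ∣    ≤⟨ +-mono-≤ (∣x∣≤sumOfAbs x N {N} ℕP.≤-refl) (close m N N≤m ℕP.≤-refl) ⟩
      S + 1ℚ                     ∎

  cauchy-const : ∀ q → IsCauchy (λ _ → q)
  cauchy-const q ε 0<ε = 0 , λ _ _ _ _ → subst (_≤ ε) (sym (cong ∣_∣ (+-inverseʳ q))) (<⇒≤ 0<ε)

  cauchy-+ : ∀ x y → IsCauchy x → IsCauchy y → IsCauchy (λ m → x m + y m)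
  cauchy-+ x y cx cy ε 0<ε with cx (½ * ε) (0<½* 0<ε) | cy (½ * ε) (0<½* 0<ε)
  ... | N , p | M , q = N ℕ.⊔ M , λ m n m≥ n≥ → begin
    ∣ (x m + y m) - (x n + y n) ∣       ≡⟨ cong ∣_∣ (solve 4 (λ a b c d → (a :+ b) :- (c :+ d) := (a :- c) :+ (b :- d)) refl (x m) (y m) (x n) (y n)) ⟩
    ∣ (x m - x n) + (y m - y n) ∣       ≤⟨ ∣p+q∣≤∣p∣+∣q∣ (x m - x n) (y m - y n) ⟩
    ∣ x m - x n ∣ + ∣ y m - y n ∣       ≤⟨ +-mono-≤ (p m n (ℕP.m⊔n≤o⇒m≤o N M m≥) (ℕP.m⊔n≤o⇒m≤o N M n≥))
                                                    (q m n (ℕP.m⊔n≤o⇒n≤o N M m≥) (ℕP.m⊔n≤o⇒n≤o N M n≥)) ⟩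
    ½ * ε + ½ * ε                       ≡⟨ ½+½ ε ⟩
    ε                                   ∎
    where open ≤-Reasoning

  cauchy-neg : ∀ x → IsCauchy x → IsCauchy (λ m → - x m)
  cauchy-neg x cx ε 0<ε = proj₁ (cx ε 0<ε) , λ m n m≥ n≥ → subst (_≤ ε)
    (trans (∣-∣-swap (x m) (x n)) (cong ∣_∣ (solve 2 (λ a b → b :- a := (:- a) :- (:- b)) refl (x m) (x n))))
    (proj₂ (cx ε 0<ε) m n m≥ n≥)

  *-close : ∀ a b c d → ∣ a * b - c * d ∣ ≤ ∣ a ∣ * ∣ b - d ∣ + ∣ d ∣ * ∣ a - c ∣
  *-close a b c d = begin
    ∣ a * b - c * d ∣                          ≡⟨ cong ∣_∣ (split a b c d) ⟩
    ∣ a * (b - d) + d * (a - c) ∣              ≤⟨ ∣p+q∣≤∣p∣+∣q∣ (a * (b - d)) (d * (a - c)) ⟩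
    ∣ a * (b - d) ∣ + ∣ d * (a - c) ∣          ≡⟨ cong₂ _+_ (∣p*q∣≡∣p∣*∣q∣ a (b - d)) (∣p*q∣≡∣p∣*∣q∣ d (a - c)) ⟩
    ∣ a ∣ * ∣ b - d ∣ + ∣ d ∣ * ∣ a - c ∣      ∎
    where
    open ≤-Reasoning
    split : ∀ a b c d → a * b - c * d ≡ a * (b - d) + d * (a - c)
    split = solve 4 (λ a b c d → a :* b :- c :* d := a :* (b :- d) :+ d :* (a :- c)) refl

  cauchy-* : ∀ x y → IsCauchy x → IsCauchy y → IsCauchy (λ m → x m * y m)
  cauchy-* x y cx cy ε 0<ε = N ℕ.⊔ M , λ m n m≥ n≥ → begin
    ∣ x m * y m - x n * y n ∣                             ≤⟨ *-close (x m) (y m) (x n) (y n) ⟩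
    ∣ x m ∣ * ∣ y m - y n ∣ + ∣ y n ∣ * ∣ x m - x n ∣     ≤⟨ +-mono-≤ (first m n m≥ n≥) (second m n m≥ n≥) ⟩
    ½ * ε + ½ * ε                                         ≡⟨ ½+½ ε ⟩
    ε                                                     ∎
    where
    open ≤-Reasoning
    A : ∃ λ B → 0ℚ ≤ B × (∀ m → ∣ x m ∣ ≤ B)
    A = bounded x cx
    B : ∃ λ B → 0ℚ ≤ B × (∀ m → ∣ y m ∣ ≤ B)
    B = bounded y cy
    α : ∃ λ δ → 0ℚ < δ × proj₁ A * δ ≤ ½ * ε
    α = shrink (proj₁ A) (0<½* 0<ε)
    β : ∃ λ δ → 0ℚ < δ × proj₁ B * δ ≤ ½ * ε
    β = shrink (proj₁ B) (0<½* 0<ε)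
    N M : ℕ
    N = proj₁ (cx (proj₁ β) (proj₁ (proj₂ β)))
    M = proj₁ (cy (proj₁ α) (proj₁ (proj₂ α)))
    first : ∀ m n → N ℕ.⊔ M ℕ.≤ m → N ℕ.⊔ M ℕ.≤ n → ∣ x m ∣ * ∣ y m - y n ∣ ≤ ½ * ε
    first m n m≥ n≥ = ≤-trans
      (*-mono₂ {∣ x m ∣} {proj₁ A} {∣ y m - y n ∣} {proj₁ α} (0≤∣p∣ (x m)) (<⇒≤ (proj₁ (proj₂ α))) (proj₂ (proj₂ A) m)
        (proj₂ (cy (proj₁ α) (proj₁ (proj₂ α))) m n (ℕP.m⊔n≤o⇒n≤o N M m≥) (ℕP.m⊔n≤o⇒n≤o N M n≥)))
      (proj₂ (proj₂ α))
    second : ∀ m n → N ℕ.⊔ M ℕ.≤ m → N ℕ.⊔ M ℕ.≤ n → ∣ y n ∣ * ∣ x m - x n ∣ ≤ ½ * ε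
    second m n m≥ n≥ = ≤-trans
      (*-mono₂ {∣ y n ∣} {proj₁ B} {∣ x m - x n ∣} {proj₁ β} (0≤∣p∣ (y n)) (<⇒≤ (proj₁ (proj₂ β))) (proj₂ (proj₂ B) n)
        (proj₂ (cx (proj₁ β) (proj₁ (proj₂ β))) m n (ℕP.m⊔n≤o⇒m≤o N M m≥) (ℕP.m⊔n≤o⇒m≤o N M n≥)))
      (proj₂ (proj₂ β))

infixl 6 _+ᴿ_ _-ᴿ_
infixl 7 _*ᴿ_
infix  8 -ᴿ_
infix  4 _≤ᴿ_

fromℚ : ℚ → ℝ
fromℚ q = mkℝ (λ _ → q) (cauchy-const q)

_+ᴿ_ _-ᴿ_ _*ᴿ_ : ℝ → ℝ → ℝ
x +ᴿ y = mkℝ (λ m → seq x m + seq y m) (cauchy-+ (seq x) (seq y) (cauchy x) (cauchy y))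
x -ᴿ y = mkℝ (λ m → seq x m - seq y m) (cauchy-+ (seq x) (λ m → - seq y m) (cauchy x) (cauchy-neg (seq y) (cauchy y)))
x *ᴿ y = mkℝ (λ m → seq x m * seq y m) (cauchy-* (seq x) (seq y) (cauchy x) (cauchy y))

-ᴿ_ : ℝ → ℝ
-ᴿ x = mkℝ (λ m → - seq x m) (cauchy-neg (seq x) (cauchy x))

_≤ᴿ_ : ℝ → ℝ → Set
x ≤ᴿ y = ∀ ε → 0ℚ < ε → ∃ λ N → ∀ m → N ℕ.≤ m → seq x m ≤ seq y m + ε

infix 5 _+i_

record _[i] (A : Set) : Set where
  constructor _+i_
  field
    Re : A
    Im : A
open _[i] public

ℂ : Set
ℂ = ℝ [i]

infixl 6 _+ᴳ_ _-ᴳ_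
infixl 7 _*ᴳ_ _•_
infixr 8 _^ᴳ_

_+ᴳ_ _-ᴳ_ _*ᴳ_ : ℚ [i] → ℚ [i] → ℚ [i]
(a +i b) +ᴳ (c +i d) = (a + c) +i (b + d)
(a +i b) -ᴳ (c +i d) = (a - c) +i (b - d)
(a +i b) *ᴳ (c +i d) = (a * c - b * d) +i (a * d + b * c)

_•_ : ℚ → ℚ [i] → ℚ [i]
q • (a +i b) = (q * a) +i (q * b)

_^ᴳ_ : ℚ [i] → ℕ → ℚ [i]
z ^ᴳ zero  = 1ℚ +i 0ℚ
z ^ᴳ suc j = z *ᴳ z ^ᴳ j

invFact : ℕ → ℚ
invFact j = (int 1 / (j !)) {{j ℕP.!≢0}}

expSum : ℕ → ℚ [i] → ℚ [i]
expSum zero    z = 0ℚ +i 0ℚ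
expSum (suc n) z = expSum n z +ᴳ invFact n • z ^ᴳ n

-- The ℓ¹-norm is used for the estimates only.
∥_∥ : ℚ [i] → ℚ
∥ a +i b ∥ = ∣ a ∣ + ∣ b ∣

pow : ℚ → ℕ → ℚ
pow R zero    = 1ℚ
pow R (suc j) = R * pow R j

expTerm : ℚ → ℕ → ℚ
expTerm R j = invFact j * pow R j

abstract

  0≤∥_∥ : ∀ z → 0ℚ ≤ ∥ z ∥
  0≤∥ a +i b ∥ = 0≤+ (0≤∣p∣ a) (0≤∣p∣ b)

  ∣Re∣≤∥∥ : ∀ z → ∣ Re z ∣ ≤ ∥ z ∥
  ∣Re∣≤∥∥ (a +i b) = subst (_≤ ∣ a ∣ + ∣ b ∣) (+-identityʳ ∣ a ∣) (+-monoʳ-≤ ∣ a ∣ (0≤∣p∣ b))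

  ∣Im∣≤∥∥ : ∀ z → ∣ Im z ∣ ≤ ∥ z ∥
  ∣Im∣≤∥∥ (a +i b) = subst (_≤ ∣ a ∣ + ∣ b ∣) (+-identityˡ ∣ b ∣) (+-monoˡ-≤ ∣ b ∣ (0≤∣p∣ a))

  interchange : ∀ a b c d → (a + b) + (c + d) ≡ (a + c) + (b + d)
  interchange = solve 4 (λ a b c d → (a :+ b) :+ (c :+ d) := (a :+ c) :+ (b :+ d)) refl

  norm-+ : ∀ z w → ∥ z +ᴳ w ∥ ≤ ∥ z ∥ + ∥ w ∥
  norm-+ (a +i b) (c +i d) = begin
    ∣ a + c ∣ + ∣ b + d ∣                    ≤⟨ +-mono-≤ (∣p+q∣≤∣p∣+∣q∣ a c) (∣p+q∣≤∣p∣+∣q∣ b d) ⟩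
    (∣ a ∣ + ∣ c ∣) + (∣ b ∣ + ∣ d ∣)        ≡⟨ interchange (∣ a ∣) (∣ c ∣) (∣ b ∣) (∣ d ∣) ⟩
    (∣ a ∣ + ∣ b ∣) + (∣ c ∣ + ∣ d ∣)        ∎
    where open ≤-Reasoning

  norm-* : ∀ z w → ∥ z *ᴳ w ∥ ≤ ∥ z ∥ * ∥ w ∥
  norm-* (a +i b) (c +i d) = begin
    ∣ a * c - b * d ∣ + ∣ a * d + b * c ∣
      ≤⟨ +-mono-≤ (∣p-q∣≤∣p∣+∣q∣ (a * c) (b * d)) (∣p+q∣≤∣p∣+∣q∣ (a * d) (b * c)) ⟩
    (∣ a * c ∣ + ∣ b * d ∣) + (∣ a * d ∣ + ∣ b * c ∣)
      ≡⟨ cong₂ _+_ (cong₂ _+_ (∣p*q∣≡∣p∣*∣q∣ a c) (∣p*q∣≡∣p∣*∣q∣ b d)) (cong₂ _+_ (∣p*q∣≡∣p∣*∣q∣ a d) (∣p*q∣≡∣p∣*∣q∣ b c)) ⟩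
    (∣ a ∣ * ∣ c ∣ + ∣ b ∣ * ∣ d ∣) + (∣ a ∣ * ∣ d ∣ + ∣ b ∣ * ∣ c ∣)
      ≡⟨ expand (∣ a ∣) (∣ b ∣) (∣ c ∣) (∣ d ∣) ⟩
    (∣ a ∣ + ∣ b ∣) * (∣ c ∣ + ∣ d ∣)        ∎
    where
    open ≤-Reasoning
    expand : ∀ a b c d → (a * c + b * d) + (a * d + b * c) ≡ (a + b) * (c + d)
    expand = solve 4 (λ a b c d → (a :* c :+ b :* d) :+ (a :* d :+ b :* c) := (a :+ b) :* (c :+ d)) refl

  norm-• : ∀ {q} z → 0ℚ ≤ q → ∥ q • z ∥ ≡ q * ∥ z ∥
  norm-• {q} (a +i b) 0≤q = begin
    ∣ q * a ∣ + ∣ q * b ∣            ≡⟨ cong₂ _+_ (∣p*q∣≡∣p∣*∣q∣ q a) (∣p*q∣≡∣p∣*∣q∣ q b) ⟩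
    ∣ q ∣ * ∣ a ∣ + ∣ q ∣ * ∣ b ∣    ≡⟨ sym (*-distribˡ-+ (∣ q ∣) (∣ a ∣) (∣ b ∣)) ⟩
    ∣ q ∣ * (∣ a ∣ + ∣ b ∣)          ≡⟨ cong (_* (∣ a ∣ + ∣ b ∣)) (0≤p⇒∣p∣≡p 0≤q) ⟩
    q * (∣ a ∣ + ∣ b ∣)              ∎
    where open ≡-Reasoning

  triangleᴳ : ∀ x y z → ∥ x -ᴳ z ∥ ≤ ∥ x -ᴳ y ∥ + ∥ y -ᴳ z ∥
  triangleᴳ (a +i b) (c +i d) (e +i f) = begin
    ∣ a - e ∣ + ∣ b - f ∣                                        ≤⟨ +-mono-≤ (triangle a c e) (triangle b d f) ⟩
    (∣ a - c ∣ + ∣ c - e ∣) + (∣ b - d ∣ + ∣ d - f ∣)            ≡⟨ interchange (∣ a - c ∣) (∣ c - e ∣) (∣ b - d ∣) (∣ d - f ∣) ⟩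
    (∣ a - c ∣ + ∣ b - d ∣) + (∣ c - e ∣ + ∣ d - f ∣)            ∎
    where open ≤-Reasoning

  norm-swap : ∀ x y → ∥ x -ᴳ y ∥ ≡ ∥ y -ᴳ x ∥
  norm-swap (a +i b) (c +i d) = cong₂ _+_ (∣-∣-swap a c) (∣-∣-swap b d)

  norm-self : ∀ x → ∥ x -ᴳ x ∥ ≡ 0ℚ
  norm-self (a +i b) = cong₂ (λ (x y : ℚ) → ∣ x ∣ + ∣ y ∣) {a - a} {0ℚ} {b - b} {0ℚ} (+-inverseʳ a) (+-inverseʳ b)

  0≤1/! : ∀ j → 0ℚ ≤ invFact j
  0≤1/! j = nonneg (j !) {{j ℕP.!≢0}}
    where
    nonneg : ∀ n .{{_ : ℕ.NonZero n}} → 0ℚ ≤ int 1 / n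
    nonneg (suc n) = <⇒≤ (0<1/suc n)

  1/-cancel : ∀ a b .{{_ : ℕ.NonZero b}} .{{_ : ℕ.NonZero (a ℕ.* b)}} → fromℕ a * (int 1 / (a ℕ.* b)) ≡ int 1 / b
  1/-cancel (suc a) (suc b) = trans (/-mult (suc a) 0 1 (b ℕ.+ a ℕ.* suc b))
    (fromℚᵘ-cong {ℚᵘ.mkℚᵘ (int (suc a ℕ.* 1)) (b ℕ.+ a ℕ.* suc b ℕ.+ 0)} {ℚᵘ.mkℚᵘ (int 1) b} (ℚᵘ.*≡* (begin
      int (suc a ℕ.* 1) ℤ.* int (suc b)            ≡⟨ sym (ℤP.pos-* (suc a ℕ.* 1) (suc b)) ⟩
      int (suc a ℕ.* 1 ℕ.* suc b)                  ≡⟨ cong (λ x → int (x ℕ.* suc b)) (ℕP.*-identityʳ (suc a)) ⟩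
      int (suc a ℕ.* suc b)                        ≡⟨ cong int (sym (ℕP.+-identityʳ (suc a ℕ.* suc b))) ⟩
      int (suc a ℕ.* suc b ℕ.+ 0)                  ≡⟨ sym (ℤP.*-identityˡ _) ⟩
      int 1 ℤ.* int (suc a ℕ.* suc b ℕ.+ 0)        ∎)))
    where open ≡-Reasoning

  1/!-suc : ∀ j → fromℕ (suc j) * invFact (suc j) ≡ invFact j
  1/!-suc j = 1/-cancel (suc j) (j !) {{j ℕP.!≢0}} {{suc j ℕP.!≢0}}

  0≤pow : ∀ {R} → 0ℚ ≤ R → ∀ j → 0ℚ ≤ pow R j
  0≤pow 0≤R zero    = nonNegative⁻¹ 1ℚ
  0≤pow 0≤R (suc j) = 0≤* 0≤R (0≤pow 0≤R j)

  pow-mono : ∀ {B R} → 0ℚ ≤ B → B ≤ R → ∀ j → pow B j ≤ pow R j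
  pow-mono         0≤B B≤R zero    = ≤-refl
  pow-mono {B} {R} 0≤B B≤R (suc j) =
    *-mono₂ {B} {R} {pow B j} {pow R j} 0≤B (0≤pow (≤-trans 0≤B B≤R) j) B≤R (pow-mono 0≤B B≤R j)

  0≤expTerm : ∀ {R} → 0ℚ ≤ R → ∀ j → 0ℚ ≤ expTerm R j
  0≤expTerm 0≤R j = 0≤* (0≤1/! j) (0≤pow 0≤R j)

  expTerm-suc : ∀ R j → fromℕ (suc j) * expTerm R (suc j) ≡ R * expTerm R j
  expTerm-suc R j = begin
    fromℕ (suc j) * (invFact (suc j) * (R * pow R j))    ≡⟨ regroup (fromℕ (suc j)) (invFact (suc j)) R (pow R j) ⟩
    R * (fromℕ (suc j) * invFact (suc j) * pow R j)      ≡⟨ cong (λ x → R * (x * pow R j)) (1/!-suc j) ⟩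
    R * (invFact j * pow R j)                          ∎
    where
    open ≡-Reasoning
    regroup : ∀ a b c d → a * (b * (c * d)) ≡ c * (a * b * d)
    regroup = solve 4 (λ a b c d → a :* (b :* (c :* d)) := c :* (a :* b :* d)) refl

  expTerm-halves : ∀ {R} → 0ℚ < R → ∀ j → R + R ≤ fromℕ (suc j) → expTerm R (suc j) + expTerm R (suc j) ≤ expTerm R j
  expTerm-halves {R} 0<R j 2R≤ = *-cancelˡ-≤-pos R {{positive 0<R}} (begin
    R * (expTerm R (suc j) + expTerm R (suc j))    ≡⟨ double R (expTerm R (suc j)) ⟩
    (R + R) * expTerm R (suc j)                    ≤⟨ *-monoʳ-≤-nonNeg (expTerm R (suc j)) {{nonNegative (0≤expTerm (<⇒≤ 0<R) (suc j))}} 2R≤ ⟩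
    fromℕ (suc j) * expTerm R (suc j)              ≡⟨ expTerm-suc R j ⟩
    R * expTerm R j                                ∎)
    where
    open ≤-Reasoning
    double : ∀ a b → a * (b + b) ≡ (a + a) * b
    double = solve 2 (λ a b → a :* (b :+ b) := (a :+ a) :* b) refl

  a≤a+a : ∀ {a} → 0ℚ ≤ a → a ≤ a + a
  a≤a+a {a} 0≤a = subst (_≤ a + a) (+-identityʳ a) (+-monoʳ-≤ a 0≤a)

  norm-^ : ∀ {B} z → ∥ z ∥ ≤ B → ∀ j → ∥ z ^ᴳ j ∥ ≤ pow B j
  norm-^ {B} z z≤B zero    = ≤-refl
  norm-^ {B} z z≤B (suc j) = ≤-trans (norm-* z (z ^ᴳ j))
    (*-mono₂ {∥ z ∥} {B} {∥ z ^ᴳ j ∥} {pow B j} 0≤∥ z ∥ (0≤pow (≤-trans 0≤∥ z ∥ z≤B) j) z≤B (norm-^ z z≤B j))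

  ^-step : ∀ z w u v → (z *ᴳ u) -ᴳ (w *ᴳ v) ≡ (z *ᴳ (u -ᴳ v)) +ᴳ ((z -ᴳ w) *ᴳ v)
  ^-step (a +i b) (c +i d) (e +i f) (g +i h) = cong₂ _+i_
    (solve 8 (λ a b c d e f g h → (a :* e :- b :* f) :- (c :* g :- d :* h)
        := (a :* (e :- g) :- b :* (f :- h)) :+ ((a :- c) :* g :- (b :- d) :* h)) refl a b c d e f g h)
    (solve 8 (λ a b c d e f g h → (a :* f :+ b :* e) :- (c :* h :+ d :* g)
        := (a :* (f :- h) :+ b :* (e :- g)) :+ ((a :- c) :* h :+ (b :- d) :* g)) refl a b c d e f g h)

  ^-lipschitz : ∀ {B} z w → 1ℚ ≤ B → ∥ z ∥ ≤ B → ∥ w ∥ ≤ B → ∀ j → ∥ z ^ᴳ j -ᴳ w ^ᴳ j ∥ ≤ ∥ z -ᴳ w ∥ * pow (B + B) j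
  ^-lipschitz {B} z w 1≤B z≤B w≤B zero = 0≤* 0≤∥ z -ᴳ w ∥ (nonNegative⁻¹ 1ℚ)
  ^-lipschitz {B} z w 1≤B z≤B w≤B (suc j) = begin
    ∥ (z *ᴳ z ^ᴳ j) -ᴳ (w *ᴳ w ^ᴳ j) ∥
      ≡⟨ cong ∥_∥ (^-step z w (z ^ᴳ j) (w ^ᴳ j)) ⟩
    ∥ (z *ᴳ (z ^ᴳ j -ᴳ w ^ᴳ j)) +ᴳ ((z -ᴳ w) *ᴳ w ^ᴳ j) ∥
      ≤⟨ norm-+ (z *ᴳ (z ^ᴳ j -ᴳ w ^ᴳ j)) ((z -ᴳ w) *ᴳ w ^ᴳ j) ⟩
    ∥ z *ᴳ (z ^ᴳ j -ᴳ w ^ᴳ j) ∥ + ∥ (z -ᴳ w) *ᴳ w ^ᴳ j ∥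
      ≤⟨ +-mono-≤ (norm-* z (z ^ᴳ j -ᴳ w ^ᴳ j)) (norm-* (z -ᴳ w) (w ^ᴳ j)) ⟩
    ∥ z ∥ * ∥ z ^ᴳ j -ᴳ w ^ᴳ j ∥ + δ * ∥ w ^ᴳ j ∥
      ≤⟨ +-mono-≤
           (*-mono₂ {∥ z ∥} {B} {∥ z ^ᴳ j -ᴳ w ^ᴳ j ∥} {δ * P} 0≤∥ z ∥ 0≤δP z≤B (^-lipschitz z w 1≤B z≤B w≤B j))
           (*-monoˡ-≤-nonNeg δ {{nonNegative 0≤δ}} w^j≤) ⟩
    B * (δ * P) + δ * (B * P)
      ≡⟨ collect B δ P ⟩
    δ * ((B + B) * P)
      ∎
    where
    open ≤-Reasoning
    δ P : ℚ
    δ = ∥ z -ᴳ w ∥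
    P = pow (B + B) j
    0≤B : 0ℚ ≤ B
    0≤B = ≤-trans (nonNegative⁻¹ 1ℚ) 1≤B
    0≤δ : 0ℚ ≤ δ
    0≤δ = 0≤∥ z -ᴳ w ∥
    0≤P : 0ℚ ≤ P
    0≤P = 0≤pow (0≤+ 0≤B 0≤B) j
    0≤δP : 0ℚ ≤ δ * P
    0≤δP = 0≤* 0≤δ 0≤P
    w^j≤ : ∥ w ^ᴳ j ∥ ≤ B * P
    w^j≤ = begin
      ∥ w ^ᴳ j ∥    ≤⟨ norm-^ w w≤B j ⟩
      pow B j       ≤⟨ pow-mono 0≤B (a≤a+a 0≤B) j ⟩
      P             ≡⟨ sym (*-identityˡ P) ⟩
      1ℚ * P        ≤⟨ *-monoʳ-≤-nonNeg P {{nonNegative 0≤P}} 1≤B ⟩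
      B * P         ∎
    collect : ∀ b d p → b * (d * p) + d * (b * p) ≡ d * ((b + b) * p)
    collect = solve 3 (λ b d p → b :* (d :* p) :+ d :* (b :* p) := d :* ((b :+ b) :* p)) refl

  expTermSum : ℚ → ℕ → ℚ
  expTermSum R zero    = 0ℚ
  expTermSum R (suc n) = expTermSum R n + expTerm R n

  0≤expTermSum : ∀ {R} → 0ℚ ≤ R → ∀ n → 0ℚ ≤ expTermSum R n
  0≤expTermSum 0≤R zero    = ≤-refl
  0≤expTermSum 0≤R (suc n) = 0≤+ (0≤expTermSum 0≤R n) (0≤expTerm 0≤R n)

  sum-close : ∀ x y q u v → (x +ᴳ q • u) -ᴳ (y +ᴳ q • v) ≡ (x -ᴳ y) +ᴳ q • (u -ᴳ v)
  sum-close (a +i b) (c +i d) q (e +i f) (g +i h) = cong₂ _+i_ (eq a c q e g) (eq b d q f h)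
    where
    eq : ∀ a c q e g → (a + q * e) - (c + q * g) ≡ (a - c) + q * (e - g)
    eq = solve 5 (λ a c q e g → (a :+ q :* e) :- (c :+ q :* g) := (a :- c) :+ q :* (e :- g)) refl

  expSum-lipschitz : ∀ {B} z w → 1ℚ ≤ B → ∥ z ∥ ≤ B → ∥ w ∥ ≤ B → ∀ n →
    ∥ expSum n z -ᴳ expSum n w ∥ ≤ ∥ z -ᴳ w ∥ * expTermSum (B + B) n
  expSum-lipschitz {B} z w 1≤B z≤B w≤B zero    = ≤-reflexive (sym (*-zeroʳ ∥ z -ᴳ w ∥))
  expSum-lipschitz {B} z w 1≤B z≤B w≤B (suc n) = begin
    ∥ (expSum n z +ᴳ invFact n • z ^ᴳ n) -ᴳ (expSum n w +ᴳ invFact n • w ^ᴳ n) ∥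
      ≡⟨ cong ∥_∥ (sum-close (expSum n z) (expSum n w) (invFact n) (z ^ᴳ n) (w ^ᴳ n)) ⟩
    ∥ (expSum n z -ᴳ expSum n w) +ᴳ invFact n • (z ^ᴳ n -ᴳ w ^ᴳ n) ∥
      ≤⟨ norm-+ (expSum n z -ᴳ expSum n w) (invFact n • (z ^ᴳ n -ᴳ w ^ᴳ n)) ⟩
    ∥ expSum n z -ᴳ expSum n w ∥ + ∥ invFact n • (z ^ᴳ n -ᴳ w ^ᴳ n) ∥
      ≡⟨ cong (_+_ ∥ expSum n z -ᴳ expSum n w ∥) (norm-• (z ^ᴳ n -ᴳ w ^ᴳ n) (0≤1/! n)) ⟩
    ∥ expSum n z -ᴳ expSum n w ∥ + invFact n * ∥ z ^ᴳ n -ᴳ w ^ᴳ n ∥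
      ≤⟨ +-mono-≤ (expSum-lipschitz z w 1≤B z≤B w≤B n)
                  (*-monoˡ-≤-nonNeg (invFact n) {{nonNegative (0≤1/! n)}} (^-lipschitz z w 1≤B z≤B w≤B n)) ⟩
    δ * expTermSum (B + B) n + invFact n * (δ * pow (B + B) n)
      ≡⟨ collect δ (expTermSum (B + B) n) (invFact n) (pow (B + B) n) ⟩
    δ * (expTermSum (B + B) n + invFact n * pow (B + B) n)
      ∎
    where
    open ≤-Reasoning
    δ : ℚ
    δ = ∥ z -ᴳ w ∥
    collect : ∀ d s f p → d * s + f * (d * p) ≡ d * (s + f * p)
    collect = solve 4 (λ d s f p → d :* s :+ f :* (d :* p) := d :* (s :+ f :* p)) refl

  -- From the index N on, consecutive bounds R ^ j / j ! at least halve.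
  module Tail (R : ℚ) (0<R : 0ℚ < R) (N : ℕ) (2R≤N : R + R ≤ fromℕ N) where

    halves : ∀ j → N ℕ.≤ j → expTerm R (suc j) + expTerm R (suc j) ≤ expTerm R j
    halves j N≤j = expTerm-halves 0<R j (≤-trans 2R≤N (fromℕ-mono {N} {suc j} (ℕP.m≤n⇒m≤1+n N≤j)))

    decreasing : ∀ k → expTerm R (N ℕ.+ k) ≤ expTerm R N
    decreasing zero    = ≤-reflexive (cong (expTerm R) (ℕP.+-identityʳ N))
    decreasing (suc k) = begin
      expTerm R (N ℕ.+ suc k)                                    ≡⟨ cong (expTerm R) (ℕP.+-suc N k) ⟩
      expTerm R (suc (N ℕ.+ k))                                  ≤⟨ a≤a+a (0≤expTerm (<⇒≤ 0<R) (suc (N ℕ.+ k))) ⟩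
      expTerm R (suc (N ℕ.+ k)) + expTerm R (suc (N ℕ.+ k))      ≤⟨ halves (N ℕ.+ k) (ℕP.m≤m+n N k) ⟩
      expTerm R (N ℕ.+ k)                                        ≤⟨ decreasing k ⟩
      expTerm R N                                                ∎
      where open ≤-Reasoning

    small : ∀ {ε} → 0ℚ < ε → ∃ λ M → N ℕ.≤ M × expTerm R M ≤ ε
    small {ε} 0<ε = suc (N ℕ.+ K) , ℕP.m≤n⇒m≤1+n (ℕP.m≤m+n N K) ,
      *-cancelˡ-≤-pos (fromℕ (suc (N ℕ.+ K))) {{positive (0<fromℕ-suc (N ℕ.+ K))}} (begin
        fromℕ (suc (N ℕ.+ K)) * expTerm R (suc (N ℕ.+ K))    ≡⟨ expTerm-suc R (N ℕ.+ K) ⟩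
        R * expTerm R (N ℕ.+ K)                              ≤⟨ *-monoˡ-≤-nonNeg R {{nonNegative (<⇒≤ 0<R)}} (decreasing K) ⟩
        R * expTerm R N                                      ≤⟨ proj₂ (archimedean (R * expTerm R N) 0<ε) ⟩
        fromℕ K * ε                                          ≤⟨ *-monoʳ-≤-nonNeg ε {{nonNegative (<⇒≤ 0<ε)}} (fromℕ-mono {K} {suc (N ℕ.+ K)} (ℕP.m≤n⇒m≤1+n (ℕP.m≤n+m K N))) ⟩
        fromℕ (suc (N ℕ.+ K)) * ε                            ∎)
      where
      open ≤-Reasoning
      K : ℕ
      K = proj₁ (archimedean (R * expTerm R N) 0<ε)

    tail : ∀ z → ∥ z ∥ ≤ R → ∀ M → N ℕ.≤ M → ∀ k →
      ∥ expSum (M ℕ.+ k) z -ᴳ expSum M z ∥ + (expTerm R (M ℕ.+ k) + expTerm R (M ℕ.+ k)) ≤ expTerm R M + expTerm R M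
    tail z z≤R M N≤M zero rewrite ℕP.+-identityʳ M =
      ≤-reflexive (trans (cong (_+ (expTerm R M + expTerm R M)) (norm-self (expSum M z))) (+-identityˡ (expTerm R M + expTerm R M)))
    tail z z≤R M N≤M (suc k) rewrite ℕP.+-suc M k = begin
      ∥ (expSum j z +ᴳ invFact j • z ^ᴳ j) -ᴳ expSum M z ∥ + (expTerm R (suc j) + expTerm R (suc j))
        ≤⟨ +-mono-≤ (triangleᴳ (expSum j z +ᴳ invFact j • z ^ᴳ j) (expSum j z) (expSum M z)) (halves j (ℕP.≤-trans N≤M (ℕP.m≤m+n M k))) ⟩
      (∥ (expSum j z +ᴳ invFact j • z ^ᴳ j) -ᴳ expSum j z ∥ + ∥ expSum j z -ᴳ expSum M z ∥) + expTerm R j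
        ≡⟨ cong (λ x → (∥ x ∥ + ∥ expSum j z -ᴳ expSum M z ∥) + expTerm R j) (drop (expSum j z) (invFact j • z ^ᴳ j)) ⟩
      (∥ invFact j • z ^ᴳ j ∥ + ∥ expSum j z -ᴳ expSum M z ∥) + expTerm R j
        ≤⟨ +-monoˡ-≤ (expTerm R j) (+-monoˡ-≤ ∥ expSum j z -ᴳ expSum M z ∥ term) ⟩
      (expTerm R j + ∥ expSum j z -ᴳ expSum M z ∥) + expTerm R j
        ≡⟨ regroup (expTerm R j) (∥ expSum j z -ᴳ expSum M z ∥) ⟩
      ∥ expSum j z -ᴳ expSum M z ∥ + (expTerm R j + expTerm R j)
        ≤⟨ tail z z≤R M N≤M k ⟩
      expTerm R M + expTerm R M
        ∎
      where
      open ≤-Reasoning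
      j : ℕ
      j = M ℕ.+ k
      drop : ∀ x y → (x +ᴳ y) -ᴳ x ≡ y
      drop (a +i b) (c +i d) = cong₂ _+i_ (eq a c) (eq b d)
        where
        eq : ∀ a c → (a + c) - a ≡ c
        eq = solve 2 (λ a c → (a :+ c) :- a := c) refl
      regroup : ∀ a b → (a + b) + a ≡ b + (a + a)
      regroup = solve 2 (λ a b → (a :+ b) :+ a := b :+ (a :+ a)) refl
      term : ∥ invFact j • z ^ᴳ j ∥ ≤ expTerm R j
      term = subst (_≤ expTerm R j) (sym (norm-• (z ^ᴳ j) (0≤1/! j)))
        (*-monoˡ-≤-nonNeg (invFact j) {{nonNegative (0≤1/! j)}} (norm-^ z z≤R j))

    tail≤ : ∀ z → ∥ z ∥ ≤ R → ∀ M → N ℕ.≤ M → ∀ m → M ℕ.≤ m → ∥ expSum m z -ᴳ expSum M z ∥ ≤ expTerm R M + expTerm R M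
    tail≤ z z≤R M N≤M m M≤m = begin
      ∥ expSum m z -ᴳ expSum M z ∥
        ≡⟨ sym (+-identityʳ ∥ expSum m z -ᴳ expSum M z ∥) ⟩
      ∥ expSum m z -ᴳ expSum M z ∥ + 0ℚ
        ≤⟨ +-monoʳ-≤ ∥ expSum m z -ᴳ expSum M z ∥ (0≤+ (0≤expTerm (<⇒≤ 0<R) m) (0≤expTerm (<⇒≤ 0<R) m)) ⟩
      ∥ expSum m z -ᴳ expSum M z ∥ + (expTerm R m + expTerm R m)
        ≤⟨ subst (λ x → ∥ expSum x z -ᴳ expSum M z ∥ + (expTerm R x + expTerm R x) ≤ expTerm R M + expTerm R M)
             (ℕP.m+[n∸m]≡n M≤m) (tail z z≤R M N≤M (m ℕ.∸ M)) ⟩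
      expTerm R M + expTerm R M
        ∎
      where open ≤-Reasoning

  expSum-cauchy : ∀ (x y : ℕ → ℚ) → IsCauchy x → IsCauchy y → ∀ ε → 0ℚ < ε →
    ∃ λ N → ∀ m n → N ℕ.≤ m → N ℕ.≤ n → ∥ expSum m (x m +i y m) -ᴳ expSum n (x n +i y n) ∥ ≤ ε
  expSum-cauchy x y cx cy ε 0<ε = L , λ m n m≥ n≥ → begin
    ∥ E m m -ᴳ E n n ∥
      ≤⟨ triangleᴳ (E m m) (E M m) (E n n) ⟩
    ∥ E m m -ᴳ E M m ∥ + ∥ E M m -ᴳ E n n ∥
      ≤⟨ +-monoʳ-≤ ∥ E m m -ᴳ E M m ∥ (triangleᴳ (E M m) (E M n) (E n n)) ⟩
    ∥ E m m -ᴳ E M m ∥ + (∥ E M m -ᴳ E M n ∥ + ∥ E M n -ᴳ E n n ∥)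
      ≤⟨ +-mono-≤ (far m (M≤ m≥)) (+-mono-≤ (near m n m≥ n≥) (subst (_≤ η + η) (norm-swap (E n n) (E M n)) (far n (M≤ n≥)))) ⟩
    (η + η) + (½ * ε + (η + η))
      ≡⟨ regroup η (½ * ε) ⟩
    ½ * ε + ((η + η) + (η + η))
      ≡⟨ cong (λ a → ½ * ε + (a + a)) (½+½ (½ * (½ * ε))) ⟩
    ½ * ε + (½ * (½ * ε) + ½ * (½ * ε))
      ≡⟨ cong (½ * ε +_) (½+½ (½ * ε)) ⟩
    ½ * ε + ½ * ε
      ≡⟨ ½+½ ε ⟩
    ε ∎
    where
    open ≤-Reasoning
    bx : ∃ λ B → 0ℚ ≤ B × (∀ m → ∣ x m ∣ ≤ B)
    bx = bounded x cx
    by : ∃ λ B → 0ℚ ≤ B × (∀ m → ∣ y m ∣ ≤ B)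
    by = bounded y cy
    B R : ℚ
    B = (proj₁ bx + proj₁ by) + 1ℚ
    R = B + B
    1≤B : 1ℚ ≤ B
    1≤B = subst (_≤ B) (+-identityˡ 1ℚ) (+-monoˡ-≤ 1ℚ (0≤+ (proj₁ (proj₂ bx)) (proj₁ (proj₂ by))))
    0≤B : 0ℚ ≤ B
    0≤B = ≤-trans (nonNegative⁻¹ 1ℚ) 1≤B
    0<R : 0ℚ < R
    0<R = <-≤-trans (positive⁻¹ 1ℚ) (≤-trans 1≤B (a≤a+a 0≤B))
    Z : ℕ → ℚ [i]
    Z m = x m +i y m
    E : ℕ → ℕ → ℚ [i]
    E j m = expSum j (Z m)
    Z≤B : ∀ m → ∥ Z m ∥ ≤ B
    Z≤B m = begin
      ∣ x m ∣ + ∣ y m ∣             ≤⟨ +-mono-≤ (proj₂ (proj₂ bx) m) (proj₂ (proj₂ by) m) ⟩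
      proj₁ bx + proj₁ by           ≡⟨ sym (+-identityʳ (proj₁ bx + proj₁ by)) ⟩
      proj₁ bx + proj₁ by + 0ℚ      ≤⟨ +-monoʳ-≤ (proj₁ bx + proj₁ by) (nonNegative⁻¹ 1ℚ) ⟩
      B                             ∎
    Z≤R : ∀ m → ∥ Z m ∥ ≤ R
    Z≤R m = ≤-trans (Z≤B m) (a≤a+a 0≤B)
    arch : ∃ λ N → R + R ≤ fromℕ N
    arch = q≤fromℕ (R + R)
    module T = Tail R 0<R (proj₁ arch) (proj₂ arch)
    η : ℚ
    η = ½ * (½ * (½ * ε))
    tiny : ∃ λ M → proj₁ arch ℕ.≤ M × expTerm R M ≤ η
    tiny = T.small (0<½* (0<½* (0<½* 0<ε)))
    M : ℕ
    M = proj₁ tiny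
    far : ∀ m → M ℕ.≤ m → ∥ E m m -ᴳ E M m ∥ ≤ η + η
    far m M≤m = ≤-trans (T.tail≤ (Z m) (Z≤R m) M (proj₁ (proj₂ tiny)) m M≤m)
      (+-mono-≤ (proj₂ (proj₂ tiny)) (proj₂ (proj₂ tiny)))
    S : ℚ
    S = expTermSum R M
    δ : ∃ λ δ → 0ℚ < δ × S * δ ≤ ½ * ε
    δ = shrink S (0<½* 0<ε)
    0<½δ : 0ℚ < ½ * proj₁ δ
    0<½δ = 0<½* (proj₁ (proj₂ δ))
    Nx Ny L : ℕ
    Nx = proj₁ (cx (½ * proj₁ δ) 0<½δ)
    Ny = proj₁ (cy (½ * proj₁ δ) 0<½δ)
    L = M ℕ.⊔ (Nx ℕ.⊔ Ny)
    M≤ : ∀ {m} → L ℕ.≤ m → M ℕ.≤ m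
    M≤ = ℕP.m⊔n≤o⇒m≤o M (Nx ℕ.⊔ Ny)
    Nx≤ : ∀ {m} → L ℕ.≤ m → Nx ℕ.≤ m
    Nx≤ L≤m = ℕP.m⊔n≤o⇒m≤o Nx Ny (ℕP.m⊔n≤o⇒n≤o M (Nx ℕ.⊔ Ny) L≤m)
    Ny≤ : ∀ {m} → L ℕ.≤ m → Ny ℕ.≤ m
    Ny≤ L≤m = ℕP.m⊔n≤o⇒n≤o Nx Ny (ℕP.m⊔n≤o⇒n≤o M (Nx ℕ.⊔ Ny) L≤m)
    near : ∀ m n → L ℕ.≤ m → L ℕ.≤ n → ∥ E M m -ᴳ E M n ∥ ≤ ½ * ε
    near m n m≥ n≥ = begin
      ∥ E M m -ᴳ E M n ∥         ≤⟨ expSum-lipschitz (Z m) (Z n) 1≤B (Z≤B m) (Z≤B n) M ⟩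
      ∥ Z m -ᴳ Z n ∥ * S         ≤⟨ *-monoʳ-≤-nonNeg S {{nonNegative (0≤expTermSum (<⇒≤ 0<R) M)}} Z-close ⟩
      proj₁ δ * S                ≡⟨ *-comm (proj₁ δ) S ⟩
      S * proj₁ δ                ≤⟨ proj₂ (proj₂ δ) ⟩
      ½ * ε                      ∎
      where
      Z-close : ∥ Z m -ᴳ Z n ∥ ≤ proj₁ δ
      Z-close = subst (∥ Z m -ᴳ Z n ∥ ≤_) (½+½ (proj₁ δ))
        (+-mono-≤ (proj₂ (cx (½ * proj₁ δ) 0<½δ) m n (Nx≤ m≥) (Nx≤ n≥))
                  (proj₂ (cy (½ * proj₁ δ) 0<½δ) m n (Ny≤ m≥) (Ny≤ n≥)))
    regroup : ∀ a b → (a + a) + (b + (a + a)) ≡ b + ((a + a) + (a + a))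
    regroup = solve 2 (λ a b → (a :+ a) :+ (b :+ (a :+ a)) := b :+ ((a :+ a) :+ (a :+ a))) refl

-- If z is the limit of the rational sequence z₀, z₁, …, then exp z is the
-- limit of the diagonal sequence Σ_{j < m} (z_m)ʲ / j!.
exp : ℂ → ℂ
exp (x +i y) = mkℝ (λ m → Re (S m)) (λ ε 0<ε → let (N , close) = expSum-cauchy (seq x) (seq y) (cauchy x) (cauchy y) ε 0<ε in
                 N , λ m n m≥ n≥ → ≤-trans (∣Re∣≤∥∥ (S m -ᴳ S n)) (close m n m≥ n≥))
            +i mkℝ (λ m → Im (S m)) (λ ε 0<ε → let (N , close) = expSum-cauchy (seq x) (seq y) (cauchy x) (cauchy y) ε 0<ε in
                 N , λ m n m≥ n≥ → ≤-trans (∣Im∣≤∥∥ (S m -ᴳ S n)) (close m n m≥ n≥))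
  where
  S : ℕ → ℚ [i]
  S m = expSum m (seq x m +i seq y m)

harmonic : ℕ → ℚ
harmonic zero    = 0ℚ
harmonic (suc n) = harmonic n + int 1 / suc n

lnSeq : ℕ → ℕ → ℚ
lnSeq k N = harmonic (k ℕ.* N) - harmonic N

abstract

  1/-anti : ∀ {m n} → m ℕ.≤ n → int 1 / suc n ≤ int 1 / suc m
  1/-anti {m} {n} m≤n = begin
    b                              ≡⟨ sym (*-identityˡ b) ⟩
    1ℚ * b                         ≡⟨ cong (_* b) (sym (fromℕ-*-1/ m)) ⟩
    fromℕ (suc m) * a * b          ≡⟨ *-assoc (fromℕ (suc m)) a b ⟩
    fromℕ (suc m) * (a * b)        ≤⟨ *-monoʳ-≤-nonNeg (a * b) {{nonNegative (0≤* (<⇒≤ (0<1/suc m)) (<⇒≤ (0<1/suc n)))}} (fromℕ-mono {suc m} {suc n} (ℕ.s≤s m≤n)) ⟩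
    fromℕ (suc n) * (a * b)        ≡⟨ regroup (fromℕ (suc n)) a b ⟩
    fromℕ (suc n) * b * a          ≡⟨ cong (_* a) (fromℕ-*-1/ n) ⟩
    1ℚ * a                         ≡⟨ *-identityˡ a ⟩
    a                              ∎
    where
    open ≤-Reasoning
    a b : ℚ
    a = int 1 / suc m
    b = int 1 / suc n
    regroup : ∀ r a b → r * (a * b) ≡ r * b * a
    regroup = solve 3 (λ r a b → r :* (a :* b) := r :* b :* a) refl

  extend : ∀ h c x → h + (1ℚ + c) * x ≡ (h + c * x) + x
  extend h c x = trans (cong (h +_) (trans (*-distribʳ-+ x 1ℚ c) (cong (_+ c * x) (*-identityˡ x))))
    (trans (cong (h +_) (+-comm x (c * x))) (sym (+-assoc h (c * x) x)))

  harmonic-upper : ∀ M c → harmonic (suc M ℕ.+ c) ≤ harmonic (suc M) + fromℕ c * (int 1 / suc M)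
  harmonic-upper M zero = ≤-reflexive (trans (cong harmonic (ℕP.+-identityʳ (suc M)))
    (sym (trans (cong (harmonic (suc M) +_) (*-zeroˡ (int 1 / suc M))) (+-identityʳ (harmonic (suc M))))))
  harmonic-upper M (suc c) rewrite ℕP.+-suc M c = begin
    harmonic (suc M ℕ.+ c) + int 1 / suc (suc M ℕ.+ c)
      ≤⟨ +-mono-≤ (harmonic-upper M c) (1/-anti {M} {suc M ℕ.+ c} (ℕP.m≤n⇒m≤1+n (ℕP.m≤m+n M c))) ⟩
    (harmonic (suc M) + fromℕ c * (int 1 / suc M)) + int 1 / suc M
      ≡⟨ sym (extend (harmonic (suc M)) (fromℕ c) (int 1 / suc M)) ⟩
    harmonic (suc M) + (1ℚ + fromℕ c) * (int 1 / suc M)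
      ≡⟨ cong (λ r → harmonic (suc M) + r * (int 1 / suc M)) (sym (fromℕ-suc c)) ⟩
    harmonic (suc M) + fromℕ (suc c) * (int 1 / suc M)
      ∎
    where open ≤-Reasoning

  harmonic-lower : ∀ M c K → M ℕ.+ c ℕ.≤ suc K → harmonic M + fromℕ c * (int 1 / suc K) ≤ harmonic (M ℕ.+ c)
  harmonic-lower M zero K _ = ≤-reflexive (trans
    (trans (cong (harmonic M +_) (*-zeroˡ (int 1 / suc K))) (+-identityʳ (harmonic M)))
    (cong harmonic (sym (ℕP.+-identityʳ M))))
  harmonic-lower M (suc c) K le rewrite ℕP.+-suc M c = begin
    harmonic M + fromℕ (suc c) * (int 1 / suc K)
      ≡⟨ cong (λ r → harmonic M + r * (int 1 / suc K)) (fromℕ-suc c) ⟩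
    harmonic M + (1ℚ + fromℕ c) * (int 1 / suc K)
      ≡⟨ extend (harmonic M) (fromℕ c) (int 1 / suc K) ⟩
    (harmonic M + fromℕ c * (int 1 / suc K)) + int 1 / suc K
      ≤⟨ +-mono-≤ (harmonic-lower M c K (ℕP.<⇒≤ le)) (1/-anti {M ℕ.+ c} {K} (ℕP.≤-pred le)) ⟩
    harmonic (M ℕ.+ c) + int 1 / suc (M ℕ.+ c)
      ∎
    where open ≤-Reasoning

  fromℕ-*-1/* : ∀ a b → fromℕ (suc a) * (int 1 / (suc a ℕ.* suc b)) ≡ int 1 / suc b
  fromℕ-*-1/* a b = 1/-cancel (suc a) (suc b)

  +-cancel : ∀ h x y → (h + x) - (y + x) ≡ h - y
  +-cancel = solve 3 (λ h x y → (h :+ x) :- (y :+ x) := h :- y) refl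

  module LnBounds (k : ℕ) where

    a : ℕ → ℚ
    a = lnSeq (suc k)

    block : ∀ N → suc k ℕ.* suc N ≡ suc k ℕ.* N ℕ.+ suc k
    block N = trans (ℕP.*-suc (suc k) N) (ℕP.+-comm (suc k) (suc k ℕ.* N))

    increasing : ∀ N → a N ≤ a (suc N)
    increasing N = begin
      harmonic (suc k ℕ.* N) - harmonic N
        ≡⟨ sym (+-cancel (harmonic (suc k ℕ.* N)) (int 1 / suc N) (harmonic N)) ⟩
      (harmonic (suc k ℕ.* N) + int 1 / suc N) - (harmonic N + int 1 / suc N)
        ≡⟨ cong (λ x → (harmonic (suc k ℕ.* N) + x) - (harmonic N + int 1 / suc N)) (sym (fromℕ-*-1/* k N)) ⟩
      (harmonic (suc k ℕ.* N) + fromℕ (suc k) * (int 1 / (suc k ℕ.* suc N))) - (harmonic N + int 1 / suc N)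
        ≤⟨ +-monoˡ-≤ (- (harmonic N + int 1 / suc N))
             (harmonic-lower (suc k ℕ.* N) (suc k) (N ℕ.+ k ℕ.* suc N) (ℕP.≤-reflexive (sym (block N)))) ⟩
      harmonic (suc k ℕ.* N ℕ.+ suc k) - (harmonic N + int 1 / suc N)
        ≡⟨ cong (λ x → harmonic x - (harmonic N + int 1 / suc N)) (sym (block N)) ⟩
      harmonic (suc k ℕ.* suc N) - harmonic (suc N)
        ∎
      where open ≤-Reasoning

    decreasing : ∀ N → a (suc (suc N)) + int 1 / suc (suc N) ≤ a (suc N) + int 1 / suc N
    decreasing N = begin
      (harmonic (suc k ℕ.* suc (suc N)) - (harmonic (suc N) + t)) + t
        ≡⟨ forget (harmonic (suc k ℕ.* suc (suc N))) (harmonic (suc N)) t ⟩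
      harmonic (suc k ℕ.* suc (suc N)) - harmonic (suc N)
        ≡⟨ cong (λ x → harmonic x - harmonic (suc N)) (block (suc N)) ⟩
      harmonic (suc k ℕ.* suc N ℕ.+ suc k) - harmonic (suc N)
        ≤⟨ +-monoˡ-≤ (- harmonic (suc N)) (harmonic-upper (N ℕ.+ k ℕ.* suc N) (suc k)) ⟩
      (harmonic (suc k ℕ.* suc N) + fromℕ (suc k) * (int 1 / (suc k ℕ.* suc N))) - harmonic (suc N)
        ≡⟨ cong (λ x → (harmonic (suc k ℕ.* suc N) + x) - harmonic (suc N)) (fromℕ-*-1/* k N) ⟩
      (harmonic (suc k ℕ.* suc N) + int 1 / suc N) - harmonic (suc N)
        ≡⟨ move (harmonic (suc k ℕ.* suc N)) (int 1 / suc N) (harmonic (suc N)) ⟩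
      (harmonic (suc k ℕ.* suc N) - harmonic (suc N)) + int 1 / suc N
        ∎
      where
      open ≤-Reasoning
      t : ℚ
      t = int 1 / suc (suc N)
      forget : ∀ x y t → (x - (y + t)) + t ≡ x - y
      forget = solve 3 (λ x y t → (x :- (y :+ t)) :+ t := x :- y) refl
      move : ∀ x u y → (x + u) - y ≡ (x - y) + u
      move = solve 3 (λ x u y → (x :+ u) :- y := (x :- y) :+ u) refl

    above : ∀ N d → a N ≤ a (N ℕ.+ d)
    above N zero    = ≤-reflexive (cong a (sym (ℕP.+-identityʳ N)))
    above N (suc d) = subst (λ x → a N ≤ a x) (sym (ℕP.+-suc N d)) (≤-trans (above N d) (increasing (N ℕ.+ d)))

    below′ : ∀ N d → a (suc N ℕ.+ d) + int 1 / suc (N ℕ.+ d) ≤ a (suc N) + int 1 / suc N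
    below′ N zero    = ≤-reflexive (cong (λ x → a (suc x) + int 1 / suc x) (ℕP.+-identityʳ N))
    below′ N (suc d) = subst (λ x → a (suc x) + int 1 / suc x ≤ a (suc N) + int 1 / suc N) (sym (ℕP.+-suc N d))
      (≤-trans (decreasing (N ℕ.+ d)) (below′ N d))

    below : ∀ N d → a (suc N ℕ.+ d) ≤ a (suc N) + int 1 / suc N
    below N d = ≤-trans
      (subst (_≤ a (suc N ℕ.+ d) + int 1 / suc (N ℕ.+ d)) (+-identityʳ (a (suc N ℕ.+ d)))
        (+-monoʳ-≤ (a (suc N ℕ.+ d)) (<⇒≤ (0<1/suc (N ℕ.+ d)))))
      (below′ N d)

  between : ∀ l e x y → l ≤ x → x ≤ l + e → l ≤ y → y ≤ l + e → ∣ x - y ∣ ≤ e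
  between l e x y l≤x x≤ l≤y y≤ with ∣p∣≡p∨∣p∣≡-p (x - y)
  ... | inj₁ eq = subst (_≤ e) (sym eq) (≤-trans (+-mono-≤ x≤ (neg-antimono-≤ l≤y)) (≤-reflexive (drop l e)))
    where
    drop : ∀ l e → (l + e) - l ≡ e
    drop = solve 2 (λ l e → (l :+ e) :- l := e) refl
  ... | inj₂ eq = subst (_≤ e) (sym (trans eq (flip x y))) (≤-trans (+-mono-≤ y≤ (neg-antimono-≤ l≤x)) (≤-reflexive (drop l e)))
    where
    drop : ∀ l e → (l + e) - l ≡ e
    drop = solve 2 (λ l e → (l :+ e) :- l := e) refl
    flip : ∀ x y → - (x - y) ≡ y - x
    flip = solve 2 (λ x y → :- (x :- y) := y :- x) refl

  lnSeq-cauchy : ∀ k .{{_ : ℕ.NonZero k}} → IsCauchy (lnSeq k)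
  lnSeq-cauchy (suc k) ε 0<ε = suc N , λ m n m≥ n≥ → ≤-trans
    (between (a (suc N)) (int 1 / suc N) (a m) (a n) (lower m m≥) (upper m m≥) (lower n n≥) (upper n n≥)) 1/N≤ε
    where
    open ≤-Reasoning
    open LnBounds k
    N : ℕ
    N = proj₁ (archimedean 1ℚ 0<ε)
    lower : ∀ m → suc N ℕ.≤ m → a (suc N) ≤ a m
    lower m le = subst (λ x → a (suc N) ≤ a x) (ℕP.m+[n∸m]≡n le) (above (suc N) (m ℕ.∸ suc N))
    upper : ∀ m → suc N ℕ.≤ m → a m ≤ a (suc N) + int 1 / suc N
    upper m le = subst (λ x → a x ≤ a (suc N) + int 1 / suc N) (ℕP.m+[n∸m]≡n le) (below N (m ℕ.∸ suc N))
    1/N≤ε : int 1 / suc N ≤ ε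
    1/N≤ε = *-cancelˡ-≤-pos (fromℕ (suc N)) {{positive (0<fromℕ-suc N)}} (begin
      fromℕ (suc N) * (int 1 / suc N)    ≡⟨ fromℕ-*-1/ N ⟩
      1ℚ                                 ≤⟨ proj₂ (archimedean 1ℚ 0<ε) ⟩
      fromℕ N * ε                        ≤⟨ *-monoʳ-≤-nonNeg ε {{nonNegative (<⇒≤ 0<ε)}} (fromℕ-mono {N} {suc N} (ℕP.n≤1+n N)) ⟩
      fromℕ (suc N) * ε                  ∎)

-- ln k = ∫₁ᵏ dx / x: Σ_{N < j ≤ k N} 1 / j is the Riemann sum of this integral
-- with right end points and step 1 / N.
ln : (k : ℕ) .{{_ : ℕ.NonZero k}} → ℝ
ln k = mkℝ (lnSeq k) (lnSeq-cauchy k)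

infixl 6 _+ᶜ_ _-ᶜ_
infixl 7 _·_
infixr 8 _^-_

0ᶜ : ℂ
0ᶜ = fromℚ 0ℚ +i fromℚ 0ℚ

_+ᶜ_ _-ᶜ_ : ℂ → ℂ → ℂ
(a +i b) +ᶜ (c +i d) = (a +ᴿ c) +i (b +ᴿ d)
(a +i b) -ᶜ (c +i d) = (a -ᴿ c) +i (b -ᴿ d)

_·_ : ℝ → ℂ → ℂ
r · (a +i b) = (r *ᴿ a) +i (r *ᴿ b)

∣_∣² : ℂ → ℝ
∣ a +i b ∣² = a *ᴿ a +ᴿ b *ᴿ b

_^-_ : (k : ℕ) .{{_ : ℕ.NonZero k}} → ℂ → ℂ
k ^- s = exp ((-ᴿ ln k) · s)

-- Σ_{1 ≤ k ≤ K} f(k) k^(-s); the value f(0) is not used.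
dirichletSum : (ℕ → ℕ) → ℂ → ℕ → ℂ
dirichletSum f s zero    = 0ᶜ
dirichletSum f s (suc K) = dirichletSum f s K +ᶜ fromℚ (fromℕ (f (suc K))) · suc K ^- s

-- The condition is ∣ u n - L ∣ ≤ ε, squared to avoid the square root.
_⟶_ : (ℕ → ℂ) → ℂ → Set
u ⟶ L = ∀ ε → 0ℚ < ε →
  ∃ λ N → ∀ n → N ℕ.≤ n → ∣ u n -ᶜ L ∣² ≤ᴿ fromℚ (ε * ε)

DirichletSeriesDiverges : (ℕ → ℕ) → ℂ → Set
DirichletSeriesDiverges f s = ¬ (∃ λ L → dirichletSum f s ⟶ L)

_-ⱽ_ _+ⱽ_ _*ⱽ_ : ∀ {n} → Vec ℤ n → Vec ℤ n → Vec ℤ n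
_+ⱽ_ = Vec.zipWith ℤ._+_
_-ⱽ_ = Vec.zipWith ℤ._-_
_*ⱽ_ = Vec.zipWith ℤ._*_

-ⱽ_ : ∀ {n} → Vec ℤ n → Vec ℤ n
-ⱽ_ = Vec.map (λ a → ℤ.- a)

0ⱽ 1ⱽ : ∀ {n} → Vec ℤ n
0ⱽ = Vec.replicate _ ℤ.0ℤ
1ⱽ = Vec.replicate _ ℤ.1ℤ

record IsSubring {n} (P : Pred (Vec ℤ n) 0ℓ) : Set where
  field
    0∈ : 0ⱽ ∈ P
    +∈ : ∀ {x y} → x ∈ P → y ∈ P → (x +ⱽ y) ∈ P
    -∈ : ∀ {x} → x ∈ P → (-ⱽ x) ∈ P
    1∈ : 1ⱽ ∈ P
    *∈ : ∀ {x y} → x ∈ P → y ∈ P → (x *ⱽ y) ∈ P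

-- coset x is the number of the coset x + P in some numbering 0, …, k - 1 of
-- all cosets.  Having it as data makes P decidable.
record HasIndex {n} (P : Pred (Vec ℤ n) 0ℓ) (k : ℕ) : Set where
  field
    coset            : Vec ℤ n → Fin k
    coset-surjective : ∀ i → ∃ λ x → coset x ≡ i
    coset-≡          : ∀ {x y} → coset x ≡ coset y → (x -ⱽ y) ∈ P
    ≡-coset          : ∀ {x y} → (x -ⱽ y) ∈ P → coset x ≡ coset y

record SubringOfIndex (n k : ℕ) : Set₁ where
  field
    subset    : Pred (Vec ℤ n) 0ℓ
    isSubring : IsSubring subset
    hasIndex  : HasIndex subset k
  open IsSubring isSubring public
  open HasIndex hasIndex public

-- Two subrings are equal if they have the same elements; the numbering of the
-- cosets is irrelevant.
SubringsOfIndex : ℕ → ℕ → Setoid _ _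
SubringsOfIndex n k = record
  { Carrier       = SubringOfIndex n k
  ; _≈_           = λ S T → SubringOfIndex.subset S ≐ SubringOfIndex.subset T
  ; isEquivalence = record
    { refl  = (λ p → p) , (λ p → p)
    ; sym   = λ (p , q) → q , p
    ; trans = λ (p , q) (r , s) → (λ x → r (p x)) , (λ x → q (s x))
    }
  }

HasCardinality : ∀ {a ℓ} → Setoid a ℓ → ℕ → Set _
HasCardinality S m = Inverse (setoid (Fin m)) S

module _ {a ℓ} (DS : DecSetoid a ℓ) where
  private
    module DS = DecSetoid DS
    S = DS.setoid

  lookup-injective : ∀ {xs} → Unique S xs → ∀ i j → List.lookup xs i DS.≈ List.lookup xs j → i ≡ j
  lookup-injective (_ ∷ _)  zero    zero    _  = refl
  lookup-injective (p ∷ _)  zero    (suc j) eq = ⊥-elim (All.lookup p (∈-lookup j) eq)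
  lookup-injective (p ∷ _)  (suc i) zero    eq = ⊥-elim (All.lookup p (∈-lookup i) (DS.sym eq))
  lookup-injective (_ ∷ ps) (suc i) (suc j) eq = cong suc (lookup-injective ps i j eq)

  enumerated⇒finite : ∀ xs → IsEnumeration S xs → ∃ (HasCardinality S)
  enumerated⇒finite xs xs-complete = List.length ys , record
    { to        = List.lookup ys
    ; from      = λ s → Any.index (ys-complete s)
    ; to-cong   = λ { refl → DS.refl }
    ; from-cong = λ {s} {t} s≈t → lookup-injective ys-unique _ _
        (DS.trans (DS.sym (position s)) (DS.trans s≈t (position t)))
    ; inverse   = (λ { {s} refl → DS.sym (position s) })
                , (λ {i} {s} s≈ → lookup-injective ys-unique _ _ (DS.trans (DS.sym (position s)) s≈))
    }
    where
    ys = List.deduplicate DS._≟_ xs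
    ys-unique : Unique S ys
    ys-unique = deduplicate-! DS xs
    ys-complete : IsEnumeration S ys
    ys-complete s = ∈-deduplicate⁺ S DS._≟_ (λ y≈x z≈y → DS.trans z≈y (DS.sym y≈x)) (xs-complete s)
    position : ∀ s → s DS.≈ List.lookup ys (Any.index (ys-complete s))
    position s = AnyP.lookup-index (ys-complete s)

-- Every subring of index k contains k! ℤⁿ, so it is determined by the cosets
-- of the finitely many representatives modulo k!.
module Residues (M : ℕ) .{{_ : ℕ.NonZero M}} where

  red₁ : ℤ → Fin M
  red₁ a = fromℕ< (ℤD.n%ℕd<d a M)

  rep₁ : Fin M → ℤ
  rep₁ i = int (toℕ i)

  red : ∀ {n} → Vec ℤ n → Vec (Fin M) n
  red = Vec.map red₁

  rep : ∀ {n} → Vec (Fin M) n → Vec ℤ n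
  rep = Vec.map rep₁

  quot : ∀ {n} → Vec ℤ n → Vec ℤ n
  quot = Vec.map (ℤD._/ℕ M)

  abstract

    division : ∀ a → a ≡ rep₁ (red₁ a) ℤ.+ (a ℤD./ℕ M) ℤ.* int M
    division a = trans (ℤD.a≡a%ℕn+[a/ℕn]*n a M)
      (cong (λ r → int r ℤ.+ (a ℤD./ℕ M) ℤ.* int M) (sym (FinP.toℕ-fromℕ< (ℤD.n%ℕd<d a M))))

    red₁-unique : ∀ a b q → a ≡ b ℤ.+ q ℤ.* int M → red₁ a ≡ red₁ b
    red₁-unique a b q a≡b+qM = FinP.toℕ-injective (ℤP.+-injective (ℤP.i-j≡0⇒i≡j (rep₁ r) (rep₁ s) (trans difference vanish)))
      where
      open ≡-Reasoning
      r s : Fin M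
      r = red₁ a
      s = red₁ b
      t : ℤ
      t = (b ℤD./ℕ M) ℤ.+ q ℤ.- (a ℤD./ℕ M)
      rearrange : ∀ (r s u v q m : ℤ) → (s ℤ.+ v ℤ.* m ℤ.+ q ℤ.* m ℤ.- u ℤ.* m) ℤ.- s ≡ (v ℤ.+ q ℤ.- u) ℤ.* m
      rearrange = ℤS.solve 6 (λ r s u v q m → (s ℤS.:+ v ℤS.:* m ℤS.:+ q ℤS.:* m ℤS.:- u ℤS.:* m) ℤS.:- s
        ℤS.:= (v ℤS.:+ q ℤS.:- u) ℤS.:* m) refl
      isolate : ∀ r u → r ≡ (r ℤ.+ u) ℤ.- u
      isolate = ℤS.solve 2 (λ r u → r ℤS.:= (r ℤS.:+ u) ℤS.:- u) refl
      difference : rep₁ r ℤ.- rep₁ s ≡ t ℤ.* int M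
      difference = begin
        rep₁ r ℤ.- rep₁ s
          ≡⟨ cong (ℤ._- rep₁ s) (isolate (rep₁ r) ((a ℤD./ℕ M) ℤ.* int M)) ⟩
        (rep₁ r ℤ.+ (a ℤD./ℕ M) ℤ.* int M ℤ.- (a ℤD./ℕ M) ℤ.* int M) ℤ.- rep₁ s
          ≡⟨ cong (λ x → (x ℤ.- (a ℤD./ℕ M) ℤ.* int M) ℤ.- rep₁ s) (trans (sym (division a)) (trans a≡b+qM (cong (ℤ._+ q ℤ.* int M) (division b)))) ⟩
        (rep₁ s ℤ.+ (b ℤD./ℕ M) ℤ.* int M ℤ.+ q ℤ.* int M ℤ.- (a ℤD./ℕ M) ℤ.* int M) ℤ.- rep₁ s
          ≡⟨ rearrange (rep₁ r) (rep₁ s) (a ℤD./ℕ M) (b ℤD./ℕ M) q (int M) ⟩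
        t ℤ.* int M
          ∎
      small : ℤ.∣ t ∣ ℕ.* M ℕ.< M
      small = ℕP.≤-<-trans (ℕP.≤-reflexive (begin
        ℤ.∣ t ∣ ℕ.* M                  ≡⟨ sym (ℤP.abs-* t (int M)) ⟩
        ℤ.∣ t ℤ.* int M ∣              ≡⟨ cong ℤ.∣_∣ (sym difference) ⟩
        ℤ.∣ rep₁ r ℤ.- rep₁ s ∣        ≡⟨ cong ℤ.∣_∣ (ℤP.m-n≡m⊖n (toℕ r) (toℕ s)) ⟩
        ℤ.∣ toℕ r ℤ.⊖ toℕ s ∣          ∎))
        (ℕP.≤-<-trans (ℤP.∣m⊝n∣≤m⊔n (toℕ r) (toℕ s)) (ℕP.⊔-lub (FinP.toℕ<n r) (FinP.toℕ<n s)))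
      zero-quotient : ∀ x → x ℕ.* M ℕ.< M → x ≡ 0
      zero-quotient zero    _  = refl
      zero-quotient (suc x) lt = ⊥-elim (ℕP.<⇒≱ lt (ℕP.m≤m+n M (x ℕ.* M)))
      vanish : t ℤ.* int M ≡ ℤ.0ℤ
      vanish = trans (cong (ℤ._* int M) (ℤP.∣i∣≡0⇒i≡0 {t} (zero-quotient ℤ.∣ t ∣ small))) (ℤP.*-zeroˡ (int M))

    red₁-- : ∀ a b → red₁ (a ℤ.- b) ≡ red₁ (rep₁ (red₁ a) ℤ.- rep₁ (red₁ b))
    red₁-- a b = red₁-unique (a ℤ.- b) (rep₁ (red₁ a) ℤ.- rep₁ (red₁ b)) ((a ℤD./ℕ M) ℤ.- (b ℤD./ℕ M))
      (trans (cong₂ ℤ._-_ (division a) (division b)) (rearrange (rep₁ (red₁ a)) (rep₁ (red₁ b)) (a ℤD./ℕ M) (b ℤD./ℕ M) (int M)))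
      where
      rearrange : ∀ r s u v m → (r ℤ.+ u ℤ.* m) ℤ.- (s ℤ.+ v ℤ.* m) ≡ (r ℤ.- s) ℤ.+ (u ℤ.- v) ℤ.* m
      rearrange = ℤS.solve 5 (λ r s u v m → (r ℤS.:+ u ℤS.:* m) ℤS.:- (s ℤS.:+ v ℤS.:* m)
        ℤS.:= (r ℤS.:- s) ℤS.:+ (u ℤS.:- v) ℤS.:* m) refl

    red₁-* : ∀ a b → red₁ (a ℤ.* b) ≡ red₁ (rep₁ (red₁ a) ℤ.* rep₁ (red₁ b))
    red₁-* a b = red₁-unique (a ℤ.* b) (rep₁ (red₁ a) ℤ.* rep₁ (red₁ b))
      (rep₁ (red₁ a) ℤ.* (b ℤD./ℕ M) ℤ.+ (a ℤD./ℕ M) ℤ.* rep₁ (red₁ b) ℤ.+ (a ℤD./ℕ M) ℤ.* (b ℤD./ℕ M) ℤ.* int M)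
      (trans (cong₂ ℤ._*_ (division a) (division b)) (rearrange (rep₁ (red₁ a)) (rep₁ (red₁ b)) (a ℤD./ℕ M) (b ℤD./ℕ M) (int M)))
      where
      rearrange : ∀ r s u v m → (r ℤ.+ u ℤ.* m) ℤ.* (s ℤ.+ v ℤ.* m) ≡ r ℤ.* s ℤ.+ (r ℤ.* v ℤ.+ u ℤ.* s ℤ.+ u ℤ.* v ℤ.* m) ℤ.* m
      rearrange = ℤS.solve 5 (λ r s u v m → (r ℤS.:+ u ℤS.:* m) ℤS.:* (s ℤS.:+ v ℤS.:* m)
        ℤS.:= r ℤS.:* s ℤS.:+ (r ℤS.:* v ℤS.:+ u ℤS.:* s ℤS.:+ u ℤS.:* v ℤS.:* m) ℤS.:* m) refl

    red-- : ∀ {n} (x y : Vec ℤ n) → red (x -ⱽ y) ≡ red (rep (red x) -ⱽ rep (red y))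
    red-- []      []      = refl
    red-- (a ∷ x) (b ∷ y) = cong₂ _∷_ (red₁-- a b) (red-- x y)

    red-* : ∀ {n} (x y : Vec ℤ n) → red (x *ⱽ y) ≡ red (rep (red x) *ⱽ rep (red y))
    red-* []      []      = refl
    red-* (a ∷ x) (b ∷ y) = cong₂ _∷_ (red₁-* a b) (red-* x y)

    remainder : ∀ {n} (x : Vec ℤ n) → x -ⱽ rep (red x) ≡ Vec.map (int M ℤ.*_) (quot x)
    remainder []      = refl
    remainder (a ∷ x) = cong₂ _∷_ (trans (cong (ℤ._- rep₁ (red₁ a)) (division a)) (rearrange (rep₁ (red₁ a)) (a ℤD./ℕ M) (int M))) (remainder x)
      where
      rearrange : ∀ r q m → (r ℤ.+ q ℤ.* m) ℤ.- r ≡ m ℤ.* q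
      rearrange = ℤS.solve 3 (λ r q m → (r ℤS.:+ q ℤS.:* m) ℤS.:- r ℤS.:= m ℤS.:* q) refl

  ∀-residues? : ∀ {n} {P : Vec (Fin M) n → Set} → (∀ u → Dec (P u)) → Dec (∀ u → P u)
  ∀-residues? {zero}  P? = map′ (λ { p [] → p }) (λ f → f []) (P? [])
  ∀-residues? {suc n} P? = map′ (λ { f (i ∷ u) → f i u }) (λ f i u → f (i ∷ u))
    (FinP.all? (λ i → ∀-residues? (λ u → P? (i ∷ u))))

  ∃-residues? : ∀ {n} {P : Vec (Fin M) n → Set} → (∀ u → Dec (P u)) → Dec (∃ P)
  ∃-residues? {zero}  P? = map′ (λ p → [] , p) (λ { ([] , p) → p }) (P? [])
  ∃-residues? {suc n} P? = map′ (λ { (i , u , p) → i ∷ u , p }) (λ { (i ∷ u , p) → i , u , p })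
    (FinP.any? (λ i → ∃-residues? (λ u → P? (i ∷ u))))

  finFuns : ∀ {A : Set} m → List A → List (Fin m → A)
  finFuns zero    xs = (λ ()) ∷ []
  finFuns (suc m) xs = List.cartesianProductWith (λ { a g zero → a ; a g (suc i) → g i }) xs (finFuns m xs)

  finFuns-complete : ∀ {A : Set} (R : A → A → Set) xs m (f : Fin m → A) → (∀ i → Any (R (f i)) xs) →
    Any (λ g → ∀ i → R (f i) (g i)) (finFuns m xs)
  finFuns-complete R xs zero    f f∈ = here (λ ())
  finFuns-complete R xs (suc m) f f∈ = AnyP.cartesianProductWith⁺ _ (λ { p q zero → p ; p q (suc i) → q i })
    (f∈ zero) (finFuns-complete R xs m (λ i → f (suc i)) (λ i → f∈ (suc i)))

  residueFuns : ∀ k n → List (Vec (Fin M) n → Fin k)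
  residueFuns k zero    = List.map (λ i _ → i) (List.allFin k)
  residueFuns k (suc n) = List.map (λ g u → g (Vec.head u) (Vec.tail u)) (finFuns M (residueFuns k n))

  residueFuns-complete : ∀ k n (c : Vec (Fin M) n → Fin k) → Any (λ g → ∀ u → c u ≡ g u) (residueFuns k n)
  residueFuns-complete k zero    c = AnyP.map⁺ (Any.map (λ { eq [] → eq }) (∈-allFin (c [])))
  residueFuns-complete k (suc n) c = AnyP.map⁺ (Any.map (λ { eq (i ∷ u) → eq i u })
    (finFuns-complete (λ f g → ∀ u → f u ≡ g u) (residueFuns k n) M (λ i u → c (i ∷ u)) (λ i → residueFuns-complete k n (λ u → c (i ∷ u)))))

module Counting (n k : ℕ) where
  private instance
    k!≢0 : ℕ.NonZero (k !)
    k!≢0 = k ℕP.!≢0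
  open Residues (k !)

  -- A coset numbering c of the residues that comes from a subring of index k.
  record Valid (c : Vec (Fin (k !)) n → Fin k) : Set where
    field
      onto : ∀ i → ∃ λ u → c u ≡ i
      sub⇒ : ∀ u v → c u ≡ c v → c (red (rep u -ⱽ rep v)) ≡ c (red 0ⱽ)
      sub⇐ : ∀ u v → c (red (rep u -ⱽ rep v)) ≡ c (red 0ⱽ) → c u ≡ c v
      one  : c (red 1ⱽ) ≡ c (red 0ⱽ)
      mul  : ∀ u v → c u ≡ c (red 0ⱽ) → c v ≡ c (red 0ⱽ) → c (red (rep u *ⱽ rep v)) ≡ c (red 0ⱽ)

  valid? : ∀ c → Dec (Valid c)
  valid? c = map′
    (λ (p , q , r , s , t) → record { onto = p ; sub⇒ = q ; sub⇐ = r ; one = s ; mul = t })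
    (λ v → Valid.onto v , Valid.sub⇒ v , Valid.sub⇐ v , Valid.one v , Valid.mul v)
    (FinP.all? (λ i → ∃-residues? (λ u → c u FinP.≟ i))
      ×-dec ∀-residues? (λ u → ∀-residues? (λ v → (c u FinP.≟ c v) →-dec (c (red (rep u -ⱽ rep v)) FinP.≟ c (red 0ⱽ))))
      ×-dec ∀-residues? (λ u → ∀-residues? (λ v → (c (red (rep u -ⱽ rep v)) FinP.≟ c (red 0ⱽ)) →-dec (c u FinP.≟ c v)))
      ×-dec (c (red 1ⱽ) FinP.≟ c (red 0ⱽ))
      ×-dec ∀-residues? (λ u → ∀-residues? (λ v → (c u FinP.≟ c (red 0ⱽ)) →-dec ((c v FinP.≟ c (red 0ⱽ)) →-dec
              (c (red (rep u *ⱽ rep v)) FinP.≟ c (red 0ⱽ))))))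

  abstract

    0-x : ∀ {n} (x : Vec ℤ n) → 0ⱽ -ⱽ x ≡ -ⱽ x
    0-x []      = refl
    0-x (a ∷ x) = cong₂ _∷_ (ℤP.+-identityˡ (ℤ.- a)) (0-x x)

    x-0 : ∀ {n} (x : Vec ℤ n) → x -ⱽ 0ⱽ ≡ x
    x-0 []      = refl
    x-0 (a ∷ x) = cong₂ _∷_ (ℤP.+-identityʳ a) (x-0 x)

    x--y : ∀ {n} (x y : Vec ℤ n) → x -ⱽ (-ⱽ y) ≡ x +ⱽ y
    x--y []      []      = refl
    x--y (a ∷ x) (b ∷ y) = cong₂ _∷_ (cong (ℤ._+_ a) (ℤP.neg-involutive b)) (x--y x y)

    rep-red-rep : ∀ {n} (x : Vec ℤ n) → x +ⱽ (-ⱽ (x -ⱽ rep (red x))) ≡ rep (red x)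
    rep-red-rep []      = refl
    rep-red-rep (a ∷ x) = cong₂ _∷_ (cancel a (rep₁ (red₁ a))) (rep-red-rep x)
      where
      cancel : ∀ a b → a ℤ.+ (ℤ.- (a ℤ.- b)) ≡ b
      cancel = ℤS.solve 2 (λ a b → a ℤS.:+ (ℤS.:- (a ℤS.:- b)) ℤS.:= b) refl

    x≡rep+ : ∀ {n} (x : Vec ℤ n) → rep (red x) +ⱽ (x -ⱽ rep (red x)) ≡ x
    x≡rep+ []      = refl
    x≡rep+ (a ∷ x) = cong₂ _∷_ (cancel a (rep₁ (red₁ a))) (x≡rep+ x)
      where
      cancel : ∀ a b → b ℤ.+ (a ℤ.- b) ≡ a
      cancel = ℤS.solve 2 (λ a b → b ℤS.:+ (a ℤS.:- b) ℤS.:= a) refl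

    multiple-- : ∀ {n} i j → i ℕ.≤ j → (x : Vec ℤ n) →
      Vec.map (int j ℤ.*_) x -ⱽ Vec.map (int i ℤ.*_) x ≡ Vec.map (int (j ℕ.∸ i) ℤ.*_) x
    multiple-- i j i≤j []      = refl
    multiple-- i j i≤j (a ∷ x) = cong₂ _∷_ (trans (factor (int j) (int i) a)
      (cong (ℤ._* a) (trans (ℤP.m-n≡m⊖n j i) (ℤP.⊖-≥ i≤j)))) (multiple-- i j i≤j x)
      where
      factor : ∀ p q a → p ℤ.* a ℤ.- q ℤ.* a ≡ (p ℤ.- q) ℤ.* a
      factor = ℤS.solve 3 (λ p q a → p ℤS.:* a ℤS.:- q ℤS.:* a ℤS.:= (p ℤS.:- q) ℤS.:* a) refl

    multiple-0 : ∀ {n} (x : Vec ℤ n) → Vec.map (int 0 ℤ.*_) x ≡ 0ⱽ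
    multiple-0 []      = refl
    multiple-0 (a ∷ x) = cong₂ _∷_ (ℤP.*-zeroˡ a) (multiple-0 x)

    multiple-suc : ∀ {n} e (x : Vec ℤ n) → x +ⱽ Vec.map (int e ℤ.*_) x ≡ Vec.map (int (suc e) ℤ.*_) x
    multiple-suc e []      = refl
    multiple-suc e (a ∷ x) = cong₂ _∷_ (sym (ℤP.suc-* (int e) a)) (multiple-suc e x)

    multiple-* : ∀ {n} d e (x : Vec ℤ n) → Vec.map (int e ℤ.*_) (Vec.map (int d ℤ.*_) x) ≡ Vec.map (int (e ℕ.* d) ℤ.*_) x
    multiple-* d e []      = refl
    multiple-* d e (a ∷ x) = cong₂ _∷_ (trans (sym (ℤP.*-assoc (int e) (int d) a)) (cong (ℤ._* a) (sym (ℤP.pos-* e d)))) (multiple-* d e x)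

  fromValid : ∀ c → Valid c → SubringOfIndex n k
  fromValid c valid = record
    { subset    = P
    ; isSubring = record
      { 0∈ = refl
      ; +∈ = λ {x} {y} x∈ y∈ → subst P (x--y x y) (≡⇒ x (-ⱽ y) (trans x∈ (sym (neg∈ y y∈))))
      ; -∈ = λ {x} → neg∈ x
      ; 1∈ = one
      ; *∈ = λ {x} {y} x∈ y∈ → trans (cong c (red-* x y)) (mul (red x) (red y) x∈ y∈)
      }
    ; hasIndex  = record
      { coset            = κ
      ; coset-surjective = surjective
      ; coset-≡          = λ {x} {y} → ≡⇒ x y
      ; ≡-coset          = λ {x} {y} p → sub⇐ (red x) (red y) (trans (sym (cong c (red-- x y))) p)
      }
    }
    where
    open Valid valid
    κ : Vec ℤ n → Fin k
    κ x = c (red x)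
    P : Pred (Vec ℤ n) 0ℓ
    P x = κ x ≡ κ 0ⱽ
    ≡⇒ : ∀ x y → κ x ≡ κ y → P (x -ⱽ y)
    ≡⇒ x y eq = trans (cong c (red-- x y)) (sub⇒ (red x) (red y) eq)
    neg∈ : ∀ x → P x → P (-ⱽ x)
    neg∈ x x∈ = subst P (0-x x) (≡⇒ 0ⱽ x (sym x∈))
    surjective : ∀ i → ∃ λ x → κ x ≡ i
    surjective i with onto i
    ... | u , cu≡i = rep u , trans (cong c (red-rep u)) cu≡i
      where
      red-rep : ∀ {n} (u : Vec (Fin (k !)) n) → red (rep u) ≡ u
      red-rep []      = refl
      red-rep (j ∷ u) = cong₂ _∷_ (FinP.toℕ-injective
        (trans (FinP.toℕ-fromℕ< _) (ℕD.m<n⇒m%n≡m (FinP.toℕ<n j)))) (red-rep u)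

  module _ (S : SubringOfIndex n k) where
    open SubringOfIndex S

    ∈⇒coset-0 : ∀ {x} → x ∈ subset → coset x ≡ coset 0ⱽ
    ∈⇒coset-0 {x} x∈ = ≡-coset (subst subset (sym (x-0 x)) x∈)

    coset-0⇒∈ : ∀ {x} → coset x ≡ coset 0ⱽ → x ∈ subset
    coset-0⇒∈ {x} eq = subst subset (x-0 x) (coset-≡ eq)

    ∈? : ∀ x → Dec (x ∈ subset)
    ∈? x = map′ coset-0⇒∈ ∈⇒coset-0 (coset x FinP.≟ coset 0ⱽ)

    multiple-∈ : ∀ e {x} → x ∈ subset → Vec.map (int e ℤ.*_) x ∈ subset
    multiple-∈ zero    {x} x∈ = subst subset (sym (multiple-0 x)) 0∈
    multiple-∈ (suc e) {x} x∈ = subst subset (multiple-suc e x) (+∈ x∈ (multiple-∈ e x∈))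

    k!-∈ : ∀ x → Vec.map (int (k !) ℤ.*_) x ∈ subset
    k!-∈ x with FinP.pigeonhole (ℕP.n<1+n k) (λ (i : Fin (suc k)) → coset (Vec.map (int (toℕ i) ℤ.*_) x))
    ... | i , j , i<j , eq = subst (λ m → Vec.map (int m ℤ.*_) x ∈ subset) (sym (_∣_.equality d∣k!))
        (subst subset (multiple-* d (_∣_.quotient d∣k!) x) (multiple-∈ (_∣_.quotient d∣k!) dx∈))
      where
      d : ℕ
      d = toℕ j ℕ.∸ toℕ i
      dx∈ : Vec.map (int d ℤ.*_) x ∈ subset
      dx∈ = subst subset (multiple-- (toℕ i) (toℕ j) (ℕP.<⇒≤ i<j) x) (coset-≡ (sym eq))
      divides-! : ∀ d → 1 ℕ.≤ d → d ℕ.≤ k → d ∣ k !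
      divides-! (suc d) _ d≤k = ∣-trans (∣m⇒∣m*n (d !) ∣-refl) (m≤n⇒m!∣n! d≤k)
      d∣k! : d ∣ k !
      d∣k! = divides-! d (ℕP.m<n⇒0<n∸m i<j) (ℕP.≤-trans (ℕP.m∸n≤m (toℕ j) (toℕ i)) (ℕP.≤-pred (FinP.toℕ<n j)))

    difference-∈ : ∀ x → (x -ⱽ rep (red x)) ∈ subset
    difference-∈ x = subst subset (sym (remainder x)) (k!-∈ (quot x))

    coset-rep : ∀ x → coset (rep (red x)) ≡ coset x
    coset-rep x = sym (≡-coset (difference-∈ x))

    rep-∈ : ∀ {x} → x ∈ subset → rep (red x) ∈ subset
    rep-∈ {x} x∈ = subst subset (rep-red-rep x) (+∈ x∈ (-∈ (difference-∈ x)))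

    ∈-rep : ∀ {x} → rep (red x) ∈ subset → x ∈ subset
    ∈-rep {x} p = subst subset (x≡rep+ x) (+∈ p (difference-∈ x))

    numbering-valid : ∀ g → (∀ u → coset (rep u) ≡ g u) → Valid g
    numbering-valid g cosets = record
      { onto = λ i → red (proj₁ (coset-surjective i)) , trans (g-red _) (proj₂ (coset-surjective i))
      ; sub⇒ = λ u v eq → trans (g-red _) (trans (∈⇒coset-0 (coset-≡ (trans (cosets u) (trans eq (sym (cosets v)))))) (sym (g-red 0ⱽ)))
      ; sub⇐ = λ u v eq → trans (sym (cosets u)) (trans (≡-coset (coset-0⇒∈ (trans (sym (g-red _)) (trans eq (g-red 0ⱽ))))) (cosets v))
      ; one  = trans (g-red 1ⱽ) (trans (∈⇒coset-0 1∈) (sym (g-red 0ⱽ)))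
      ; mul  = λ u v p q → trans (g-red _) (trans (∈⇒coset-0 (*∈ (member u p) (member v q))) (sym (g-red 0ⱽ)))
      }
      where
      g-red : ∀ x → g (red x) ≡ coset x
      g-red x = trans (sym (cosets (red x))) (coset-rep x)
      member : ∀ u → g u ≡ g (red 0ⱽ) → rep u ∈ subset
      member u eq = coset-0⇒∈ (trans (cosets u) (trans eq (g-red 0ⱽ)))

    fromValid-≐ : ∀ g (cosets : ∀ u → coset (rep u) ≡ g u) (valid : Valid g) → subset ≐ SubringOfIndex.subset (fromValid g valid)
    fromValid-≐ g cosets valid =
        (λ {x} x∈ → trans (g-red x) (trans (∈⇒coset-0 x∈) (sym (g-red 0ⱽ))))
      , (λ {x} eq → coset-0⇒∈ (trans (sym (g-red x)) (trans eq (g-red 0ⱽ))))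
      where
      g-red : ∀ x → g (red x) ≡ coset x
      g-red x = trans (sym (cosets (red x))) (coset-rep x)

  SubringsOfIndexᵈ : DecSetoid _ _
  SubringsOfIndexᵈ = record
    { Carrier          = SubringOfIndex n k
    ; _≈_              = Setoid._≈_ (SubringsOfIndex n k)
    ; isDecEquivalence = record
      { isEquivalence = Setoid.isEquivalence (SubringsOfIndex n k)
      ; _≟_           = λ S T → map′
          (λ f → (λ {x} x∈ → ∈-rep T (proj₁ (f (red x)) (rep-∈ S x∈))) , (λ {x} x∈ → ∈-rep S (proj₂ (f (red x)) (rep-∈ T x∈))))
          (λ (p , q) u → (λ x∈ → p x∈) , (λ x∈ → q x∈))
          (∀-residues? (λ u → (∈? S (rep u) →-dec ∈? T (rep u)) ×-dec (∈? T (rep u) →-dec ∈? S (rep u))))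
      }
    }

  candidate : (Vec (Fin (k !)) n → Fin k) → List (SubringOfIndex n k)
  candidate c with valid? c
  ... | yes valid = fromValid c valid ∷ []
  ... | no  _     = []

  candidates : List (SubringOfIndex n k)
  candidates = List.concatMap candidate (residueFuns k n)

  candidates-complete : IsEnumeration (SubringsOfIndex n k) candidates
  candidates-complete S = AnyP.concatMap⁺ candidate (Any.map (λ {g} → found g) (residueFuns-complete k n (λ u → SubringOfIndex.coset S (rep u))))
    where
    found : ∀ g → (∀ u → SubringOfIndex.coset S (rep u) ≡ g u) →
      Any (λ T → SubringOfIndex.subset S ≐ SubringOfIndex.subset T) (candidate g)
    found g cosets with valid? g
    ... | yes valid   = here (fromValid-≐ S g cosets valid)
    ... | no ¬valid   = ⊥-elim (¬valid (numbering-valid S g cosets))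

abstract
  subringsOfIndex-finite : ∀ n k → ∃ (HasCardinality (SubringsOfIndex n k))
  subringsOfIndex-finite n k = enumerated⇒finite SubringsOfIndexᵈ candidates candidates-complete
    where open Counting n k

subringCount : ℕ → ℕ → ℕ
subringCount n k = proj₁ (subringsOfIndex-finite n k)

subringCount-correct : ∀ n k → HasCardinality (SubringsOfIndex n k) (subringCount n k)
subringCount-correct n k = proj₂ (subringsOfIndex-finite n k)

boundTerm : (n : ℕ) .{{_ : ℕ.NonTrivial n}} → ℕ → ℚ
boundTerm n@(suc (suc _)) d =
  int (d ℕ.* (n ℕ.∸ 1 ℕ.∸ d)) / (n ℕ.∸ 1 ℕ.+ d) + int 1 / (n ℕ.∸ 1 ℕ.+ d)

max₀≤d≤ : ℕ → (ℕ → ℚ) → ℚ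
max₀≤d≤ zero    g = g 0
max₀≤d≤ (suc m) g = max₀≤d≤ m g ⊔ g (suc m)

bound : (n : ℕ) .{{_ : ℕ.NonTrivial n}} → ℚ
bound n = max₀≤d≤ (n ℕ.∸ 1) (boundTerm n)

{-# OPTIONS --safe #-}
-- Let m = n - 1 + d and a = d (n - 1 - d).  For every N ≥ 1 (not only for
-- primes), each d × (n - 1 - d) matrix over ℤ/N gives a subring of ℤⁿ of index
-- Nᵐ, hence f(Nᵐ) ≥ Nᵃ.  If Re s ≤ (a + 1) / m, then the terms at k = Nᵐ have
-- absolute value at least c / N.  Now choose q so large that k ^ (- i Im s) turns
-- by at most a third of a radian while k runs from (q j)ᵐ to ((q + 1) j)ᵐ; this
-- does not depend on j.  After a rotation by the argument at the left end, all
-- terms of this block have nonnegative real part, and those at k = Nᵐ with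
-- q j < N ≤ (q + 1) j contribute at least a positive constant.  So the partial
-- sums are not Cauchy, even on the line Re s = (a + 1) / m.
--
-- All estimates are made for the rational approximants at one index r of the
-- Cauchy sequences, with r chosen after the block.
module Submission where

open import Defs
open import Algebra.Bundles using (CommutativeRing)
open import Algebra.Structures using (IsCommutativeRing)
import Algebra.Solver.Ring.AlmostCommutativeRing as ACR
import Algebra.Solver.Ring.Simple
open import Data.Empty using (⊥-elim)
open import Data.Fin using (Fin; zero; suc; toℕ; _↑ˡ_; _↑ʳ_; combine; funToFin; finToFun)
import Data.Fin.Properties as FinP
open import Data.Integer as ℤ using (ℤ; 0ℤ; 1ℤ; -1ℤ) renaming (+_ to int)
import Data.Integer.DivMod as ℤD
import Data.Integer.Divisibility.Signed as ℤ∣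
open ℤ∣ using () renaming (_∣_ to _∣ℤ_)
import Data.Integer.Properties as ℤP
import Data.Integer.Tactic.RingSolver as ℤT
open import Data.Nat as ℕ using (ℕ; zero; suc; NonTrivial)
import Data.Nat.DivMod as ℕD
import Data.Nat.Properties as ℕP
import Data.Nat.Solver
open import Data.Product using (∃; _×_; _,_; proj₁; proj₂)
open import Data.Rational
open import Data.Rational.Properties
open import Data.Rational.Solver using (module +-*-Solver)
open import Data.Sum using (inj₁; inj₂)
open import Data.Vec as Vec using (Vec; _∷_; lookup)
import Data.Vec.Properties as VecP
open import Function using (_∘_)
open import Function.Bundles using (Inverse)
open import Level using (0ℓ)
open import Relation.Binary.Bundles using (Setoid)
open import Relation.Binary.PropositionalEquality
open import Relation.Nullary using (¬_; Dec; yes; no)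
open import Relation.Nullary.Decidable using (map′; _×-dec_)
open import Relation.Unary using (Pred; _∈_; _≐_)
open +-*-Solver using (solve; _:+_; _:*_; _:-_; :-_; _:=_; con)
module ℕS = Data.Nat.Solver.+-*-Solver

-- Subrings from matrices over ℤ/N

-- The obstacle is the line Re s = (a + 1) / m at nonreal s. Terms of absolute value c / N do not
-- suffice there, because rotation may produce convergence: the sum of p^(-s) over the primes p
-- converges at s = 1 + i t for t ≠ 0. A block whose end points have bounded ratio must contain a
-- positive proportion of the admissible N, and this is why composite N are included: the N in (q j,
-- (q + 1) j] give j terms of size about 1 / (q j), whereas primes alone would give only about 1 /
-- log j.
--
-- For truncated series, exp (z + w) = exp z exp w holds up to an error, which is made uniform on a
-- ball containing all arguments of the block. In the k-th term the error is multiplied by f(k), so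
-- the truncation index can be chosen only once the block is fixed. Negative exponents use the same
-- formula: a lower bound for exp (- y) comes from an upper bound for exp y, and the comparison with
-- powers of N rests on exp (ln N) ≤ N.

module _ (M : ℕ) .{{_ : ℕ.NonZero M}} where
  open Residues M

  red₁-≡⇒∣ : ∀ a b → red₁ a ≡ red₁ b → int M ∣ℤ (a ℤ.- b)
  red₁-≡⇒∣ a b eq = ℤ∣.divides ((a ℤD./ℕ M) ℤ.- (b ℤD./ℕ M)) (begin
    a ℤ.- b
      ≡⟨ cong₂ ℤ._-_ (division a) (division b) ⟩
    (rep₁ (red₁ a) ℤ.+ (a ℤD./ℕ M) ℤ.* int M) ℤ.- (rep₁ (red₁ b) ℤ.+ (b ℤD./ℕ M) ℤ.* int M)
      ≡⟨ cong (λ r → (rep₁ (red₁ a) ℤ.+ (a ℤD./ℕ M) ℤ.* int M) ℤ.- (rep₁ r ℤ.+ (b ℤD./ℕ M) ℤ.* int M)) (sym eq) ⟩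
    (rep₁ (red₁ a) ℤ.+ (a ℤD./ℕ M) ℤ.* int M) ℤ.- (rep₁ (red₁ a) ℤ.+ (b ℤD./ℕ M) ℤ.* int M)
      ≡⟨ cancel (rep₁ (red₁ a)) (a ℤD./ℕ M) (b ℤD./ℕ M) (int M) ⟩
    ((a ℤD./ℕ M) ℤ.- (b ℤD./ℕ M)) ℤ.* int M ∎)
    where
    open ≡-Reasoning
    cancel : ∀ r u v m → (r ℤ.+ u ℤ.* m) ℤ.- (r ℤ.+ v ℤ.* m) ≡ (u ℤ.- v) ℤ.* m
    cancel = ℤT.solve-∀

  ∣⇒red₁-≡ : ∀ a b → int M ∣ℤ (a ℤ.- b) → red₁ a ≡ red₁ b
  ∣⇒red₁-≡ a b (ℤ∣.divides q eq) = red₁-unique a b q (trans (split a b) (cong (ℤ._+_ b) eq))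
    where
    split : ∀ a b → a ≡ b ℤ.+ (a ℤ.- b)
    split = ℤT.solve-∀

  red₁-rep₁ : ∀ i → red₁ (rep₁ i) ≡ i
  red₁-rep₁ i = FinP.toℕ-injective (trans (FinP.toℕ-fromℕ< _) (ℕD.m<n⇒m%n≡m (FinP.toℕ<n i)))

dot : ∀ {r} → (Fin r → ℤ) → (Fin r → ℤ) → ℤ
dot {zero}  a u = 0ℤ
dot {suc r} a u = a zero ℤ.* u zero ℤ.+ dot (a ∘ suc) (u ∘ suc)

dot-linear : ∀ {r} (a : Fin r → ℤ) p q {u v w : Fin r → ℤ} →
  (∀ i → w i ≡ p ℤ.* u i ℤ.+ q ℤ.* v i) → dot a w ≡ p ℤ.* dot a u ℤ.+ q ℤ.* dot a v
dot-linear {zero}  a p q eq = zeros p q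
  where
  zeros : ∀ p q → 0ℤ ≡ p ℤ.* 0ℤ ℤ.+ q ℤ.* 0ℤ
  zeros = ℤT.solve-∀
dot-linear {suc r} a p q {u} {v} {w} eq = trans
  (cong₂ (λ x y → a zero ℤ.* x ℤ.+ y) (eq zero) (dot-linear (a ∘ suc) p q (eq ∘ suc)))
  (regroup (a zero) p q (u zero) (v zero) (dot (a ∘ suc) (u ∘ suc)) (dot (a ∘ suc) (v ∘ suc)))
  where
  regroup : ∀ a p q u v x y → a ℤ.* (p ℤ.* u ℤ.+ q ℤ.* v) ℤ.+ (p ℤ.* x ℤ.+ q ℤ.* y) ≡
    p ℤ.* (a ℤ.* u ℤ.+ x) ℤ.+ q ℤ.* (a ℤ.* v ℤ.+ y)
  regroup = ℤT.solve-∀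

dot-cong : ∀ {r} (a : Fin r → ℤ) {u v : Fin r → ℤ} → (∀ i → u i ≡ v i) → dot a u ≡ dot a v
dot-cong {zero}  a eq = refl
dot-cong {suc r} a eq = cong₂ (λ x y → a zero ℤ.* x ℤ.+ y) (eq zero) (dot-cong (a ∘ suc) (eq ∘ suc))

∣-0 : ∀ k → k ∣ℤ 0ℤ
∣-0 k = ℤ∣.divides 0ℤ refl

∣-dot : ∀ {r} k (a : Fin r → ℤ) {u : Fin r → ℤ} → (∀ i → k ∣ℤ u i) → k ∣ℤ dot a u
∣-dot {zero}  k a k∣u = ∣-0 k
∣-dot {suc r} k a k∣u = ℤ∣.∣m∣n⇒∣m+n (ℤ∣.∣n⇒∣m*n (a zero) (k∣u zero)) (∣-dot k (a ∘ suc) (k∣u ∘ suc))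

dot-zero : ∀ {r} (a : Fin r → ℤ) {u : Fin r → ℤ} → (∀ i → u i ≡ 0ℤ) → dot a u ≡ 0ℤ
dot-zero {zero}  a eq = refl
dot-zero {suc r} a eq = cong₂ ℤ._+_ (trans (cong (a zero ℤ.*_) (eq zero)) (ℤP.*-zeroʳ (a zero))) (dot-zero (a ∘ suc) (eq ∘ suc))

single : ∀ {r} → ℤ → Fin r → Fin r → ℤ
single c zero    zero    = c
single c zero    (suc j) = 0ℤ
single c (suc i) zero    = 0ℤ
single c (suc i) (suc j) = single c i j

∣-single : ∀ {r} c (i j : Fin r) → c ∣ℤ single c i j
∣-single c zero    zero    = ℤ∣.∣-refl
∣-single c zero    (suc j) = ∣-0 c
∣-single c (suc i) zero    = ∣-0 c
∣-single c (suc i) (suc j) = ∣-single c i j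

dot-single : ∀ {r} (a : Fin r → ℤ) c i → dot a (single c i) ≡ a i ℤ.* c
dot-single a c zero    = trans (cong (ℤ._+_ (a zero ℤ.* c)) (dot-zero (a ∘ suc) (λ _ → refl))) (ℤP.+-identityʳ _)
dot-single a c (suc i) = trans (cong₂ ℤ._+_ (ℤP.*-zeroʳ (a zero)) (dot-single (a ∘ suc) c i)) (ℤP.+-identityˡ _)

-- Coordinates on ℤⁿ⁺¹ / ℤ 1: adding a multiple of the identity does not change them.
offset : ∀ {n} → Vec ℤ (suc n) → Fin n → ℤ
offset x i = lookup x (suc i) ℤ.- lookup x zero

module _ {n} (x y : Vec ℤ (suc n)) (i : Fin n) where

  -- The coefficients 1 are kept so that sums, differences and negatives all have the shape p u + q
  -- v of `dot-linear` and `carrier-linear`.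
  offset-+ : offset (x +ⱽ y) i ≡ 1ℤ ℤ.* offset x i ℤ.+ 1ℤ ℤ.* offset y i
  offset-+ = trans (cong₂ ℤ._-_ (VecP.lookup-zipWith _ (suc i) x y) (VecP.lookup-zipWith _ zero x y))
    (regroup (lookup x (suc i)) (lookup x zero) (lookup y (suc i)) (lookup y zero))
    where
    regroup : ∀ a b c d → (a ℤ.+ c) ℤ.- (b ℤ.+ d) ≡ 1ℤ ℤ.* (a ℤ.- b) ℤ.+ 1ℤ ℤ.* (c ℤ.- d)
    regroup = ℤT.solve-∀

  offset-- : offset (x -ⱽ y) i ≡ 1ℤ ℤ.* offset x i ℤ.+ -1ℤ ℤ.* offset y i
  offset-- = trans (cong₂ ℤ._-_ (VecP.lookup-zipWith _ (suc i) x y) (VecP.lookup-zipWith _ zero x y))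
    (regroup (lookup x (suc i)) (lookup x zero) (lookup y (suc i)) (lookup y zero))
    where
    regroup : ∀ a b c d → (a ℤ.- c) ℤ.- (b ℤ.- d) ≡ 1ℤ ℤ.* (a ℤ.- b) ℤ.+ -1ℤ ℤ.* (c ℤ.- d)
    regroup = ℤT.solve-∀

  -- With x = x₀ 1 + x′ and y = y₀ 1 + y′, the product has a part linear in x′ and y′ and the
  -- quadratic part x′ y′.
  offset-* : offset (x *ⱽ y) i ≡
    1ℤ ℤ.* (lookup y zero ℤ.* offset x i ℤ.+ lookup x zero ℤ.* offset y i) ℤ.+ 1ℤ ℤ.* (offset x i ℤ.* offset y i)
  offset-* = trans (cong₂ ℤ._-_ (VecP.lookup-zipWith _ (suc i) x y) (VecP.lookup-zipWith _ zero x y))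
    (regroup (lookup x (suc i)) (lookup x zero) (lookup y (suc i)) (lookup y zero))
    where
    regroup : ∀ a b c d → (a ℤ.* c) ℤ.- (b ℤ.* d) ≡
      1ℤ ℤ.* (d ℤ.* (a ℤ.- b) ℤ.+ b ℤ.* (c ℤ.- d)) ℤ.+ 1ℤ ℤ.* ((a ℤ.- b) ℤ.* (c ℤ.- d))
    regroup = ℤT.solve-∀

offset-neg : ∀ {n} (x : Vec ℤ (suc n)) i → offset (-ⱽ x) i ≡ -1ℤ ℤ.* offset x i ℤ.+ 0ℤ ℤ.* offset x i
offset-neg x i = trans (cong₂ ℤ._-_ (VecP.lookup-map (suc i) _ x) (VecP.lookup-map zero _ x))
  (regroup (lookup x (suc i)) (lookup x zero))
  where
  regroup : ∀ a b → ℤ.- a ℤ.- ℤ.- b ≡ -1ℤ ℤ.* (a ℤ.- b) ℤ.+ 0ℤ ℤ.* (a ℤ.- b)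
  regroup = ℤT.solve-∀

offset-const : ∀ {n} c (i : Fin n) → offset (Vec.replicate (suc n) c) i ≡ 0ℤ
offset-const c i = trans (cong (ℤ._- c) (VecP.lookup-replicate i c)) (ℤP.+-inverseʳ c)

funToFin-cong : ∀ {m n} {f g : Fin m → Fin n} → (∀ i → f i ≡ g i) → funToFin f ≡ funToFin g
funToFin-cong {zero}  eq = refl
funToFin-cong {suc m} eq = cong₂ combine (eq zero) (funToFin-cong (λ i → eq (suc i)))

funToFin-injective : ∀ {m n} {f g : Fin m → Fin n} → funToFin f ≡ funToFin g → ∀ i → f i ≡ g i
funToFin-injective {m} {n} {f} {g} eq i = trans (sym (FinP.finToFun-funToFin f i))
  (trans (cong (λ k → finToFun {n} {m} k i) eq) (FinP.finToFun-funToFin g i))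

finToFun-injective : ∀ m n {i j : Fin (m ℕ.^ n)} → (∀ k → finToFun {m} {n} i k ≡ finToFun {m} {n} j k) → i ≡ j
finToFun-injective m n {i} {j} eq = trans (sym (FinP.funToFin-finToFin {n} {m} i))
  (trans (funToFin-cong {n} {m} {finToFun {m} {n} i} {finToFun {m} {n} j} eq) (FinP.funToFin-finToFin {n} {m} j))

-- The subring ℤ 1 + N L, where L is the preimage of the graph of the matrix A
-- over ℤ/N under ℤⁿ → ℤⁿ/ℤ 1 → (ℤ/N)ʳ⁺ᵈ (n = 1 + r + d).  The offsets of its
-- elements are N times those of L, whence the modulus N² for the defect.
module GraphSubring (N r d : ℕ) .{{_ : ℕ.NonZero N}} (A : Fin d → Fin r → ℤ) where

  private
    instance
      N²≢0 : ℕ.NonZero (N ℕ.* N)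
      N²≢0 = ℕP.m*n≢0 N N
    module N  = Residues N
    module N² = Residues (N ℕ.* N)

  free : Vec ℤ (suc (r ℕ.+ d)) → Fin r → ℤ
  free x i = offset x (i ↑ˡ d)

  defect : Vec ℤ (suc (r ℕ.+ d)) → Fin d → ℤ
  defect x j = offset x (r ↑ʳ j) ℤ.- dot (A j) (free x)

  carrier : Pred (Vec ℤ (suc (r ℕ.+ d))) _
  carrier x = (∀ i → int N ∣ℤ free x i) × (∀ j → int (N ℕ.* N) ∣ℤ defect x j)

  defect-linear : ∀ p q {x y z} → (∀ i → offset z i ≡ p ℤ.* offset x i ℤ.+ q ℤ.* offset y i) →
    ∀ j → defect z j ≡ p ℤ.* defect x j ℤ.+ q ℤ.* defect y j
  defect-linear p q {x} {y} eq j = trans (cong₂ ℤ._-_ (eq (r ↑ʳ j)) (dot-linear (A j) p q (λ i → eq (i ↑ˡ d))))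
    (regroup p q (offset x (r ↑ʳ j)) (offset y (r ↑ʳ j)) (dot (A j) (free x)) (dot (A j) (free y)))
    where
    regroup : ∀ p q u v a b → (p ℤ.* u ℤ.+ q ℤ.* v) ℤ.- (p ℤ.* a ℤ.+ q ℤ.* b) ≡ p ℤ.* (u ℤ.- a) ℤ.+ q ℤ.* (v ℤ.- b)
    regroup = ℤT.solve-∀

  carrier-linear : ∀ p q {x y z} → (∀ i → offset z i ≡ p ℤ.* offset x i ℤ.+ q ℤ.* offset y i) →
    x ∈ carrier → y ∈ carrier → z ∈ carrier
  carrier-linear p q {x} {y} {z} eq (x₁ , x₂) (y₁ , y₂) =
      (λ i → subst (_ ∣ℤ_) (sym (eq (i ↑ˡ d))) (ℤ∣.∣m∣n⇒∣m+n (ℤ∣.∣n⇒∣m*n p (x₁ i)) (ℤ∣.∣n⇒∣m*n q (y₁ i))))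
    , (λ j → subst (_ ∣ℤ_) (sym (defect-linear p q {x} {y} {z} eq j)) (ℤ∣.∣m∣n⇒∣m+n (ℤ∣.∣n⇒∣m*n p (x₂ j)) (ℤ∣.∣n⇒∣m*n q (y₂ j))))

  const-∈ : ∀ c → Vec.replicate (suc (r ℕ.+ d)) c ∈ carrier
  const-∈ c = (λ i → subst (_ ∣ℤ_) (sym (offset-const c (i ↑ˡ d))) (∣-0 _))
    , (λ j → subst (_ ∣ℤ_) (sym (cong₂ ℤ._-_ (offset-const c (r ↑ʳ j)) (dot-zero (A j) (λ i → offset-const c (i ↑ˡ d))))) (∣-0 _))

  offset-∣ : ∀ {x} → x ∈ carrier → ∀ j → int N ∣ℤ offset x (r ↑ʳ j)
  offset-∣ {x} (x₁ , x₂) j = subst (_ ∣ℤ_) (split (offset x (r ↑ʳ j)) (dot (A j) (free x)))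
    (ℤ∣.∣m∣n⇒∣m+n (ℤ∣.∣-trans (subst (int N ∣ℤ_) (sym (ℤP.pos-* N N)) (ℤ∣.∣n⇒∣m*n (int N) ℤ∣.∣-refl)) (x₂ j)) (∣-dot (int N) (A j) x₁))
    where
    split : ∀ a b → (a ℤ.- b) ℤ.+ b ≡ a
    split = ℤT.solve-∀

  ∣-*-∣ : ∀ {a b} → int N ∣ℤ a → int N ∣ℤ b → int (N ℕ.* N) ∣ℤ a ℤ.* b
  ∣-*-∣ {a} {b} N∣a N∣b = subst (_∣ℤ a ℤ.* b) (sym (ℤP.pos-* N N))
    (ℤ∣.∣-trans (ℤ∣.*-monoʳ-∣ (int N) N∣b) (ℤ∣.*-monoˡ-∣ b N∣a))

  -- The linear part of a product stays in the lattice. In the quadratic part all offsets are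
  -- divisible by N², hence so is their image under `A`. No condition on `A` arises, and this is
  -- what makes the number of subrings as large as the number of matrices.
  *-∈ : ∀ {x y} → x ∈ carrier → y ∈ carrier → (x *ⱽ y) ∈ carrier
  *-∈ {x} {y} x∈@(x₁ , x₂) y∈@(y₁ , y₂) =
      (λ i → subst (_ ∣ℤ_) (sym (offset-* x y (i ↑ˡ d)))
        (ℤ∣.∣m∣n⇒∣m+n (ℤ∣.∣n⇒∣m*n 1ℤ (ℤ∣.∣m∣n⇒∣m+n (ℤ∣.∣n⇒∣m*n (lookup y zero) (x₁ i)) (ℤ∣.∣n⇒∣m*n (lookup x zero) (y₁ i))))
          (ℤ∣.∣n⇒∣m*n 1ℤ (ℤ∣.∣m⇒∣m*n (free y i) (x₁ i)))))
    , (λ j → subst (_ ∣ℤ_) (sym (defect-* j))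
        (ℤ∣.∣m∣n⇒∣m+n (ℤ∣.∣m∣n⇒∣m+n (ℤ∣.∣n⇒∣m*n (lookup y zero) (x₂ j)) (ℤ∣.∣n⇒∣m*n (lookup x zero) (y₂ j)))
          (ℤ∣.∣m∣n⇒∣m-n (∣-*-∣ (offset-∣ {x} x∈ j) (offset-∣ {y} y∈ j)) (∣-dot _ (A j) (λ i → ∣-*-∣ (x₁ i) (y₁ i))))))
    where
    defect-* : ∀ j → defect (x *ⱽ y) j ≡ (lookup y zero ℤ.* defect x j ℤ.+ lookup x zero ℤ.* defect y j) ℤ.+
      (offset x (r ↑ʳ j) ℤ.* offset y (r ↑ʳ j) ℤ.- dot (A j) (λ i → free x i ℤ.* free y i))
    defect-* j = trans (cong₂ ℤ._-_ (offset-* x y (r ↑ʳ j))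
        (trans (dot-linear (A j) 1ℤ 1ℤ (λ i → offset-* x y (i ↑ˡ d)))
          (cong (λ t → 1ℤ ℤ.* t ℤ.+ 1ℤ ℤ.* dot (A j) (λ i → free x i ℤ.* free y i))
            (dot-linear (A j) (lookup y zero) (lookup x zero) (λ i → refl)))))
      (regroup (lookup y zero) (lookup x zero) (offset x (r ↑ʳ j)) (offset y (r ↑ʳ j))
        (dot (A j) (free x)) (dot (A j) (free y)) (dot (A j) (λ i → free x i ℤ.* free y i)))
      where
      regroup : ∀ p q u v a b c → (1ℤ ℤ.* (p ℤ.* u ℤ.+ q ℤ.* v) ℤ.+ 1ℤ ℤ.* (u ℤ.* v)) ℤ.-
          (1ℤ ℤ.* (p ℤ.* a ℤ.+ q ℤ.* b) ℤ.+ 1ℤ ℤ.* c) ≡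
        (p ℤ.* (u ℤ.- a) ℤ.+ q ℤ.* (v ℤ.- b)) ℤ.+ (u ℤ.* v ℤ.- c)
      regroup = ℤT.solve-∀

  -- Coordinate zero is 0, so the remaining coordinates are the offsets.
  point : (Fin r → ℤ) → (Fin d → ℤ) → Vec ℤ (suc (r ℕ.+ d))
  point u v = 0ℤ ∷ (Vec.tabulate u Vec.++ Vec.tabulate v)

  free-point : ∀ u v i → free (point u v) i ≡ u i
  free-point u v i = trans (ℤP.+-identityʳ _)
    (trans (VecP.lookup-++ˡ (Vec.tabulate u) (Vec.tabulate v) i) (VecP.lookup∘tabulate u i))

  defect-point : ∀ u v j → defect (point u v) j ≡ v j ℤ.- dot (A j) u
  defect-point u v j = cong₂ ℤ._-_ (trans (ℤP.+-identityʳ _)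
    (trans (VecP.lookup-++ʳ (Vec.tabulate u) (Vec.tabulate v) j) (VecP.lookup∘tabulate v j)))
    (dot-cong (A j) (free-point u v))

  -- The pair (`free`, `defect`) is an additive surjection onto ℤʳ × ℤᵈ, and `carrier` is the
  -- preimage of N ℤʳ × N² ℤᵈ. Hence the quotient is (ℤ/N)ʳ × (ℤ/N²)ᵈ.
  coset : Vec ℤ (suc (r ℕ.+ d)) → Fin (N ℕ.^ r ℕ.* (N ℕ.* N) ℕ.^ d)
  coset x = combine (funToFin (λ i → N.red₁ (free x i))) (funToFin (λ j → N².red₁ (defect x j)))

  coset-surjective : ∀ k → ∃ λ x → coset x ≡ k
  coset-surjective k with FinP.combine-surjective {N ℕ.^ r} {(N ℕ.* N) ℕ.^ d} k
  ... | i , j , refl = point u v , cong₂ combine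
      (trans (funToFin-cong (λ a → trans (cong N.red₁ (free-point u v a)) (red₁-rep₁ N (finToFun {N} {r} i a)))) (FinP.funToFin-finToFin {r} {N} i))
      (trans (funToFin-cong (λ b → trans (cong N².red₁ (trans (defect-point u v b) (cancel (N².rep₁ (finToFun {N ℕ.* N} {d} j b)) (dot (A b) u)))) (red₁-rep₁ (N ℕ.* N) (finToFun {N ℕ.* N} {d} j b))))
        (FinP.funToFin-finToFin {d} {N ℕ.* N} j))
    where
    u : Fin r → ℤ
    u a = N.rep₁ (finToFun {N} {r} i a)
    -- The summand `dot (A b) u` makes the defect equal to the prescribed residue.
    v : Fin d → ℤ
    v b = N².rep₁ (finToFun {N ℕ.* N} {d} j b) ℤ.+ dot (A b) u
    cancel : ∀ a b → (a ℤ.+ b) ℤ.- b ≡ a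
    cancel = ℤT.solve-∀

  minus : ∀ a b → 1ℤ ℤ.* a ℤ.+ -1ℤ ℤ.* b ≡ a ℤ.- b
  minus = ℤT.solve-∀

  free-- : ∀ x y i → free (x -ⱽ y) i ≡ free x i ℤ.- free y i
  free-- x y i = trans (offset-- x y (i ↑ˡ d)) (minus (free x i) (free y i))

  defect-- : ∀ x y j → defect (x -ⱽ y) j ≡ defect x j ℤ.- defect y j
  defect-- x y j = trans (defect-linear 1ℤ -1ℤ {x} {y} {x -ⱽ y} (offset-- x y) j) (minus (defect x j) (defect y j))

  coset-≡ : ∀ {x y} → coset x ≡ coset y → (x -ⱽ y) ∈ carrier
  coset-≡ {x} {y} eq =
      (λ i → subst (_ ∣ℤ_) (sym (free-- x y i)) (red₁-≡⇒∣ N (free x i) (free y i) (funToFin-injective (proj₁ both) i)))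
    , (λ j → subst (_ ∣ℤ_) (sym (defect-- x y j)) (red₁-≡⇒∣ (N ℕ.* N) (defect x j) (defect y j) (funToFin-injective (proj₂ both) j)))
    where
    both = FinP.combine-injective (funToFin (λ i → N.red₁ (free x i))) (funToFin (λ j → N².red₁ (defect x j)))
      (funToFin (λ i → N.red₁ (free y i))) (funToFin (λ j → N².red₁ (defect y j))) eq

  ≡-coset : ∀ {x y} → (x -ⱽ y) ∈ carrier → coset x ≡ coset y
  ≡-coset {x} {y} (p , q) = cong₂ combine
    (funToFin-cong (λ i → ∣⇒red₁-≡ N (free x i) (free y i) (subst (_ ∣ℤ_) (free-- x y i) (p i))))
    (funToFin-cong (λ j → ∣⇒red₁-≡ (N ℕ.* N) (defect x j) (defect y j) (subst (_ ∣ℤ_) (defect-- x y j) (q j))))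

  subring : SubringOfIndex (suc (r ℕ.+ d)) (N ℕ.^ r ℕ.* (N ℕ.* N) ℕ.^ d)
  subring = record
    { subset    = carrier
    ; isSubring = record
      { 0∈ = const-∈ 0ℤ
      ; +∈ = λ {x} {y} → carrier-linear 1ℤ 1ℤ {x} {y} {x +ⱽ y} (offset-+ x y)
      ; -∈ = λ {x} x∈ → carrier-linear -1ℤ 0ℤ {x} {x} { -ⱽ x } (offset-neg x) x∈ x∈
      ; 1∈ = const-∈ 1ℤ
      ; *∈ = λ {x} {y} → *-∈ {x} {y}
      }
    ; hasIndex  = record
      { coset            = coset
      ; coset-surjective = coset-surjective
      ; coset-≡          = λ {x} {y} → coset-≡ {x} {y}
      ; ≡-coset          = λ {x} {y} → ≡-coset {x} {y}
      }
    }

  -- N times the graph point over the i-th unit vector; these elements recover `A` modulo N from the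
  -- subring.
  column : Fin r → Vec ℤ (suc (r ℕ.+ d))
  column i = point (single (int N) i) (λ j → A j i ℤ.* int N)

  column-∈ : ∀ i → column i ∈ carrier
  column-∈ i = (λ k → subst (_ ∣ℤ_) (sym (free-point _ _ k)) (∣-single (int N) i k))
    , (λ j → subst (_ ∣ℤ_) (sym (trans (defect-point _ _ j)
        (trans (cong (ℤ._-_ (A j i ℤ.* int N)) (dot-single (A j) (int N) i)) (ℤP.+-inverseʳ (A j i ℤ.* int N))))) (∣-0 _))

cardinality-≥ : ∀ {a ℓ l m} (S : Setoid a ℓ) → HasCardinality S m → (f : Fin l → Setoid.Carrier S) →
  (∀ i j → Setoid._≈_ S (f i) (f j) → i ≡ j) → l ℕ.≤ m
cardinality-≥ S numbering f separates = FinP.injective⇒≤ {f = λ i → Inverse.from numbering (f i)}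
  (λ {i} {j} eq → separates i j (S.trans (S.sym (Inverse.inverseˡ numbering refl)) (Inverse.inverseˡ numbering eq)))
  where module S = Setoid S

module _ (N r d : ℕ) .{{_ : ℕ.NonZero N}} where

  private
    module G = GraphSubring N r d

    -- Numbers below (Nʳ)ᵈ are read as d rows of r digits in base N, so they are in bijection with
    -- the matrices over ℤ/N.
    entry : Fin ((N ℕ.^ r) ℕ.^ d) → Fin d → Fin r → Fin N
    entry k j i = finToFun {N} {r} (finToFun {N ℕ.^ r} {d} k j) i

    matrix : Fin ((N ℕ.^ r) ℕ.^ d) → Fin d → Fin r → ℤ
    matrix k j i = int (toℕ (entry k j i))

    index-≡ : N ℕ.^ r ℕ.* (N ℕ.* N) ℕ.^ d ≡ N ℕ.^ (r ℕ.+ d ℕ.+ d)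
    index-≡ = begin
      N ℕ.^ r ℕ.* (N ℕ.* N) ℕ.^ d      ≡⟨ cong (λ M → N ℕ.^ r ℕ.* (N ℕ.* M) ℕ.^ d) (sym (ℕP.*-identityʳ N)) ⟩
      N ℕ.^ r ℕ.* (N ℕ.^ 2) ℕ.^ d      ≡⟨ cong (N ℕ.^ r ℕ.*_) (ℕP.^-*-assoc N 2 d) ⟩
      N ℕ.^ r ℕ.* N ℕ.^ (2 ℕ.* d)      ≡⟨ sym (ℕP.^-distribˡ-+-* N r (2 ℕ.* d)) ⟩
      N ℕ.^ (r ℕ.+ (d ℕ.+ (d ℕ.+ 0)))  ≡⟨ cong (N ℕ.^_) (trans (cong (λ e → r ℕ.+ (d ℕ.+ e)) (ℕP.+-identityʳ d)) (sym (ℕP.+-assoc r d d))) ⟩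
      N ℕ.^ (r ℕ.+ d ℕ.+ d)            ∎
      where open ≡-Reasoning

    -- A column of the first matrix lies in the subring of the second. Its defect there is N times a
    -- difference of entries and is divisible by N², so the entries agree modulo N.
    separates : ∀ k l → G.carrier (matrix k) ≐ G.carrier (matrix l) → k ≡ l
    separates k l (k⊆l , _) = finToFun-injective (N ℕ.^ r) d λ j → finToFun-injective N r λ i → same j i
      where
      same : ∀ j i → entry k j i ≡ entry l j i
      same j i = begin
        entry k j i                            ≡⟨ sym (red₁-rep₁ N (entry k j i)) ⟩
        Residues.red₁ N (matrix k j i)         ≡⟨ ∣⇒red₁-≡ N (matrix k j i) (matrix l j i) (ℤ∣.*-cancelʳ-∣ (int N) difference) ⟩
        Residues.red₁ N (matrix l j i)         ≡⟨ red₁-rep₁ N (entry l j i) ⟩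
        entry l j i                            ∎
        where
        open ≡-Reasoning
        difference : int N ℤ.* int N ∣ℤ (matrix k j i ℤ.- matrix l j i) ℤ.* int N
        difference = subst₂ _∣ℤ_ (ℤP.pos-* N N)
          (trans (G.defect-point (matrix l) (single (int N) i) (λ m → matrix k m i ℤ.* int N) j)
            (trans (cong (ℤ._-_ (matrix k j i ℤ.* int N)) (dot-single (matrix l j) (int N) i)) (factor (matrix k j i) (matrix l j i) (int N))))
          (proj₂ (k⊆l {G.column (matrix k) i} (G.column-∈ (matrix k) i)) j)
          where
          factor : ∀ a b c → a ℤ.* c ℤ.- b ℤ.* c ≡ (a ℤ.- b) ℤ.* c
          factor = ℤT.solve-∀

    -- The index is a variable with an equation, so that matching on `refl` replaces transporting
    -- the subrings along `index-≡`.
    embeds : ∀ k → k ≡ N ℕ.^ r ℕ.* (N ℕ.* N) ℕ.^ d → (N ℕ.^ r) ℕ.^ d ℕ.≤ subringCount (suc (r ℕ.+ d)) k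
    embeds k refl = cardinality-≥ (SubringsOfIndex (suc (r ℕ.+ d)) k) (subringCount-correct (suc (r ℕ.+ d)) k)
      (λ i → G.subring (matrix i)) separates

  subringCount-≥ : N ℕ.^ (d ℕ.* r) ℕ.≤ subringCount (suc (r ℕ.+ d)) (N ℕ.^ (r ℕ.+ d ℕ.+ d))
  subringCount-≥ = subst (ℕ._≤ subringCount (suc (r ℕ.+ d)) (N ℕ.^ (r ℕ.+ d ℕ.+ d)))
    (trans (ℕP.^-*-assoc N r d) (cong (N ℕ.^_) (ℕP.*-comm r d))) (embeds _ (sym index-≡))

-- Inequalities in ℚ

*-monoˡ : ∀ {a b c} → 0ℚ ≤ a → b ≤ c → a * b ≤ a * c
*-monoˡ {a} 0≤a = *-monoˡ-≤-nonNeg a {{nonNegative 0≤a}}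

*-monoʳ : ∀ {a b c} → 0ℚ ≤ a → b ≤ c → b * a ≤ c * a
*-monoʳ {a} 0≤a = *-monoʳ-≤-nonNeg a {{nonNegative 0≤a}}

*-cancelˡ : ∀ {a b c} → 0ℚ < a → a * b ≤ a * c → b ≤ c
*-cancelˡ {a} 0<a = *-cancelˡ-≤-pos a {{positive 0<a}}

p≤p+q : ∀ {p q} → 0ℚ ≤ q → p ≤ p + q
p≤p+q {p} {q} 0≤q = subst (_≤ p + q) (+-identityʳ p) (+-monoʳ-≤ p 0≤q)

+-cancelʳ-≤ : ∀ r {p q} → p + r ≤ q + r → p ≤ q
+-cancelʳ-≤ r {p} {q} le = subst₂ _≤_ (drop p r) (drop q r) (+-monoˡ-≤ (- r) le)
  where
  drop : ∀ p r → p + r - r ≡ p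
  drop = solve 2 (λ p r → p :+ r :- r := p) refl

p≤q⇒0≤q-p : ∀ {p q} → p ≤ q → 0ℚ ≤ q - p
p≤q⇒0≤q-p {p} {q} p≤q = subst (_≤ q - p) (+-inverseʳ p) (+-monoˡ-≤ (- p) p≤q)

p≤∣p∣ : ∀ p → p ≤ ∣ p ∣
p≤∣p∣ p with ≤-total 0ℚ p
... | inj₁ 0≤p = ≤-reflexive (sym (0≤p⇒∣p∣≡p 0≤p))
... | inj₂ p≤0 = ≤-trans p≤0 (0≤∣p∣ p)

≥-from-∣-∣ : ∀ {p q δ} → ∣ p - q ∣ ≤ δ → q ≤ p + δ
≥-from-∣-∣ {p} {q} {δ} close = begin
  q                    ≡⟨ solve 2 (λ p q → q := p :+ (q :- p)) refl p q ⟩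
  p + (q - p)          ≤⟨ +-monoʳ-≤ p (≤-trans (p≤∣p∣ (q - p)) (subst (_≤ δ) (∣-∣-swap p q) close)) ⟩
  p + δ                ∎
  where open ≤-Reasoning

<⇒≱ : ∀ {p q} → p < q → ¬ q ≤ p
<⇒≱ p<q q≤p = <-irrefl refl (<-≤-trans p<q q≤p)

0≤p*p : ∀ p → 0ℚ ≤ p * p
0≤p*p p with ≤-total 0ℚ p
... | inj₁ 0≤p = 0≤* 0≤p 0≤p
... | inj₂ p≤0 = subst (0ℚ ≤_) (solve 1 (λ p → (:- p) :* (:- p) := p :* p) refl p) (0≤* (neg-antimono-≤ p≤0) (neg-antimono-≤ p≤0))

∣p∣≤-from-square : ∀ {p q} → 0ℚ ≤ q → p * p ≤ q * q → ∣ p ∣ ≤ q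
∣p∣≤-from-square {p} {q} 0≤q p²≤q² with ∣ p ∣ ≤? q
... | yes ∣p∣≤q = ∣p∣≤q
... | no  ∣p∣≰q = ⊥-elim (<⇒≱ (begin-strict
    q * q            ≤⟨ *-monoˡ 0≤q (<⇒≤ q<∣p∣) ⟩
    q * ∣ p ∣        <⟨ *-monoˡ-<-pos (∣ p ∣) {{positive (≤-<-trans 0≤q q<∣p∣)}} q<∣p∣ ⟩
    ∣ p ∣ * ∣ p ∣    ≡⟨ sym (∣p*q∣≡∣p∣*∣q∣ p p) ⟩
    ∣ p * p ∣        ≡⟨ 0≤p⇒∣p∣≡p (0≤p*p p) ⟩
    p * p            ∎) p²≤q²)
  where
  open ≤-Reasoning
  q<∣p∣ : q < ∣ p ∣
  q<∣p∣ = ≰⇒> ∣p∣≰q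

⅓ ¼ ⅛ 2ℚ : ℚ
⅓ = int 1 / 3
¼ = ½ * ½
⅛ = ½ * ¼
2ℚ = fromℕ 2

0≤2 : 0ℚ ≤ 2ℚ
0≤2 = nonNegative⁻¹ 2ℚ

0≤1 : 0ℚ ≤ 1ℚ
0≤1 = nonNegative⁻¹ 1ℚ

-- Gaussian rationals

negᴳ : ℚ [i] → ℚ [i]
negᴳ (a +i b) = (- a) +i (- b)

0ᴳ 1ᴳ : ℚ [i]
0ᴳ = 0ℚ +i 0ℚ
1ᴳ = 1ℚ +i 0ℚ

ι : ℚ → ℚ [i]
ι q = q +i 0ℚ

ᴳ-isCommutativeRing : IsCommutativeRing _≡_ _+ᴳ_ _*ᴳ_ negᴳ 0ᴳ 1ᴳ
ᴳ-isCommutativeRing = record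
  { isRing = record
    { +-isAbelianGroup = record
      { isGroup = record
        { isMonoid = record
          { isSemigroup = record
            { isMagma = record { isEquivalence = isEquivalence ; ∙-cong = cong₂ _+ᴳ_ }
            ; assoc = λ (a +i b) (c +i d) (e +i f) → cong₂ _+i_ (+-assoc a c e) (+-assoc b d f)
            }
          ; identity = (λ (a +i b) → cong₂ _+i_ (+-identityˡ a) (+-identityˡ b))
                     , (λ (a +i b) → cong₂ _+i_ (+-identityʳ a) (+-identityʳ b))
          }
        ; inverse = (λ (a +i b) → cong₂ _+i_ (+-inverseˡ a) (+-inverseˡ b))
                  , (λ (a +i b) → cong₂ _+i_ (+-inverseʳ a) (+-inverseʳ b))
        ; ⁻¹-cong = cong negᴳ
        }
      ; comm = λ (a +i b) (c +i d) → cong₂ _+i_ (+-comm a c) (+-comm b d)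
      }
    ; *-cong = cong₂ _*ᴳ_
    ; *-assoc = λ (a +i b) (c +i d) (e +i f) → cong₂ _+i_
        (solve 6 (λ a b c d e f → (a :* c :- b :* d) :* e :- (a :* d :+ b :* c) :* f
          := a :* (c :* e :- d :* f) :- b :* (c :* f :+ d :* e)) refl a b c d e f)
        (solve 6 (λ a b c d e f → (a :* c :- b :* d) :* f :+ (a :* d :+ b :* c) :* e
          := a :* (c :* f :+ d :* e) :+ b :* (c :* e :- d :* f)) refl a b c d e f)
    ; *-identity = (λ (a +i b) → cong₂ _+i_
          (solve 2 (λ a b → con 1ℚ :* a :- con 0ℚ :* b := a) refl a b)
          (solve 2 (λ a b → con 1ℚ :* b :+ con 0ℚ :* a := b) refl a b))
      , (λ (a +i b) → cong₂ _+i_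
          (solve 2 (λ a b → a :* con 1ℚ :- b :* con 0ℚ := a) refl a b)
          (solve 2 (λ a b → a :* con 0ℚ :+ b :* con 1ℚ := b) refl a b))
    ; distrib = (λ (a +i b) (c +i d) (e +i f) → cong₂ _+i_
          (solve 6 (λ a b c d e f → a :* (c :+ e) :- b :* (d :+ f) := (a :* c :- b :* d) :+ (a :* e :- b :* f)) refl a b c d e f)
          (solve 6 (λ a b c d e f → a :* (d :+ f) :+ b :* (c :+ e) := (a :* d :+ b :* c) :+ (a :* f :+ b :* e)) refl a b c d e f))
      , (λ (a +i b) (c +i d) (e +i f) → cong₂ _+i_
          (solve 6 (λ a b c d e f → (c :+ e) :* a :- (d :+ f) :* b := (c :* a :- d :* b) :+ (e :* a :- f :* b)) refl a b c d e f)
          (solve 6 (λ a b c d e f → (c :+ e) :* b :+ (d :+ f) :* a := (c :* b :+ d :* a) :+ (e :* b :+ f :* a)) refl a b c d e f))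
    }
  ; *-comm = λ (a +i b) (c +i d) → cong₂ _+i_
      (solve 4 (λ a b c d → a :* c :- b :* d := c :* a :- d :* b) refl a b c d)
      (solve 4 (λ a b c d → a :* d :+ b :* c := c :* b :+ d :* a) refl a b c d)
  }

ᴳ-commutativeRing : CommutativeRing 0ℓ 0ℓ
ᴳ-commutativeRing = record { isCommutativeRing = ᴳ-isCommutativeRing }

_≟ᴳ_ : (z w : ℚ [i]) → Dec (z ≡ w)
(a +i b) ≟ᴳ (c +i d) = map′ (λ (p , q) → cong₂ _+i_ p q) (λ eq → cong Re eq , cong Im eq) (a ≟ c ×-dec b ≟ d)

module 𝔾 = CommutativeRing ᴳ-commutativeRing
module 𝔾S = Algebra.Solver.Ring.Simple (ACR.fromCommutativeRing ᴳ-commutativeRing) _≟ᴳ_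
open 𝔾S using () renaming (solve to solveᴳ; _:+_ to _⊕_; _:*_ to _⊗_; _:-_ to _⊖_; _:=_ to _⊜_; con to conᴳ)

•-ι : ∀ q z → q • z ≡ ι q *ᴳ z
•-ι q (a +i b) = cong₂ _+i_
  (solve 3 (λ q a b → q :* a := q :* a :- con 0ℚ :* b) refl q a b)
  (solve 3 (λ q a b → q :* b := q :* b :+ con 0ℚ :* a) refl q a b)

•-*ᴳ : ∀ q z w → q • (z *ᴳ w) ≡ z *ᴳ (q • w)
•-*ᴳ q (a +i b) (c +i d) = cong₂ _+i_
  (solve 5 (λ q a b c d → q :* (a :* c :- b :* d) := a :* (q :* c) :- b :* (q :* d)) refl q a b c d)
  (solve 5 (λ q a b c d → q :* (a :* d :+ b :* c) := a :* (q :* d) :+ b :* (q :* c)) refl q a b c d)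

expTermᴳ : ℚ [i] → ℕ → ℚ [i]
expTermᴳ z j = invFact j • z ^ᴳ j

expTermᴳ-suc : ∀ z j → fromℕ (suc j) • expTermᴳ z (suc j) ≡ z *ᴳ expTermᴳ z j
expTermᴳ-suc z j = trans (cong₂ _+i_ (component (Re (z ^ᴳ suc j))) (component (Im (z ^ᴳ suc j)))) (•-*ᴳ (invFact j) z (z ^ᴳ j))
  where
  component : ∀ x → fromℕ (suc j) * (invFact (suc j) * x) ≡ invFact j * x
  component x = trans (sym (*-assoc (fromℕ (suc j)) (invFact (suc j)) x)) (cong (_* x) (1/!-suc j))

•-cancel : ∀ n {z w} → fromℕ (suc n) • z ≡ fromℕ (suc n) • w → z ≡ w
•-cancel n {a +i b} {c +i d} eq = cong₂ _+i_ (component (cong Re eq)) (component (cong Im eq))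
  where
  component : ∀ {x y} → fromℕ (suc n) * x ≡ fromℕ (suc n) * y → x ≡ y
  component eq = ≤-antisym (*-cancelˡ (0<fromℕ-suc n) (≤-reflexive eq)) (*-cancelˡ (0<fromℕ-suc n) (≤-reflexive (sym eq)))

-- The functional equation of the exponential function

module CauchyProduct (z w : ℚ [i]) where

  a b : ℕ → ℚ [i]
  a = expTermᴳ z
  b = expTermᴳ w

  -- conv p n = Σ_{i ≤ n} a (p + i) * b (n - i).  The shift p is there for the
  -- induction; for p = 0, conv-suc is the recursion of (z + w)ⁿ / n!.
  conv : ℕ → ℕ → ℚ [i]
  conv p zero    = a p *ᴳ b zero
  conv p (suc n) = a p *ᴳ b (suc n) +ᴳ conv (suc p) n

  N : ℕ → ℚ [i]
  N k = ι (fromℕ k)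

  N-suc : ∀ k → N (suc k) ≡ 1ᴳ +ᴳ N k
  N-suc k = cong₂ _+i_ (fromℕ-suc k) refl

  N-+ : ∀ k l → N (k ℕ.+ l) ≡ N k +ᴳ N l
  N-+ k l = cong₂ _+i_ (fromℕ-+ k l) refl

  a-suc : ∀ j → N (suc j) *ᴳ a (suc j) ≡ z *ᴳ a j
  a-suc j = trans (sym (•-ι (fromℕ (suc j)) (a (suc j)))) (expTermᴳ-suc z j)

  b-suc : ∀ j → N (suc j) *ᴳ b (suc j) ≡ w *ᴳ b j
  b-suc j = trans (sym (•-ι (fromℕ (suc j)) (b (suc j)))) (expTermᴳ-suc w j)

  -- The weight p + n + 1 is split for each product as (p + i) + (n + 1 - i). By `a-suc` the first
  -- part lowers the index of `a` and gives a factor z; by `b-suc` the second lowers that of `b` and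
  -- gives w. At i = 0 the part p has nothing to lower to, which leaves the extra summand.
  conv-suc : ∀ p n → N (suc p ℕ.+ n) *ᴳ conv p (suc n) ≡ N p *ᴳ (a p *ᴳ b (suc n)) +ᴳ (z +ᴳ w) *ᴳ conv p n
  conv-suc p zero = begin
    N (suc p ℕ.+ 0) *ᴳ (a p *ᴳ b 1 +ᴳ a (suc p) *ᴳ b 0)
      ≡⟨ cong (λ k → N k *ᴳ (a p *ᴳ b 1 +ᴳ a (suc p) *ᴳ b 0)) (ℕP.+-identityʳ (suc p)) ⟩
    N (suc p) *ᴳ (a p *ᴳ b 1 +ᴳ a (suc p) *ᴳ b 0)
      ≡⟨ solveᴳ 5 (λ n x y u v → n ⊗ (x ⊗ y ⊕ u ⊗ v) ⊜ x ⊗ y ⊗ n ⊕ (n ⊗ u) ⊗ v) refl (N (suc p)) (a p) (b 1) (a (suc p)) (b 0) ⟩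
    a p *ᴳ b 1 *ᴳ N (suc p) +ᴳ (N (suc p) *ᴳ a (suc p)) *ᴳ b 0
      ≡⟨ cong₂ (λ n x → a p *ᴳ b 1 *ᴳ n +ᴳ x *ᴳ b 0) (N-suc p) (a-suc p) ⟩
    a p *ᴳ b 1 *ᴳ (1ᴳ +ᴳ N p) +ᴳ (z *ᴳ a p) *ᴳ b 0
      ≡⟨ solveᴳ 5 (λ n x y v z → x ⊗ y ⊗ (conᴳ 1ᴳ ⊕ n) ⊕ (z ⊗ x) ⊗ v ⊜ n ⊗ (x ⊗ y) ⊕ (x ⊗ (conᴳ 1ᴳ ⊗ y) ⊕ z ⊗ (x ⊗ v))) refl (N p) (a p) (b 1) (b 0) z ⟩
    N p *ᴳ (a p *ᴳ b 1) +ᴳ (a p *ᴳ (N 1 *ᴳ b 1) +ᴳ z *ᴳ (a p *ᴳ b 0))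
      ≡⟨ cong (λ x → N p *ᴳ (a p *ᴳ b 1) +ᴳ (a p *ᴳ x +ᴳ z *ᴳ (a p *ᴳ b 0))) (b-suc 0) ⟩
    N p *ᴳ (a p *ᴳ b 1) +ᴳ (a p *ᴳ (w *ᴳ b 0) +ᴳ z *ᴳ (a p *ᴳ b 0))
      ≡⟨ solveᴳ 5 (λ s x v z w → s ⊕ (x ⊗ (w ⊗ v) ⊕ z ⊗ (x ⊗ v)) ⊜ s ⊕ (z ⊕ w) ⊗ (x ⊗ v)) refl (N p *ᴳ (a p *ᴳ b 1)) (a p) (b 0) z w ⟩
    N p *ᴳ (a p *ᴳ b 1) +ᴳ (z +ᴳ w) *ᴳ (a p *ᴳ b 0) ∎
    where open ≡-Reasoning
  conv-suc p (suc n) = begin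
    N (suc p ℕ.+ suc n) *ᴳ (x *ᴳ y +ᴳ C)
      ≡⟨ solveᴳ 3 (λ n s c → n ⊗ (s ⊕ c) ⊜ n ⊗ s ⊕ n ⊗ c) refl (N (suc p ℕ.+ suc n)) (x *ᴳ y) C ⟩
    N (suc p ℕ.+ suc n) *ᴳ (x *ᴳ y) +ᴳ N (suc p ℕ.+ suc n) *ᴳ C
      ≡⟨ cong₂ (λ s k → s *ᴳ (x *ᴳ y) +ᴳ N k *ᴳ C) (trans (cong N (sym (ℕP.+-suc p (suc n)))) (N-+ p (suc (suc n)))) (ℕP.+-suc (suc p) n) ⟩
    (N p +ᴳ N (suc (suc n))) *ᴳ (x *ᴳ y) +ᴳ N (suc (suc p) ℕ.+ n) *ᴳ C
      ≡⟨ cong ((N p +ᴳ N (suc (suc n))) *ᴳ (x *ᴳ y) +ᴳ_) (conv-suc (suc p) n) ⟩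
    (N p +ᴳ N (suc (suc n))) *ᴳ (x *ᴳ y) +ᴳ (N (suc p) *ᴳ (a (suc p) *ᴳ b (suc n)) +ᴳ (z +ᴳ w) *ᴳ D)
      ≡⟨ solveᴳ 8 (λ q m x y k u v d → (q ⊕ m) ⊗ (x ⊗ y) ⊕ (k ⊗ (u ⊗ v) ⊕ d) ⊜ q ⊗ (x ⊗ y) ⊕ (x ⊗ (m ⊗ y) ⊕ ((k ⊗ u) ⊗ v ⊕ d)))
           refl (N p) (N (suc (suc n))) x y (N (suc p)) (a (suc p)) (b (suc n)) ((z +ᴳ w) *ᴳ D) ⟩
    N p *ᴳ (x *ᴳ y) +ᴳ (x *ᴳ (N (suc (suc n)) *ᴳ y) +ᴳ ((N (suc p) *ᴳ a (suc p)) *ᴳ b (suc n) +ᴳ (z +ᴳ w) *ᴳ D))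
      ≡⟨ cong₂ (λ s t → N p *ᴳ (x *ᴳ y) +ᴳ (x *ᴳ s +ᴳ (t *ᴳ b (suc n) +ᴳ (z +ᴳ w) *ᴳ D))) (b-suc (suc n)) (a-suc p) ⟩
    N p *ᴳ (x *ᴳ y) +ᴳ (x *ᴳ (w *ᴳ b (suc n)) +ᴳ ((z *ᴳ x) *ᴳ b (suc n) +ᴳ (z +ᴳ w) *ᴳ D))
      ≡⟨ solveᴳ 6 (λ s x v d z w → s ⊕ (x ⊗ (w ⊗ v) ⊕ ((z ⊗ x) ⊗ v ⊕ (z ⊕ w) ⊗ d)) ⊜ s ⊕ (z ⊕ w) ⊗ (x ⊗ v ⊕ d)) refl (N p *ᴳ (x *ᴳ y)) x (b (suc n)) D z w ⟩
    N p *ᴳ (x *ᴳ y) +ᴳ (z +ᴳ w) *ᴳ (x *ᴳ b (suc n) +ᴳ D) ∎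
    where
    open ≡-Reasoning
    x y C D : ℚ [i]
    x = a p
    y = b (suc (suc n))
    C = conv (suc p) (suc n)
    D = conv (suc p) n

  -- Both sides satisfy (n + 1) c(n + 1) = (z + w) c(n) with c(0) = 1, so binomial coefficients do
  -- not appear.
  conv-binomial : ∀ n → conv 0 n ≡ expTermᴳ (z +ᴳ w) n
  conv-binomial zero    = refl
  conv-binomial (suc n) = •-cancel n (begin
    fromℕ (suc n) • conv 0 (suc n)                          ≡⟨ •-ι (fromℕ (suc n)) (conv 0 (suc n)) ⟩
    N (suc n) *ᴳ conv 0 (suc n)                             ≡⟨ conv-suc 0 n ⟩
    N 0 *ᴳ (a 0 *ᴳ b (suc n)) +ᴳ (z +ᴳ w) *ᴳ conv 0 n       ≡⟨ solveᴳ 2 (λ x y → conᴳ 0ᴳ ⊗ x ⊕ y ⊜ y) refl (a 0 *ᴳ b (suc n)) ((z +ᴳ w) *ᴳ conv 0 n) ⟩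
    (z +ᴳ w) *ᴳ conv 0 n                                    ≡⟨ cong ((z +ᴳ w) *ᴳ_) (conv-binomial n) ⟩
    (z +ᴳ w) *ᴳ expTermᴳ (z +ᴳ w) n                         ≡⟨ sym (expTermᴳ-suc (z +ᴳ w) n) ⟩
    fromℕ (suc n) • expTermᴳ (z +ᴳ w) (suc n)               ∎)
    where open ≡-Reasoning

  -- For p = 0, the sum of the a i * b j with i + j < n.
  triangleSum : ℕ → ℕ → ℚ [i]
  triangleSum p zero    = 0ᴳ
  triangleSum p (suc n) = a p *ᴳ expSum (suc n) w +ᴳ triangleSum (suc p) n

  triangleSum-suc : ∀ p n → triangleSum p (suc n) ≡ triangleSum p n +ᴳ conv p n
  triangleSum-suc p zero    = solveᴳ 2 (λ x y → x ⊗ (conᴳ 0ᴳ ⊕ y) ⊕ conᴳ 0ᴳ ⊜ conᴳ 0ᴳ ⊕ x ⊗ y) refl (a p) (b 0)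
  triangleSum-suc p (suc n) = trans (cong (a p *ᴳ expSum (suc (suc n)) w +ᴳ_) (triangleSum-suc (suc p) n))
    (solveᴳ 5 (λ x e y t c → x ⊗ (e ⊕ y) ⊕ (t ⊕ c) ⊜ (x ⊗ e ⊕ t) ⊕ (x ⊗ y ⊕ c)) refl
      (a p) (expSum (suc n) w) (b (suc n)) (triangleSum (suc p) n) (conv (suc p) n))

  triangleSum-exp : ∀ n → triangleSum 0 n ≡ expSum n (z +ᴳ w)
  triangleSum-exp zero    = refl
  triangleSum-exp (suc n) = trans (triangleSum-suc 0 n) (cong₂ _+ᴳ_ (triangleSum-exp n) (conv-binomial n))

  -- An exponential sum that grows at the front, to match the recursion of `triangleSum`; `expSum`
  -- grows at the end.
  frontSum : ℕ → ℕ → ℚ [i]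
  frontSum p zero    = 0ᴳ
  frontSum p (suc n) = a p +ᴳ frontSum (suc p) n

  frontSum-suc : ∀ p n → frontSum p (suc n) ≡ frontSum p n +ᴳ a (p ℕ.+ n)
  frontSum-suc p zero    = trans (𝔾.+-comm (a p) 0ᴳ) (cong (λ k → 0ᴳ +ᴳ a k) (sym (ℕP.+-identityʳ p)))
  frontSum-suc p (suc n) = trans (cong (a p +ᴳ_) (trans (frontSum-suc (suc p) n) (cong (λ k → frontSum (suc p) n +ᴳ a k) (sym (ℕP.+-suc p n)))))
    (sym (𝔾.+-assoc (a p) (frontSum (suc p) n) (a (p ℕ.+ suc n))))

  frontSum-exp : ∀ n → frontSum 0 n ≡ expSum n z
  frontSum-exp zero    = refl
  frontSum-exp (suc n) = trans (frontSum-suc 0 n) (cong (_+ᴳ a n) (frontSum-exp n))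

-- expTermSum is the same sum, but abstract, so that it does not unfold here.
realExpSum : ℕ → ℚ → ℚ
realExpSum zero    x = 0ℚ
realExpSum (suc n) x = realExpSum n x + expTerm x n

0≤realExpSum : ∀ n {x} → 0ℚ ≤ x → 0ℚ ≤ realExpSum n x
0≤realExpSum zero    0≤x = ≤-refl
0≤realExpSum (suc n) 0≤x = 0≤+ (0≤realExpSum n 0≤x) (0≤expTerm 0≤x n)

ι-^ : ∀ x j → ι x ^ᴳ j ≡ ι (pow x j)
ι-^ x zero    = refl
ι-^ x (suc j) = trans (cong (ι x *ᴳ_) (ι-^ x j)) (cong₂ _+i_
  (solve 2 (λ x p → x :* p :- con 0ℚ :* con 0ℚ := x :* p) refl x (pow x j))
  (solve 2 (λ x p → x :* con 0ℚ :+ con 0ℚ :* p := con 0ℚ) refl x (pow x j)))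

expSum-ι : ∀ n x → expSum n (ι x) ≡ ι (realExpSum n x)
expSum-ι zero    x = refl
expSum-ι (suc n) x = cong₂ _+ᴳ_ (expSum-ι n x) (trans (cong (invFact n •_) (ι-^ x n)) (cong (expTerm x n +i_) (*-zeroʳ (invFact n))))

1≤realExpSum : ∀ n {x} → 0ℚ ≤ x → 1ℚ ≤ realExpSum (suc n) x
1≤realExpSum zero    0≤x = ≤-refl
1≤realExpSum (suc n) 0≤x = ≤-trans (1≤realExpSum n 0≤x) (p≤p+q (0≤expTerm 0≤x (suc n)))

realExpSum-mono : ∀ n {x y} → 0ℚ ≤ x → x ≤ y → realExpSum n x ≤ realExpSum n y
realExpSum-mono zero    0≤x x≤y = ≤-refl
realExpSum-mono (suc n) 0≤x x≤y = +-mono-≤ (realExpSum-mono n 0≤x x≤y) (*-monoˡ (0≤1/! n) (pow-mono 0≤x x≤y n))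

-- The mean value bound, with the derivative taken at the right end point.
pow-increment : ∀ {x h} → 0ℚ ≤ x → 0ℚ ≤ h → ∀ j → pow (x + h) (suc j) ≤ pow x (suc j) + fromℕ (suc j) * (h * pow (x + h) j)
pow-increment {x} {h} 0≤x 0≤h zero    = ≤-reflexive (solve 2 (λ x h → (x :+ h) :* con 1ℚ := x :* con 1ℚ :+ con 1ℚ :* (h :* con 1ℚ)) refl x h)
pow-increment {x} {h} 0≤x 0≤h (suc j) = begin
  (x + h) * Q
    ≡⟨ *-distribʳ-+ Q x h ⟩
  x * Q + h * Q
    ≤⟨ +-monoˡ-≤ (h * Q) (*-monoˡ 0≤x (pow-increment 0≤x 0≤h j)) ⟩
  x * (pow x (suc j) + k * (h * P)) + h * Q
    ≡⟨ solve 6 (λ x p k h q r → x :* (p :+ k :* (h :* q)) :+ h :* r := x :* p :+ (k :* h :* (x :* q) :+ h :* r)) refl x (pow x (suc j)) k h P Q ⟩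
  x * pow x (suc j) + (k * h * (x * P) + h * Q)
    ≤⟨ +-monoʳ-≤ (x * pow x (suc j)) (+-monoˡ-≤ (h * Q) (*-monoˡ (0≤* (0≤fromℕ (suc j)) 0≤h) (*-monoʳ {P} {x} {x + h} (0≤pow (0≤+ 0≤x 0≤h) j) (p≤p+q 0≤h)))) ⟩
  x * pow x (suc j) + (k * h * Q + h * Q)
    ≡⟨ solve 4 (λ s k h q → s :+ (k :* h :* q :+ h :* q) := s :+ (con 1ℚ :+ k) :* (h :* q)) refl (x * pow x (suc j)) k h Q ⟩
  x * pow x (suc j) + (1ℚ + k) * (h * Q)
    ≡⟨ cong (λ m → x * pow x (suc j) + m * (h * Q)) (sym (fromℕ-suc (suc j))) ⟩
  x * pow x (suc j) + fromℕ (suc (suc j)) * (h * Q) ∎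
  where
  open ≤-Reasoning
  k P Q : ℚ
  k = fromℕ (suc j)
  P = pow (x + h) j
  Q = (x + h) * P

expTerm-increment : ∀ {x h} → 0ℚ ≤ x → 0ℚ ≤ h → ∀ j → expTerm (x + h) (suc j) ≤ expTerm x (suc j) + h * expTerm (x + h) j
expTerm-increment {x} {h} 0≤x 0≤h j = begin
  f * pow (x + h) (suc j)                                 ≤⟨ *-monoˡ (0≤1/! (suc j)) (pow-increment 0≤x 0≤h j) ⟩
  f * (pow x (suc j) + fromℕ (suc j) * (h * P))           ≡⟨ solve 5 (λ f p k h q → f :* (p :+ k :* (h :* q)) := f :* p :+ h :* (k :* f :* q)) refl f (pow x (suc j)) (fromℕ (suc j)) h P ⟩
  f * pow x (suc j) + h * (fromℕ (suc j) * f * P)         ≡⟨ cong (λ m → f * pow x (suc j) + h * (m * P)) (1/!-suc j) ⟩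
  f * pow x (suc j) + h * (invFact j * P)                 ∎
  where
  open ≤-Reasoning
  f P : ℚ
  f = invFact (suc j)
  P = pow (x + h) j

-- The derivative of the polynomial with n + 1 terms is the one with n terms.
realExpSum-suc-increment : ∀ {x h} → 0ℚ ≤ x → 0ℚ ≤ h → ∀ n → realExpSum (suc n) (x + h) ≤ realExpSum (suc n) x + h * realExpSum n (x + h)
realExpSum-suc-increment {x} {h} 0≤x 0≤h zero    = ≤-reflexive (sym (trans (cong (realExpSum 1 x +_) (*-zeroʳ h)) (+-identityʳ (realExpSum 1 x))))
realExpSum-suc-increment {x} {h} 0≤x 0≤h (suc n) = begin
  realExpSum (suc n) (x + h) + expTerm (x + h) (suc n)
    ≤⟨ +-mono-≤ (realExpSum-suc-increment 0≤x 0≤h n) (expTerm-increment 0≤x 0≤h n) ⟩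
  (realExpSum (suc n) x + h * realExpSum n (x + h)) + (expTerm x (suc n) + h * expTerm (x + h) n)
    ≡⟨ solve 5 (λ a h b c d → (a :+ h :* b) :+ (c :+ h :* d) := (a :+ c) :+ h :* (b :+ d)) refl (realExpSum (suc n) x) h (realExpSum n (x + h)) (expTerm x (suc n)) (expTerm (x + h) n) ⟩
  realExpSum (suc (suc n)) x + h * realExpSum (suc n) (x + h) ∎
  where open ≤-Reasoning

-- To be read as (1 - h) e(x + h) ≤ e(x). With h = ½ it gives bounds uniform in n, with h = 1 / k
-- the comparison with logarithms, with h = ⅓ the angle estimate.
realExpSum-increment : ∀ {x h} → 0ℚ ≤ x → 0ℚ ≤ h → ∀ n → realExpSum n (x + h) ≤ realExpSum n x + h * realExpSum n (x + h)
realExpSum-increment {x} {h} 0≤x 0≤h zero    = ≤-reflexive (sym (trans (+-identityˡ (h * 0ℚ)) (*-zeroʳ h)))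
realExpSum-increment {x} {h} 0≤x 0≤h (suc n) = ≤-trans (realExpSum-suc-increment 0≤x 0≤h n)
  (+-monoʳ-≤ (realExpSum (suc n) x) (*-monoˡ 0≤h (p≤p+q (0≤expTerm (0≤+ 0≤x 0≤h) n))))

realExpSum-+½ : ∀ {x} → 0ℚ ≤ x → ∀ n → realExpSum n (x + ½) ≤ 2ℚ * realExpSum n x
realExpSum-+½ {x} 0≤x n = begin
  y                              ≡⟨ solve 1 (λ y → y := con 2ℚ :* y :- y) refl y ⟩
  2ℚ * y - y                     ≤⟨ +-monoˡ-≤ (- y) (*-monoˡ 0≤2 (realExpSum-increment 0≤x (nonNegative⁻¹ ½) n)) ⟩
  2ℚ * (realExpSum n x + ½ * y) - y ≡⟨ solve 2 (λ e y → con 2ℚ :* (e :+ con ½ :* y) :- y := con 2ℚ :* e) refl (realExpSum n x) y ⟩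
  2ℚ * realExpSum n x            ∎
  where
  open ≤-Reasoning
  y : ℚ
  y = realExpSum n (x + ½)

realExpSum-0 : ∀ n → realExpSum n 0ℚ ≤ 1ℚ
realExpSum-0 zero          = 0≤1
realExpSum-0 (suc zero)    = ≤-refl
realExpSum-0 (suc (suc n)) = ≤-trans (≤-reflexive (trans (cong (realExpSum (suc n) 0ℚ +_)
  (trans (cong (invFact (suc n) *_) (*-zeroˡ (pow 0ℚ n))) (*-zeroʳ (invFact (suc n))))) (+-identityʳ (realExpSum (suc n) 0ℚ)))) (realExpSum-0 (suc n))

halves : ℕ → ℚ
halves zero    = 0ℚ
halves (suc k) = halves k + ½

halves-≡ : ∀ k → halves k ≡ fromℕ k * ½
halves-≡ zero    = sym (*-zeroˡ ½)
halves-≡ (suc k) = trans (cong (_+ ½) (halves-≡ k)) (trans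
  (solve 1 (λ x → x :* con ½ :+ con ½ := (con 1ℚ :+ x) :* con ½) refl (fromℕ k)) (cong (_* ½) (sym (fromℕ-suc k))))

0≤halves : ∀ k → 0ℚ ≤ halves k
0≤halves zero    = ≤-refl
0≤halves (suc k) = 0≤+ (0≤halves k) (nonNegative⁻¹ ½)

realExpSum-halves : ∀ k n → realExpSum n (halves k) ≤ pow 2ℚ k
realExpSum-halves zero    n = realExpSum-0 n
realExpSum-halves (suc k) n = ≤-trans (realExpSum-+½ (0≤halves k) n) (*-monoˡ 0≤2 (realExpSum-halves k n))

realExpSum-bounded : ∀ {x} → 0ℚ ≤ x → ∃ λ C → ∀ n → realExpSum n x ≤ C
realExpSum-bounded {x} 0≤x with archimedean x (positive⁻¹ ½)
... | k , x≤k/2 = pow 2ℚ k , λ n → ≤-trans (realExpSum-mono n 0≤x (subst (x ≤_) (sym (halves-≡ k)) x≤k/2)) (realExpSum-halves k n)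

pow-* : ∀ x y j → pow (x * y) j ≡ pow x j * pow y j
pow-* x y zero    = refl
pow-* x y (suc j) = trans (cong (x * y *_) (pow-* x y j))
  (solve 4 (λ x y p q → x :* y :* (p :* q) := x :* p :* (y :* q)) refl x y (pow x j) (pow y j))

pow-+ : ∀ x i j → pow x (i ℕ.+ j) ≡ pow x i * pow x j
pow-+ x zero    j = sym (*-identityˡ (pow x j))
pow-+ x (suc i) j = trans (cong (x *_) (pow-+ x i j)) (sym (*-assoc x (pow x i) (pow x j)))

1≤pow2 : ∀ j → 1ℚ ≤ pow 2ℚ j
1≤pow2 zero    = ≤-refl
1≤pow2 (suc j) = *-mono₂ {1ℚ} {2ℚ} {1ℚ} {pow 2ℚ j} 0≤1 (0≤pow 0≤2 j) (fromℕ-mono {1} {2} (ℕ.s≤s ℕ.z≤n)) (1≤pow2 j)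

n≤pow2 : ∀ n → fromℕ n ≤ pow 2ℚ n
n≤pow2 zero    = 0≤1
n≤pow2 (suc n) = begin
  fromℕ (suc n)              ≡⟨ fromℕ-suc n ⟩
  1ℚ + fromℕ n               ≤⟨ +-mono-≤ (1≤pow2 n) (n≤pow2 n) ⟩
  pow 2ℚ n + pow 2ℚ n        ≡⟨ solve 1 (λ p → p :+ p := con 2ℚ :* p) refl (pow 2ℚ n) ⟩
  2ℚ * pow 2ℚ n              ∎
  where open ≤-Reasoning

-- Truncation error of the functional equation

module ProductError {R} (z w : ℚ [i]) (z≤R : ∥ z ∥ ≤ R) (w≤R : ∥ w ∥ ≤ R) where
  open CauchyProduct z w

  -- The terms at the doubled radius exceed the bounds for `a` and `b` by the factor 2ʲ. Products
  -- with i + j ≥ n thereby gain 2⁻ⁿ, while the sum of the α stays bounded.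
  α : ℕ → ℚ
  α = expTerm (2ℚ * R)

  0≤2R : 0ℚ ≤ 2ℚ * R
  0≤2R = 0≤* 0≤2 (≤-trans 0≤∥ z ∥ z≤R)

  term-≤ : ∀ {u} → ∥ u ∥ ≤ R → ∀ j → pow 2ℚ j * ∥ expTermᴳ u j ∥ ≤ α j
  term-≤ {u} u≤R j = begin
    pow 2ℚ j * ∥ expTermᴳ u j ∥              ≡⟨ cong (pow 2ℚ j *_) (norm-• (u ^ᴳ j) (0≤1/! j)) ⟩
    pow 2ℚ j * (invFact j * ∥ u ^ᴳ j ∥)      ≤⟨ *-monoˡ (0≤pow 0≤2 j) (*-monoˡ (0≤1/! j) (norm-^ u u≤R j)) ⟩
    pow 2ℚ j * (invFact j * pow R j)         ≡⟨ solve 3 (λ p f r → p :* (f :* r) := f :* (p :* r)) refl (pow 2ℚ j) (invFact j) (pow R j) ⟩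
    invFact j * (pow 2ℚ j * pow R j)         ≡⟨ cong (invFact j *_) (sym (pow-* 2ℚ R j)) ⟩
    α j                                      ∎
    where open ≤-Reasoning

  tail-≤ : ∀ m d → pow 2ℚ m * ∥ expSum (m ℕ.+ d) w -ᴳ expSum m w ∥ ≤ realExpSum (m ℕ.+ d) (2ℚ * R)
  tail-≤ m zero rewrite ℕP.+-identityʳ m = subst (_≤ realExpSum m (2ℚ * R))
    (sym (trans (cong (pow 2ℚ m *_) (norm-self (expSum m w))) (*-zeroʳ (pow 2ℚ m)))) (0≤realExpSum m 0≤2R)
  tail-≤ m (suc d) rewrite ℕP.+-suc m d = begin
    p * ∥ (E +ᴳ t) -ᴳ F ∥          ≡⟨ cong (λ x → p * ∥ x ∥) (solveᴳ 3 (λ e t f → (e ⊕ t) ⊖ f ⊜ (e ⊖ f) ⊕ t) refl E t F) ⟩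
    p * ∥ (E -ᴳ F) +ᴳ t ∥          ≤⟨ *-monoˡ (0≤pow 0≤2 m) (norm-+ (E -ᴳ F) t) ⟩
    p * (∥ E -ᴳ F ∥ + ∥ t ∥)       ≡⟨ *-distribˡ-+ p (∥ E -ᴳ F ∥) (∥ t ∥) ⟩
    p * ∥ E -ᴳ F ∥ + p * ∥ t ∥     ≤⟨ +-mono-≤ (tail-≤ m d) (≤-trans (*-monoʳ 0≤∥ t ∥ pow-grows) (term-≤ w≤R (m ℕ.+ d))) ⟩
    realExpSum (m ℕ.+ d) (2ℚ * R) + α (m ℕ.+ d) ∎
    where
    open ≤-Reasoning
    p : ℚ
    p = pow 2ℚ m
    E F t : ℚ [i]
    E = expSum (m ℕ.+ d) w
    F = expSum m w
    t = b (m ℕ.+ d)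
    pow-grows : p ≤ pow 2ℚ (m ℕ.+ d)
    pow-grows = subst₂ _≤_ (*-identityʳ p) (sym (pow-+ 2ℚ m d)) (*-monoˡ (0≤pow 0≤2 m) (1≤pow2 d))

  frontα : ℕ → ℕ → ℚ
  frontα p zero    = 0ℚ
  frontα p (suc n) = α p + frontα (suc p) n

  frontα-suc : ∀ p n → frontα p (suc n) ≡ frontα p n + α (p ℕ.+ n)
  frontα-suc p zero    = trans (+-comm (α p) 0ℚ) (cong (λ k → 0ℚ + α k) (sym (ℕP.+-identityʳ p)))
  frontα-suc p (suc n) = trans (cong (α p +_) (trans (frontα-suc (suc p) n) (cong (λ k → frontα (suc p) n + α k) (sym (ℕP.+-suc p n)))))
    (sym (+-assoc (α p) (frontα (suc p) n) (α (p ℕ.+ suc n))))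

  frontα-exp : ∀ n → frontα 0 n ≡ realExpSum n (2ℚ * R)
  frontα-exp zero    = refl
  frontα-exp (suc n) = trans (frontα-suc 0 n) (cong (_+ α n) (frontα-exp n))

  -- For p = 0 and B = expSum n w, the difference is the sum of the a i *ᴳ b j
  -- with i, j < n ≤ i + j, where ∥ a i ∥ * ∥ b j ∥ ≤ 2⁻ⁿ * (α i * α j).
  error-≤ : ∀ B β M → (∀ m → m ℕ.≤ M → pow 2ℚ m * ∥ B -ᴳ expSum m w ∥ ≤ β) → ∀ p n → n ℕ.≤ M →
    pow 2ℚ (p ℕ.+ n) * ∥ frontSum p n *ᴳ B -ᴳ triangleSum p n ∥ ≤ frontα p n * β
  error-≤ B β M close p zero    _   = ≤-reflexive (trans (cong (λ x → pow 2ℚ (p ℕ.+ 0) * ∥ x ∥)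
    (solveᴳ 1 (λ x → conᴳ 0ᴳ ⊗ x ⊖ conᴳ 0ᴳ ⊜ conᴳ 0ᴳ) refl B)) (trans (*-zeroʳ (pow 2ℚ (p ℕ.+ 0))) (sym (*-zeroˡ β))))
  error-≤ B β M close p (suc n) n<M = begin
    P * ∥ (a p +ᴳ A) *ᴳ B -ᴳ (a p *ᴳ E +ᴳ T) ∥
      ≡⟨ cong (λ x → P * ∥ x ∥) (solveᴳ 5 (λ x f c e t → (x ⊕ f) ⊗ c ⊖ (x ⊗ e ⊕ t) ⊜ x ⊗ (c ⊖ e) ⊕ (f ⊗ c ⊖ t)) refl (a p) A B E T) ⟩
    P * ∥ a p *ᴳ (B -ᴳ E) +ᴳ (A *ᴳ B -ᴳ T) ∥
      ≤⟨ *-monoˡ (0≤pow 0≤2 (p ℕ.+ suc n)) (≤-trans (norm-+ (a p *ᴳ (B -ᴳ E)) (A *ᴳ B -ᴳ T)) (+-monoˡ-≤ ∥ A *ᴳ B -ᴳ T ∥ (norm-* (a p) (B -ᴳ E)))) ⟩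
    P * (∥ a p ∥ * ∥ B -ᴳ E ∥ + ∥ A *ᴳ B -ᴳ T ∥)
      ≡⟨ *-distribˡ-+ P (∥ a p ∥ * ∥ B -ᴳ E ∥) (∥ A *ᴳ B -ᴳ T ∥) ⟩
    P * (∥ a p ∥ * ∥ B -ᴳ E ∥) + P * ∥ A *ᴳ B -ᴳ T ∥
      ≤⟨ +-mono-≤ first second ⟩
    α p * β + frontα (suc p) n * β
      ≡⟨ sym (*-distribʳ-+ β (α p) (frontα (suc p) n)) ⟩
    (α p + frontα (suc p) n) * β ∎
    where
    open ≤-Reasoning
    P : ℚ
    P = pow 2ℚ (p ℕ.+ suc n)
    A E T : ℚ [i]
    A = frontSum (suc p) n
    E = expSum (suc n) w
    T = triangleSum (suc p) n
    -- The weight splits into 2ᵖ for `a p` and 2ⁿ⁺¹ for the tail of the other series.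
    first : P * (∥ a p ∥ * ∥ B -ᴳ E ∥) ≤ α p * β
    first = begin
      P * (∥ a p ∥ * ∥ B -ᴳ E ∥)
        ≡⟨ cong (_* (∥ a p ∥ * ∥ B -ᴳ E ∥)) (pow-+ 2ℚ p (suc n)) ⟩
      pow 2ℚ p * pow 2ℚ (suc n) * (∥ a p ∥ * ∥ B -ᴳ E ∥)
        ≡⟨ solve 4 (λ p q x y → p :* q :* (x :* y) := (p :* x) :* (q :* y)) refl (pow 2ℚ p) (pow 2ℚ (suc n)) (∥ a p ∥) (∥ B -ᴳ E ∥) ⟩
      (pow 2ℚ p * ∥ a p ∥) * (pow 2ℚ (suc n) * ∥ B -ᴳ E ∥)
        ≤⟨ *-mono₂ {pow 2ℚ p * ∥ a p ∥} {α p} {pow 2ℚ (suc n) * ∥ B -ᴳ E ∥} {β}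
             (0≤* (0≤pow 0≤2 p) 0≤∥ a p ∥) (≤-trans (0≤* (0≤pow 0≤2 (suc n)) 0≤∥ B -ᴳ E ∥) (close (suc n) n<M))
             (term-≤ z≤R p) (close (suc n) n<M) ⟩
      α p * β ∎
    second : P * ∥ A *ᴳ B -ᴳ T ∥ ≤ frontα (suc p) n * β
    second = subst (λ k → pow 2ℚ k * ∥ A *ᴳ B -ᴳ T ∥ ≤ frontα (suc p) n * β) (sym (ℕP.+-suc p n))
      (error-≤ B β M close (suc p) n (ℕP.<⇒≤ n<M))

  product-error : ∀ n → pow 2ℚ n * ∥ expSum n z *ᴳ expSum n w -ᴳ expSum n (z +ᴳ w) ∥ ≤ realExpSum n (2ℚ * R) * realExpSum n (2ℚ * R)
  product-error n = subst₂ (λ s t → pow 2ℚ n * ∥ s *ᴳ expSum n w -ᴳ t ∥ ≤ realExpSum n (2ℚ * R) * realExpSum n (2ℚ * R))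
    (frontSum-exp n) (triangleSum-exp n)
    (subst (λ x → pow 2ℚ n * ∥ frontSum 0 n *ᴳ expSum n w -ᴳ triangleSum 0 n ∥ ≤ x * realExpSum n (2ℚ * R)) (frontα-exp n)
      (error-≤ (expSum n w) (realExpSum n (2ℚ * R)) n close 0 n ℕP.≤-refl))
    where
    close : ∀ m → m ℕ.≤ n → pow 2ℚ m * ∥ expSum n w -ᴳ expSum m w ∥ ≤ realExpSum n (2ℚ * R)
    close m m≤n = subst (λ k → pow 2ℚ m * ∥ expSum k w -ᴳ expSum m w ∥ ≤ realExpSum k (2ℚ * R)) (ℕP.m+[n∸m]≡n m≤n) (tail-≤ m (n ℕ.∸ m))

-- The error is at most C² / 2ⁿ with C depending on R alone. One truncation index therefore serves
-- all terms of a block.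
expSum-+ : ∀ R {ε} → 0ℚ ≤ R → 0ℚ < ε → ∃ λ N → ∀ n → N ℕ.≤ n → ∀ z w → ∥ z ∥ ≤ R → ∥ w ∥ ≤ R →
  ∥ expSum n z *ᴳ expSum n w -ᴳ expSum n (z +ᴳ w) ∥ ≤ ε
expSum-+ R {ε} 0≤R 0<ε with realExpSum-bounded (0≤* 0≤2 0≤R)
... | C , bound with archimedean (C * C) 0<ε
...   | N , C²≤Nε = suc N , λ { n@(suc n′) (ℕ.s≤s N≤n′) z w z≤R w≤R →
    let δ = ∥ expSum n z *ᴳ expSum n w -ᴳ expSum n (z +ᴳ w) ∥
        e = realExpSum n (2ℚ * R)
        0≤e = 0≤realExpSum n (0≤* 0≤2 0≤R)
    in *-cancelˡ (0<fromℕ-suc n′) (begin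
      fromℕ n * δ      ≤⟨ *-monoʳ 0≤∥ expSum n z *ᴳ expSum n w -ᴳ expSum n (z +ᴳ w) ∥ (n≤pow2 n) ⟩
      pow 2ℚ n * δ     ≤⟨ ProductError.product-error z w z≤R w≤R n ⟩
      e * e            ≤⟨ *-mono₂ {e} {C} {e} {C} 0≤e (≤-trans 0≤e (bound n)) (bound n) (bound n) ⟩
      C * C            ≤⟨ C²≤Nε ⟩
      fromℕ N * ε      ≤⟨ *-monoʳ (<⇒≤ 0<ε) (fromℕ-mono {N} {n} (ℕP.m≤n⇒m≤1+n N≤n′)) ⟩
      fromℕ n * ε      ∎) }
  where open ≤-Reasoning

-- The exponential function at logarithms and on the imaginary axis

harmonic-mono : ∀ M c → harmonic M ≤ harmonic (M ℕ.+ c)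
harmonic-mono M zero    = ≤-reflexive (cong harmonic (sym (ℕP.+-identityʳ M)))
harmonic-mono M (suc c) = subst (λ k → harmonic M ≤ harmonic k) (sym (ℕP.+-suc M c))
  (≤-trans (harmonic-mono M c) (p≤p+q (<⇒≤ (0<1/suc (M ℕ.+ c)))))

-- Adding 1 / (k + 1) to the argument multiplies the sum by at most 1 / (1 - 1 / (k + 1)) = (k + 1)
-- / k, and these factors telescope.
realExpSum-harmonic : ∀ n {x} → 0ℚ ≤ x → ∀ M c →
  fromℕ (suc M) * realExpSum n (x + (harmonic (suc M ℕ.+ c) - harmonic (suc M))) ≤ fromℕ (suc M ℕ.+ c) * realExpSum n x
realExpSum-harmonic n {x} 0≤x M zero rewrite ℕP.+-identityʳ M =
  ≤-reflexive (cong (λ y → fromℕ (suc M) * realExpSum n y) (trans (cong (x +_) (+-inverseʳ (harmonic (suc M)))) (+-identityʳ x)))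
realExpSum-harmonic n {x} 0≤x M (suc c) rewrite ℕP.+-suc M c = *-cancelˡ (0<fromℕ-suc (M ℕ.+ c)) (begin
  k * (m * P′)
    ≡⟨ solve 3 (λ k m p → k :* (m :* p) := m :* (k :* p)) refl k m P′ ⟩
  m * (k * P′)
    ≤⟨ *-monoˡ (0≤fromℕ (suc M)) step ⟩
  m * (fromℕ (suc (suc (M ℕ.+ c))) * P)
    ≡⟨ solve 3 (λ m k p → m :* (k :* p) := k :* (m :* p)) refl m (fromℕ (suc (suc (M ℕ.+ c)))) P ⟩
  fromℕ (suc (suc (M ℕ.+ c))) * (m * P)
    ≤⟨ *-monoˡ (0≤fromℕ (suc (suc (M ℕ.+ c)))) (realExpSum-harmonic n 0≤x M c) ⟩
  fromℕ (suc (suc (M ℕ.+ c))) * (k * S)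
    ≡⟨ solve 3 (λ m k p → m :* (k :* p) := k :* (m :* p)) refl (fromℕ (suc (suc (M ℕ.+ c)))) k S ⟩
  k * (fromℕ (suc (suc (M ℕ.+ c))) * S) ∎)
  where
  open ≤-Reasoning
  m k h y P P′ S : ℚ
  m = fromℕ (suc M)
  k = fromℕ (suc (M ℕ.+ c))
  h = int 1 / suc (suc (M ℕ.+ c))
  y = x + (harmonic (suc M ℕ.+ c) - harmonic (suc M))
  P = realExpSum n y
  P′ = realExpSum n (x + (harmonic (suc (M ℕ.+ c)) + h - harmonic (suc M)))
  S = realExpSum n x
  arg : x + (harmonic (suc (M ℕ.+ c)) + h - harmonic (suc M)) ≡ y + h
  arg = solve 4 (λ x a h b → x :+ (a :+ h :- b) := x :+ (a :- b) :+ h) refl x (harmonic (suc (M ℕ.+ c))) h (harmonic (suc M))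
  increment : P′ ≤ P + h * P′
  increment = subst (λ z → realExpSum n z ≤ P + h * realExpSum n z) (sym arg)
    (realExpSum-increment (0≤+ 0≤x (p≤q⇒0≤q-p (harmonic-mono (suc M) c))) (<⇒≤ (0<1/suc (suc (M ℕ.+ c)))) n)
  step : k * P′ ≤ fromℕ (suc (suc (M ℕ.+ c))) * P
  step = +-cancelʳ-≤ P′ (begin
    k * P′ + P′                                  ≡⟨ solve 2 (λ k p → k :* p :+ p := (con 1ℚ :+ k) :* p) refl k P′ ⟩
    (1ℚ + k) * P′                                ≡⟨ cong (_* P′) (sym (fromℕ-suc (suc (M ℕ.+ c)))) ⟩
    k⁺ * P′                                      ≤⟨ *-monoˡ (0≤fromℕ (suc (suc (M ℕ.+ c)))) increment ⟩
    k⁺ * (P + h * P′)                            ≡⟨ solve 4 (λ k p h q → k :* (p :+ h :* q) := k :* p :+ k :* h :* q) refl k⁺ P h P′ ⟩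
    k⁺ * P + k⁺ * h * P′                         ≡⟨ cong (λ u → k⁺ * P + u * P′) (fromℕ-*-1/ (suc (M ℕ.+ c))) ⟩
    k⁺ * P + 1ℚ * P′                             ≡⟨ cong (k⁺ * P +_) (*-identityˡ P′) ⟩
    k⁺ * P + P′                                  ∎)
    where
    k⁺ : ℚ
    k⁺ = fromℕ (suc (suc (M ℕ.+ c)))

-- One half of exp (x + ln k) = k exp x, true already for the approximants and with independent
-- indices for the exponential and the logarithm.
realExpSum-lnSeq : ∀ n {x} → 0ℚ ≤ x → ∀ k r → realExpSum n (x + lnSeq (suc k) (suc r)) ≤ fromℕ (suc k) * realExpSum n x
realExpSum-lnSeq n {x} 0≤x k r = *-cancelˡ (0<fromℕ-suc r) (≤-trans (realExpSum-harmonic n 0≤x r (k ℕ.* suc r))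
  (≤-reflexive (trans (cong (_* realExpSum n x) (trans (fromℕ-* (suc k) (suc r)) (*-comm (fromℕ (suc k)) (fromℕ (suc r)))))
    (*-assoc (fromℕ (suc r)) (fromℕ (suc k)) (realExpSum n x)))))

0≤lnSeq : ∀ k r → 0ℚ ≤ lnSeq (suc k) r
0≤lnSeq k r = p≤q⇒0≤q-p (harmonic-mono r (k ℕ.* r))

realExpSum-power : ∀ n {x} → 0ℚ ≤ x → ∀ k r e → realExpSum n (fromℕ e * lnSeq (suc k) (suc r) + x) ≤ fromℕ (suc k ℕ.^ e) * realExpSum n x
realExpSum-power n {x} 0≤x k r zero    = ≤-reflexive (trans
  (cong (realExpSum n) (trans (cong (_+ x) (*-zeroˡ (lnSeq (suc k) (suc r)))) (+-identityˡ x))) (sym (*-identityˡ (realExpSum n x))))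
realExpSum-power n {x} 0≤x k r (suc e) = begin
  realExpSum n (fromℕ (suc e) * L + x)                 ≡⟨ cong (realExpSum n) (trans (cong (λ m → m * L + x) (fromℕ-suc e)) (solve 3 (λ e l x → (con 1ℚ :+ e) :* l :+ x := (e :* l :+ x) :+ l) refl (fromℕ e) L x)) ⟩
  realExpSum n ((fromℕ e * L + x) + L)                 ≤⟨ realExpSum-lnSeq n (0≤+ (0≤* (0≤fromℕ e) (0≤lnSeq k (suc r))) 0≤x) k r ⟩
  fromℕ (suc k) * realExpSum n (fromℕ e * L + x)       ≤⟨ *-monoˡ (0≤fromℕ (suc k)) (realExpSum-power n 0≤x k r e) ⟩
  fromℕ (suc k) * (fromℕ (suc k ℕ.^ e) * realExpSum n x) ≡⟨ sym (*-assoc (fromℕ (suc k)) (fromℕ (suc k ℕ.^ e)) (realExpSum n x)) ⟩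
  fromℕ (suc k) * fromℕ (suc k ℕ.^ e) * realExpSum n x ≡⟨ cong (_* realExpSum n x) (sym (fromℕ-* (suc k) (suc k ℕ.^ e))) ⟩
  fromℕ (suc k ℕ.^ suc e) * realExpSum n x             ∎
  where
  open ≤-Reasoning
  L : ℚ
  L = lnSeq (suc k) (suc r)

lnSeq-mono-+ : ∀ K c r → lnSeq K r ≤ lnSeq (K ℕ.+ c) r
lnSeq-mono-+ K c r = +-monoˡ-≤ (- harmonic r) (subst (λ k → harmonic (K ℕ.* r) ≤ harmonic k) (sym (ℕP.*-distribʳ-+ r K c)) (harmonic-mono (K ℕ.* r) (c ℕ.* r)))

-- This is ln (1 + c / K) ≤ c / K, with K + 1 for K: the difference consists of c R fractions, each
-- at most 1 / ((K + 1) R).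
lnSeq-difference-+ : ∀ K c r → fromℕ (suc K) * (lnSeq (suc K ℕ.+ c) (suc r) - lnSeq (suc K) (suc r)) ≤ fromℕ c
lnSeq-difference-+ K c r = begin
  k * ((harmonic ((suc K ℕ.+ c) ℕ.* R) - harmonic R) - (harmonic (suc K ℕ.* R) - harmonic R))
    ≡⟨ cong (k *_) (solve 3 (λ a b c → (a :- b) :- (c :- b) := a :- c) refl (harmonic ((suc K ℕ.+ c) ℕ.* R)) (harmonic R) (harmonic (suc K ℕ.* R))) ⟩
  k * (harmonic ((suc K ℕ.+ c) ℕ.* R) - H)
    ≡⟨ cong (λ j → k * (harmonic j - H)) (ℕP.*-distribʳ-+ R (suc K) c) ⟩
  k * (harmonic (suc K ℕ.* R ℕ.+ c ℕ.* R) - H)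
    ≤⟨ *-monoˡ (0≤fromℕ (suc K)) (+-monoˡ-≤ (- H) (harmonic-upper (r ℕ.+ K ℕ.* R) (c ℕ.* R))) ⟩
  k * (H + fromℕ (c ℕ.* R) * h - H)
    ≡⟨ cong (λ z → k * (H + z * h - H)) (fromℕ-* c R) ⟩
  k * (H + fromℕ c * fromℕ R * h - H)
    ≡⟨ solve 5 (λ k H c r h → k :* (H :+ c :* r :* h :- H) := c :* (k :* r :* h)) refl k H (fromℕ c) (fromℕ R) h ⟩
  fromℕ c * (k * fromℕ R * h)
    ≡⟨ cong (λ z → fromℕ c * (z * h)) (sym (fromℕ-* (suc K) R)) ⟩
  fromℕ c * (fromℕ (suc K ℕ.* R) * h)
    ≡⟨ cong (fromℕ c *_) (fromℕ-*-1/ (r ℕ.+ K ℕ.* R)) ⟩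
  fromℕ c * 1ℚ
    ≡⟨ *-identityʳ (fromℕ c) ⟩
  fromℕ c ∎
  where
  open ≤-Reasoning
  R : ℕ
  R = suc r
  k H h : ℚ
  k = fromℕ (suc K)
  H = harmonic (suc K ℕ.* R)
  h = int 1 / (suc K ℕ.* R)

lnSeq-1 : ∀ r → lnSeq 1 r ≡ 0ℚ
lnSeq-1 r = trans (cong (λ k → harmonic k - harmonic r) (ℕP.*-identityˡ r)) (+-inverseʳ (harmonic r))

lnSeq-≤ : ∀ k r → lnSeq (suc k) (suc r) ≤ fromℕ k
lnSeq-≤ k r = subst (_≤ fromℕ k) (trans (*-identityˡ (lnSeq (suc k) (suc r) - lnSeq 1 (suc r)))
  (trans (cong (λ x → lnSeq (suc k) (suc r) - x) (lnSeq-1 (suc r))) (+-identityʳ (lnSeq (suc k) (suc r))))) (lnSeq-difference-+ 0 k r)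

-- The approximants are additive only after the index of one summand is changed from r to l r.
lnSeq-* : ∀ k l r → lnSeq (k ℕ.* l) r ≡ lnSeq k (l ℕ.* r) + lnSeq l r
lnSeq-* k l r = trans (cong (λ j → harmonic j - harmonic r) (ℕP.*-assoc k l r))
  (solve 3 (λ a b c → a :- c := (a :- b) :+ (b :- c)) refl (harmonic (k ℕ.* (l ℕ.* r))) (harmonic (l ℕ.* r)) (harmonic r))

lnSeq-increasing : ∀ k {M M′} → M ℕ.≤ M′ → lnSeq (suc k) M ≤ lnSeq (suc k) M′
lnSeq-increasing k {M} {M′} M≤M′ = subst (λ j → lnSeq (suc k) M ≤ lnSeq (suc k) j) (ℕP.m+[n∸m]≡n M≤M′) (LnBounds.above k M (M′ ℕ.∸ M))

-- By `lnSeq-*` the logarithms of the single factors occur at different indices. As the approximants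
-- increase with the index, all are replaced by the one at the largest index; `m` keeps this index
-- fixed during the induction.
lnSeq-power : ∀ k r m e → e ℕ.≤ m → lnSeq (suc k ℕ.^ e) r ≤ fromℕ e * lnSeq (suc k) (suc k ℕ.^ m ℕ.* r)
lnSeq-power k r m zero    _   = ≤-reflexive (trans (lnSeq-1 r) (sym (*-zeroˡ (lnSeq (suc k) (suc k ℕ.^ m ℕ.* r)))))
lnSeq-power k r m (suc e) e<m = begin
  lnSeq (suc k ℕ.* suc k ℕ.^ e) r                                ≡⟨ lnSeq-* (suc k) (suc k ℕ.^ e) r ⟩
  lnSeq (suc k) (suc k ℕ.^ e ℕ.* r) + lnSeq (suc k ℕ.^ e) r      ≤⟨ +-mono-≤ (lnSeq-increasing k (ℕP.*-monoˡ-≤ r (ℕP.^-monoʳ-≤ (suc k) (ℕP.<⇒≤ e<m)))) (lnSeq-power k r m e (ℕP.<⇒≤ e<m)) ⟩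
  L + fromℕ e * L                                                ≡⟨ solve 2 (λ l e → l :+ e :* l := (con 1ℚ :+ e) :* l) refl L (fromℕ e) ⟩
  (1ℚ + fromℕ e) * L                                             ≡⟨ cong (_* L) (sym (fromℕ-suc e)) ⟩
  fromℕ (suc e) * L                                              ∎
  where
  open ≤-Reasoning
  L : ℚ
  L = lnSeq (suc k) (suc k ℕ.^ m ℕ.* r)

expSum-near-1 : ∀ n z → ∥ expSum (suc n) z -ᴳ 1ᴳ ∥ + 1ℚ ≤ realExpSum (suc n) ∥ z ∥
expSum-near-1 zero    z = ≤-refl
expSum-near-1 (suc n) z = begin
  ∥ (E +ᴳ t) -ᴳ 1ᴳ ∥ + 1ℚ            ≡⟨ cong (λ x → ∥ x ∥ + 1ℚ) (solveᴳ 2 (λ e t → (e ⊕ t) ⊖ conᴳ 1ᴳ ⊜ (e ⊖ conᴳ 1ᴳ) ⊕ t) refl E t) ⟩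
  ∥ (E -ᴳ 1ᴳ) +ᴳ t ∥ + 1ℚ            ≤⟨ +-monoˡ-≤ 1ℚ (norm-+ (E -ᴳ 1ᴳ) t) ⟩
  (∥ E -ᴳ 1ᴳ ∥ + ∥ t ∥) + 1ℚ         ≡⟨ solve 2 (λ x y → (x :+ y) :+ con 1ℚ := (x :+ con 1ℚ) :+ y) refl (∥ E -ᴳ 1ᴳ ∥) (∥ t ∥) ⟩
  (∥ E -ᴳ 1ᴳ ∥ + 1ℚ) + ∥ t ∥         ≤⟨ +-mono-≤ (expSum-near-1 n z) (≤-trans (≤-reflexive (norm-• (z ^ᴳ suc n) (0≤1/! (suc n)))) (*-monoˡ (0≤1/! (suc n)) (norm-^ z ≤-refl (suc n)))) ⟩
  realExpSum (suc (suc n)) ∥ z ∥      ∎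
  where
  open ≤-Reasoning
  E t : ℚ [i]
  E = expSum (suc n) z
  t = expTermᴳ z (suc n)

-- From (1 - ⅓) e(⅓) ≤ 1. This is the origin of the angle ⅓: it keeps exp (i θ) within ½ of 1, and
-- so the cosine above ½.
realExpSum-⅓ : ∀ n → realExpSum n ⅓ ≤ 1ℚ + ½
realExpSum-⅓ n = begin
  y                        ≡⟨ solve 1 (λ y → y := con (1ℚ + ½) :* (y :- con ⅓ :* y)) refl y ⟩
  (1ℚ + ½) * (y - ⅓ * y)   ≤⟨ *-monoˡ (nonNegative⁻¹ (1ℚ + ½)) y-y/3≤1 ⟩
  (1ℚ + ½) * 1ℚ            ≡⟨ *-identityʳ (1ℚ + ½) ⟩
  1ℚ + ½                   ∎
  where
  open ≤-Reasoning
  y : ℚ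
  y = realExpSum n ⅓
  y-y/3≤1 : y - ⅓ * y ≤ 1ℚ
  y-y/3≤1 = begin
    y - ⅓ * y                                ≤⟨ +-monoˡ-≤ (- (⅓ * y)) (realExpSum-increment {0ℚ} {⅓} ≤-refl (nonNegative⁻¹ ⅓) n) ⟩
    (realExpSum n 0ℚ + ⅓ * y) - ⅓ * y        ≡⟨ solve 2 (λ a b → (a :+ b) :- b := a) refl (realExpSum n 0ℚ) (⅓ * y) ⟩
    realExpSum n 0ℚ                          ≤⟨ realExpSum-0 n ⟩
    1ℚ                                       ∎

½≤cos : ∀ n {θ} → ∣ θ ∣ ≤ ⅓ → ½ ≤ Re (expSum (suc n) (0ℚ +i θ))
½≤cos n {θ} θ≤⅓ = +-cancelʳ-≤ ½ (≥-from-∣-∣ {c} {1ℚ} (≤-trans (∣Re∣≤∥∥ (expSum (suc n) (0ℚ +i θ) -ᴳ 1ᴳ)) near))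
  where
  c : ℚ
  c = Re (expSum (suc n) (0ℚ +i θ))
  near : ∥ expSum (suc n) (0ℚ +i θ) -ᴳ 1ᴳ ∥ ≤ ½
  near = +-cancelʳ-≤ 1ℚ (≤-trans (expSum-near-1 n (0ℚ +i θ)) (≤-trans
    (realExpSum-mono (suc n) 0≤∥ 0ℚ +i θ ∥ (subst (_≤ ⅓) (sym (+-identityˡ (∣ θ ∣))) θ≤⅓))
    (≤-trans (realExpSum-⅓ (suc n)) (≤-reflexive (+-comm 1ℚ ½)))))

conj : ℚ [i] → ℚ [i]
conj (a +i b) = a +i (- b)

conj-^ : ∀ z j → conj z ^ᴳ j ≡ conj (z ^ᴳ j)
conj-^ z        zero    = refl
conj-^ (a +i b) (suc j) = trans (cong (conj (a +i b) *ᴳ_) (conj-^ (a +i b) j)) (let (c +i d) = (a +i b) ^ᴳ j in cong₂ _+i_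
  (solve 4 (λ a b c d → a :* c :- (:- b) :* (:- d) := a :* c :- b :* d) refl a b c d)
  (solve 4 (λ a b c d → a :* (:- d) :+ (:- b) :* c := :- (a :* d :+ b :* c)) refl a b c d))

expSum-conj : ∀ n z → expSum n (conj z) ≡ conj (expSum n z)
expSum-conj zero    z = refl
expSum-conj (suc n) z = trans (cong₂ (λ x y → x +ᴳ invFact n • y) (expSum-conj n z) (conj-^ z n))
  (cong (Re (expSum n z) + invFact n * Re (z ^ᴳ n) +i_)
    (solve 3 (λ x f y → (:- x) :+ f :* (:- y) := :- (x :+ f :* y)) refl (Im (expSum n z)) (invFact n) (Im (z ^ᴳ n))))

∥ι∥ : ∀ x → ∥ ι x ∥ ≡ ∣ x ∣
∥ι∥ x = +-identityʳ ∣ x ∣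

module ExpEstimates (n : ℕ) (R δ : ℚ) (δ≤½ : δ ≤ ½)
  (expSum-+≈ : ∀ z w → ∥ z ∥ ≤ R → ∥ w ∥ ≤ R → ∥ expSum (suc n) z *ᴳ expSum (suc n) w -ᴳ expSum (suc n) (z +ᴳ w) ∥ ≤ δ) where

  E : ℚ [i] → ℚ [i]
  E = expSum (suc n)

  e : ℚ → ℚ
  e = realExpSum (suc n)

  -- At negative x the truncated series has terms of both signs, and even its positivity is not
  -- evident. The functional equation passes to x + X ≥ 0, where the constant term alone gives 1.
  e-lower : ∀ x X → ∣ x ∣ ≤ R → ∣ X ∣ ≤ R → 0ℚ ≤ x + X → ½ ≤ e x * e X
  e-lower x X x≤R X≤R 0≤x+X = +-cancelʳ-≤ ½ (begin
    1ℚ                ≤⟨ 1≤realExpSum n 0≤x+X ⟩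
    e (x + X)         ≤⟨ ≥-from-∣-∣ {e x * e X} {e (x + X)} {δ} (begin
      ∣ e x * e X - e (x + X) ∣                    ≡⟨ cong (λ p → ∣ p - e (x + X) ∣) (solve 2 (λ a b → a :* b := a :* b :- con 0ℚ :* con 0ℚ) refl (e x) (e X)) ⟩
      ∣ Re (ι (e x) *ᴳ ι (e X) -ᴳ ι (e (x + X))) ∣  ≤⟨ ∣Re∣≤∥∥ (ι (e x) *ᴳ ι (e X) -ᴳ ι (e (x + X))) ⟩
      ∥ ι (e x) *ᴳ ι (e X) -ᴳ ι (e (x + X)) ∥      ≤⟨ subst₂ (λ u v → ∥ u -ᴳ v ∥ ≤ δ) (cong₂ _*ᴳ_ (expSum-ι (suc n) x) (expSum-ι (suc n) X)) (expSum-ι (suc n) (x + X))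
                                                         (expSum-+≈ (ι x) (ι X) (subst (_≤ R) (sym (∥ι∥ x)) x≤R) (subst (_≤ R) (sym (∥ι∥ X)) X≤R)) ⟩
      δ ∎) ⟩
    e x * e X + δ     ≤⟨ +-monoʳ-≤ (e x * e X) δ≤½ ⟩
    e x * e X + ½     ∎)
    where open ≤-Reasoning

  0≤e : ∀ x X → ∣ x ∣ ≤ R → ∣ X ∣ ≤ R → 0ℚ ≤ X → 0ℚ ≤ x + X → 0ℚ ≤ e x
  0≤e x X x≤R X≤R 0≤X 0≤x+X with ≤-total 0ℚ (e x)
  ... | inj₁ 0≤ex = 0≤ex
  ... | inj₂ ex≤0 = ⊥-elim (<⇒≱ (positive⁻¹ ½) (≤-trans (e-lower x X x≤R X≤R 0≤x+X)
    (≤-trans (*-monoʳ {e X} {e x} {0ℚ} (0≤realExpSum (suc n) 0≤X) ex≤0) (≤-reflexive (*-zeroˡ (e X))))))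

  -- The product with the conjugate is E(i τ) E(- i τ), which is within δ of E(0). Hence c² + s² ≤
  -- 3/2, weakened to the square 2² to bound both components by 2.
  rotation-≤4 : ∀ τ → ∣ τ ∣ ≤ R → ∥ E (0ℚ +i τ) ∥ ≤ fromℕ 4
  rotation-≤4 τ τ≤R = +-mono-≤ {∣ c ∣} {2ℚ} {∣ s ∣} {2ℚ}
      (∣p∣≤-from-square 0≤2 (≤-trans (p≤p+q (0≤p*p s)) norm²≤4))
      (∣p∣≤-from-square 0≤2 (≤-trans (subst (_≤ c * c + s * s) (+-identityˡ (s * s)) (+-monoˡ-≤ (s * s) (0≤p*p c))) norm²≤4))
    where
    open ≤-Reasoning
    c s : ℚ
    c = Re (E (0ℚ +i τ))
    s = Im (E (0ℚ +i τ))
    i∣τ∣≤R : ∀ {τ} → ∣ τ ∣ ≤ R → ∥ 0ℚ +i τ ∥ ≤ R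
    i∣τ∣≤R {τ} = subst (_≤ R) (sym (+-identityˡ (∣ τ ∣)))
    product : ∥ E (0ℚ +i τ) *ᴳ conj (E (0ℚ +i τ)) -ᴳ ι (e 0ℚ) ∥ ≤ δ
    product = subst₂ (λ u v → ∥ E (0ℚ +i τ) *ᴳ u -ᴳ v ∥ ≤ δ) (expSum-conj (suc n) (0ℚ +i τ))
      (trans (cong E (cong₂ _+i_ (+-identityˡ 0ℚ) (+-inverseʳ τ))) (expSum-ι (suc n) 0ℚ))
      (expSum-+≈ (0ℚ +i τ) (0ℚ +i (- τ)) (i∣τ∣≤R τ≤R) (i∣τ∣≤R (subst (_≤ R) (sym (∣-p∣≡∣p∣ τ)) τ≤R)))
    norm²≤4 : c * c + s * s ≤ 2ℚ * 2ℚ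
    norm²≤4 = begin
      c * c + s * s                                  ≡⟨ solve 3 (λ c s x → c :* c :+ s :* s := (c :* c :- s :* (:- s) :- x) :+ x) refl c s (e 0ℚ) ⟩
      (c * c - s * (- s) - e 0ℚ) + e 0ℚ              ≤⟨ +-mono-≤ (≤-trans (p≤∣p∣ (c * c - s * (- s) - e 0ℚ)) (≤-trans (∣Re∣≤∥∥ (E (0ℚ +i τ) *ᴳ conj (E (0ℚ +i τ)) -ᴳ ι (e 0ℚ))) product)) (realExpSum-0 (suc n)) ⟩
      δ + 1ℚ                                         ≤⟨ +-monoˡ-≤ 1ℚ δ≤½ ⟩
      ½ + 1ℚ                                         ≤⟨ ≤ᵇ⇒≤ _ ⟩
      2ℚ * 2ℚ                                        ∎

  -- exp (i τ) exp (x + i y) = exp x (cos (τ + y) + i sin (τ + y)).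
  rotated-lower : ∀ τ x y → ∥ 0ℚ +i τ ∥ ≤ R → ∥ x +i y ∥ ≤ R → ∣ x ∣ ≤ R → ∥ 0ℚ +i (τ + y) ∥ ≤ R → ∣ τ + y ∣ ≤ ⅓ → 0ℚ ≤ e x →
    ½ * e x ≤ Re (E (0ℚ +i τ) *ᴳ E (x +i y)) + (δ + δ)
  rotated-lower τ x y τ≤R z≤R x≤R θ≤R θ≤⅓ 0≤ex = begin
    ½ * e x                                          ≤⟨ *-monoʳ {e x} {½} {c} 0≤ex (½≤cos n θ≤⅓) ⟩
    c * e x                                          ≡⟨ solve 3 (λ c x s → c :* x := x :* c :- con 0ℚ :* s) refl c (e x) (Im (E (0ℚ +i θ))) ⟩
    Re (ι (e x) *ᴳ E (0ℚ +i θ))                      ≤⟨ ≥-from-∣-∣ {Re (W *ᴳ Z)} {Re (ι (e x) *ᴳ E (0ℚ +i θ))} (≤-trans (∣Re∣≤∥∥ (W *ᴳ Z -ᴳ ι (e x) *ᴳ E (0ℚ +i θ))) close) ⟩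
    Re (W *ᴳ Z) + (δ + δ)                            ∎
    where
    open ≤-Reasoning
    θ c : ℚ
    θ = τ + y
    c = Re (E (0ℚ +i θ))
    W Z : ℚ [i]
    W = E (0ℚ +i τ)
    Z = E (x +i y)
    first : ∥ W *ᴳ Z -ᴳ E (x +i θ) ∥ ≤ δ
    first = subst (λ u → ∥ W *ᴳ Z -ᴳ E (u +i θ) ∥ ≤ δ) (+-identityˡ x) (expSum-+≈ (0ℚ +i τ) (x +i y) τ≤R z≤R)
    second : ∥ ι (e x) *ᴳ E (0ℚ +i θ) -ᴳ E (x +i θ) ∥ ≤ δ
    second = subst₂ (λ u v → ∥ u *ᴳ E (0ℚ +i θ) -ᴳ E v ∥ ≤ δ) (expSum-ι (suc n) x) (cong₂ _+i_ (+-identityʳ x) (+-identityˡ θ))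
      (expSum-+≈ (ι x) (0ℚ +i θ) (subst (_≤ R) (sym (∥ι∥ x)) x≤R) θ≤R)
    close : ∥ W *ᴳ Z -ᴳ ι (e x) *ᴳ E (0ℚ +i θ) ∥ ≤ δ + δ
    close = ≤-trans (triangleᴳ (W *ᴳ Z) (E (x +i θ)) (ι (e x) *ᴳ E (0ℚ +i θ)))
      (+-mono-≤ first (subst (_≤ δ) (norm-swap (ι (e x) *ᴳ E (0ℚ +i θ)) (E (x +i θ))) second))

-- The sum over one block

sumTo : (ℕ → ℚ) → ℕ → ℚ
sumTo g zero    = 0ℚ
sumTo g (suc K) = sumTo g K + g (suc K)

sumTo-mono-+ : ∀ g {K} c → (∀ k → K ℕ.< k → k ℕ.≤ K ℕ.+ c → 0ℚ ≤ g k) → sumTo g K ≤ sumTo g (K ℕ.+ c)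
sumTo-mono-+ g {K} zero    0≤g = ≤-reflexive (cong (sumTo g) (sym (ℕP.+-identityʳ K)))
sumTo-mono-+ g {K} (suc c) 0≤g rewrite ℕP.+-suc K c =
  ≤-trans (sumTo-mono-+ g c (λ k K<k k≤ → 0≤g k K<k (ℕP.m≤n⇒m≤1+n k≤))) (p≤p+q (0≤g (suc (K ℕ.+ c)) (ℕ.s≤s (ℕP.m≤m+n K c)) ℕP.≤-refl))

sumTo-mono : ∀ g {K L} → K ℕ.≤ L → (∀ k → K ℕ.< k → k ℕ.≤ L → 0ℚ ≤ g k) → sumTo g K ≤ sumTo g L
sumTo-mono g {K} {L} K≤L 0≤g = subst (λ l → sumTo g K ≤ sumTo g l) (ℕP.m+[n∸m]≡n K≤L)
  (sumTo-mono-+ g (L ℕ.∸ K) (λ k K<k k≤ → 0≤g k K<k (subst (k ℕ.≤_) (ℕP.m+[n∸m]≡n K≤L) k≤)))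

sumTo-last : ∀ g {K L} → K ℕ.< L → (∀ k → K ℕ.< k → k ℕ.≤ L → 0ℚ ≤ g k) → sumTo g K + g L ≤ sumTo g L
sumTo-last g {K} {suc L} (ℕ.s≤s K≤L) 0≤g = +-monoˡ-≤ (g (suc L)) (sumTo-mono g K≤L (λ k K<k k≤L → 0≤g k K<k (ℕP.m≤n⇒m≤1+n k≤L)))

-- Between consecutive powers only the term at the upper one is kept; the others are nonnegative.
sumTo-powers : ∀ g c A m j → (∀ k → A ℕ.^ suc m ℕ.< k → k ℕ.≤ (A ℕ.+ j) ℕ.^ suc m → 0ℚ ≤ g k) →
  (∀ N → A ℕ.< N → N ℕ.≤ A ℕ.+ j → c ≤ g (N ℕ.^ suc m)) →
  sumTo g (A ℕ.^ suc m) + fromℕ j * c ≤ sumTo g ((A ℕ.+ j) ℕ.^ suc m)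
sumTo-powers g c A m zero    0≤g c≤g rewrite ℕP.+-identityʳ A = ≤-reflexive (trans (cong (sumTo g (A ℕ.^ suc m) +_) (*-zeroˡ c)) (+-identityʳ (sumTo g (A ℕ.^ suc m))))
sumTo-powers g c A m (suc j) 0≤g c≤g rewrite ℕP.+-suc A j = begin
  S + fromℕ (suc j) * c                          ≡⟨ cong (λ x → S + x * c) (fromℕ-suc j) ⟩
  S + (1ℚ + fromℕ j) * c                         ≡⟨ solve 3 (λ s j c → s :+ (con 1ℚ :+ j) :* c := (s :+ j :* c) :+ c) refl S (fromℕ j) c ⟩
  (S + fromℕ j * c) + c                          ≤⟨ +-mono-≤ (sumTo-powers g c A m j (λ k A<k k≤ → 0≤g k A<k (ℕP.≤-trans k≤ (ℕP.<⇒≤ step))) (λ N A<N N≤ → c≤g N A<N (ℕP.m≤n⇒m≤1+n N≤)))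
                                                            (c≤g (suc (A ℕ.+ j)) (ℕ.s≤s (ℕP.m≤m+n A j)) ℕP.≤-refl) ⟩
  sumTo g ((A ℕ.+ j) ℕ.^ suc m) + g (suc (A ℕ.+ j) ℕ.^ suc m)
                                                 ≤⟨ sumTo-last g step (λ k <k k≤ → 0≤g k (ℕP.≤-<-trans (ℕP.^-monoˡ-≤ (suc m) (ℕP.m≤m+n A j)) <k) k≤) ⟩
  sumTo g (suc (A ℕ.+ j) ℕ.^ suc m)              ∎
  where
  open ≤-Reasoning
  S : ℚ
  S = sumTo g (A ℕ.^ suc m)
  step : (A ℕ.+ j) ℕ.^ suc m ℕ.< suc (A ℕ.+ j) ℕ.^ suc m
  step = ℕP.^-monoˡ-< (suc m) (ℕP.n<1+n (A ℕ.+ j))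

0≤sumTo : ∀ {g} → (∀ k → 0ℚ ≤ g k) → ∀ K → 0ℚ ≤ sumTo g K
0≤sumTo 0≤g zero    = ≤-refl
0≤sumTo 0≤g (suc K) = 0≤+ (0≤sumTo 0≤g K) (0≤g (suc K))

weightedSum : (ℕ → ℕ) → (ℕ → ℚ [i]) → ℕ → ℚ [i]
weightedSum f E zero    = 0ᴳ
weightedSum f E (suc K) = weightedSum f E K +ᴳ fromℕ (f (suc K)) • E (suc K)

-- The lower bounds for the rotated terms hold only up to δ. Adding δ to every term makes the
-- summands nonnegative on the block, at the total cost of δ times the sum of the f(k).
Re-weightedSum : ∀ f E w δ K → Re (w *ᴳ weightedSum f E K) + δ * sumTo (λ k → fromℕ (f k)) K ≡
  sumTo (λ k → fromℕ (f k) * (Re (w *ᴳ E k) + δ)) K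
Re-weightedSum f E w δ zero    = solve 3 (λ a b d → (a :* con 0ℚ :- b :* con 0ℚ) :+ d :* con 0ℚ := con 0ℚ) refl (Re w) (Im w) δ
Re-weightedSum f E w δ (suc K) = trans
  (solve 9 (λ a b x y f u v d s → (a :* (x :+ f :* u) :- b :* (y :+ f :* v)) :+ d :* (s :+ f) :=
      ((a :* x :- b :* y) :+ d :* s) :+ f :* ((a :* u :- b :* v) :+ d)) refl
    (Re w) (Im w) (Re (weightedSum f E K)) (Im (weightedSum f E K)) (fromℕ (f (suc K))) (Re (E (suc K))) (Im (E (suc K))) δ (sumTo (λ k → fromℕ (f k)) K))
  (cong (_+ fromℕ (f (suc K)) * (Re (w *ᴳ E (suc K)) + δ)) (Re-weightedSum f E w δ K))

-- This is 2ᵐ - 1, the sum of the binomial coefficients of (1 + x)ᵐ after the constant one; for 0 ≤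
-- x ≤ 1 every power of x there is at most x.
growth : ℕ → ℕ
growth zero    = 0
growth (suc m) = suc (2 ℕ.* growth m)

-- (1 + 1 / q)ᵐ ≤ 1 + growth m / q, cleared of denominators.
growth-≤ : ∀ q m → suc q ℕ.* suc (suc q) ℕ.^ m ℕ.≤ (suc q ℕ.+ growth m) ℕ.* suc q ℕ.^ m
growth-≤ q zero    = ℕP.*-monoˡ-≤ 1 (ℕP.m≤m+n (suc q) 0)
growth-≤ q (suc m) = begin
  suc q ℕ.* (suc (suc q) ℕ.* P)                                ≡⟨ ℕS.solve 3 (λ x y z → x ℕS.:* (y ℕS.:* z) ℕS.:= y ℕS.:* (x ℕS.:* z)) refl (suc q) (suc (suc q)) P ⟩
  suc (suc q) ℕ.* (suc q ℕ.* P)                                ≤⟨ ℕP.*-monoʳ-≤ (suc (suc q)) (growth-≤ q m) ⟩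
  suc (suc q) ℕ.* ((suc q ℕ.+ c) ℕ.* Q)                        ≤⟨ ℕP.m≤m+n _ (c ℕ.* q ℕ.* Q) ⟩
  suc (suc q) ℕ.* ((suc q ℕ.+ c) ℕ.* Q) ℕ.+ c ℕ.* q ℕ.* Q      ≡⟨ ℕS.solve 3 (λ q c Q → (ℕS.con 2 ℕS.:+ q) ℕS.:* ((ℕS.con 1 ℕS.:+ q ℕS.:+ c) ℕS.:* Q) ℕS.:+ c ℕS.:* q ℕS.:* Q
                                                                     ℕS.:= (ℕS.con 1 ℕS.:+ q ℕS.:+ (ℕS.con 1 ℕS.:+ ℕS.con 2 ℕS.:* c)) ℕS.:* ((ℕS.con 1 ℕS.:+ q) ℕS.:* Q)) refl q c Q ⟩
  (suc q ℕ.+ suc (2 ℕ.* c)) ℕ.* (suc q ℕ.* Q)                  ∎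
  where
  open ℕP.≤-Reasoning
  c P Q : ℕ
  c = growth m
  P = suc (suc q) ℕ.^ m
  Q = suc q ℕ.^ m

^-distribʳ-* : ∀ k l m → (k ℕ.* l) ℕ.^ m ≡ k ℕ.^ m ℕ.* l ℕ.^ m
^-distribʳ-* k l zero    = refl
^-distribʳ-* k l (suc m) = trans (cong (k ℕ.* l ℕ.*_) (^-distribʳ-* k l m))
  (ℕS.solve 4 (λ k l x y → k ℕS.:* l ℕS.:* (x ℕS.:* y) ℕS.:= k ℕS.:* x ℕS.:* (l ℕS.:* y)) refl k l (k ℕ.^ m) (l ℕ.^ m))

module _ {K K′} (r : ℕ) .{{_ : ℕ.NonZero K}} (K≤K′ : K ℕ.≤ K′) where

  lnSeq-mono : lnSeq K (suc r) ≤ lnSeq K′ (suc r)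
  lnSeq-mono = subst (λ k → lnSeq K (suc r) ≤ lnSeq k (suc r)) (ℕP.m+[n∸m]≡n K≤K′) (lnSeq-mono-+ K (K′ ℕ.∸ K) (suc r))

  lnSeq-difference : fromℕ K * (lnSeq K′ (suc r) - lnSeq K (suc r)) ≤ fromℕ (K′ ℕ.∸ K)
  lnSeq-difference = go K refl
    where
    go : ∀ L .{{_ : ℕ.NonZero L}} → L ≡ K → fromℕ K * (lnSeq K′ (suc r) - lnSeq K (suc r)) ≤ fromℕ (K′ ℕ.∸ K)
    go (suc L) refl = subst (λ k → fromℕ K * (lnSeq k (suc r) - lnSeq K (suc r)) ≤ fromℕ (K′ ℕ.∸ K)) (ℕP.m+[n∸m]≡n K≤K′) (lnSeq-difference-+ L (K′ ℕ.∸ K) r)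

-- The numbers j, q and m of the overview are `suc j`, `suc q` and `suc m`, here and in `Block`.
blockEnd : ℕ → ℕ → ℕ → ℕ
blockEnd j q m = (suc j ℕ.* suc q ℕ.+ suc j) ℕ.^ suc m

-- Everything happens at the approximant index `suc n`: `σ` and `t` stand for Re s and Im s there,
-- and `η` is the slack by which `σ` may exceed (a + 1) / m. `η-small` limits its effect on the
-- exponents to ½, and the bounds on `R` keep all arguments in the ball where the functional
-- equation has error at most `δ`.
module Block (f : ℕ → ℕ) (a m : ℕ) (f-≥ : ∀ N → suc N ℕ.^ a ℕ.≤ f (suc N ℕ.^ suc m))
  (n : ℕ) (R δ : ℚ) (0≤δ : 0ℚ ≤ δ) (δ≤½ : δ ≤ ½)
  (expSum-+≈ : ∀ z w → ∥ z ∥ ≤ R → ∥ w ∥ ≤ R → ∥ expSum (suc n) z *ᴳ expSum (suc n) w -ᴳ expSum (suc n) (z +ᴳ w) ∥ ≤ δ)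
  (σ t S T η : ℚ) (σ≤S : ∣ σ ∣ ≤ S) (t≤T : ∣ t ∣ ≤ T) (0≤η : 0ℚ ≤ η) (σ≤b+η : σ ≤ fromℕ (suc a) * (int 1 / suc m) + η)
  (q j : ℕ) (T-small : T * fromℕ (growth (suc m)) ≤ fromℕ (suc q) * ⅓)
  (η-small : η * fromℕ (blockEnd j q m) ≤ ½)
  (R-large : fromℕ (blockEnd j q m) * S + fromℕ (blockEnd j q m) * T ≤ R) (R-large′ : fromℕ (suc a) * fromℕ (blockEnd j q m) + ½ ≤ R)
  where

  open ExpEstimates n R δ δ≤½ expSum-+≈
  open ≤-Reasoning

  r A K K′ : ℕ
  r  = suc n
  A  = suc j ℕ.* suc q
  K  = A ℕ.^ suc m
  K′ = blockEnd j q m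

  L : ℕ → ℚ
  L k = lnSeq k r

  k′ s′ : ℚ
  k′ = fromℕ K′
  s′ = fromℕ (suc a)

  0≤k′ : 0ℚ ≤ k′
  0≤k′ = 0≤fromℕ K′

  0≤S : 0ℚ ≤ S
  0≤S = ≤-trans (0≤∣p∣ σ) σ≤S

  0≤T : 0ℚ ≤ T
  0≤T = ≤-trans (0≤∣p∣ t) t≤T

  k′S≤R : k′ * S ≤ R
  k′S≤R = ≤-trans (p≤p+q (0≤* 0≤k′ 0≤T)) R-large

  k′T≤R : k′ * T ≤ R
  k′T≤R = ≤-trans (subst (_≤ k′ * S + k′ * T) (+-identityˡ (k′ * T)) (+-monoˡ-≤ (k′ * T) (0≤* 0≤k′ 0≤S))) R-large

  ⅓≤R : ⅓ ≤ R
  ⅓≤R = ≤-trans (≤ᵇ⇒≤ {⅓} {½} _) (≤-trans (subst (_≤ s′ * k′ + ½) (+-identityˡ ½) (+-monoˡ-≤ ½ (0≤* (0≤fromℕ (suc a)) 0≤k′))) R-large′)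

  instance
    A≢0 : ℕ.NonZero A
    A≢0 = _
    K≢0 : ℕ.NonZero K
    K≢0 = ℕP.m^n≢0 A (suc m)

  K≤K′ : K ℕ.≤ K′
  K≤K′ = ℕP.^-monoˡ-≤ (suc m) (ℕP.m≤m+n A (suc j))

  0≤L : ∀ k .{{_ : ℕ.NonZero k}} → 0ℚ ≤ L k
  0≤L (suc k) = 0≤lnSeq k r

  L≤k′ : ∀ k .{{_ : ℕ.NonZero k}} → k ℕ.≤ K′ → L k ≤ k′
  L≤k′ (suc k) k≤K′ = ≤-trans (lnSeq-≤ k n) (fromℕ-mono {k} {K′} (ℕP.<⇒≤ k≤K′))

  L*-≤ : ∀ k .{{_ : ℕ.NonZero k}} → k ℕ.≤ K′ → ∀ {u U} → ∣ u ∣ ≤ U → ∣ L k * u ∣ ≤ k′ * U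
  L*-≤ k k≤K′ {u} {U} u≤U = begin
    ∣ L k * u ∣          ≡⟨ ∣p*q∣≡∣p∣*∣q∣ (L k) u ⟩
    ∣ L k ∣ * ∣ u ∣      ≡⟨ cong (_* ∣ u ∣) (0≤p⇒∣p∣≡p (0≤L k)) ⟩
    L k * ∣ u ∣          ≤⟨ *-mono₂ {L k} {k′} {∣ u ∣} {U} (0≤L k) (≤-trans (0≤∣p∣ u) u≤U) (L≤k′ k k≤K′) u≤U ⟩
    k′ * U               ∎

  -L*-≤ : ∀ k .{{_ : ℕ.NonZero k}} → k ℕ.≤ K′ → ∀ {u U} → ∣ u ∣ ≤ U → ∣ (- L k) * u ∣ ≤ k′ * U
  -L*-≤ k k≤K′ {u} {U} u≤U = subst (_≤ k′ * U) (trans (sym (∣-p∣≡∣p∣ (L k * u))) (cong ∣_∣ (neg-distribˡ-* (L k) u))) (L*-≤ k k≤K′ u≤U)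

  -- K′ / K = (1 + 1 / (q + 1))ᵐ⁺¹ is independent of j.
  gap : suc q ℕ.* (K′ ℕ.∸ K) ℕ.≤ growth (suc m) ℕ.* K
  gap = ℕP.≤-trans (ℕP.≤-reflexive (ℕP.*-distribˡ-∸ (suc q) K′ K))
    (ℕP.m≤n+o⇒m∸n≤o (suc q ℕ.* K′) (suc q ℕ.* K) (ℕP.≤-trans scaled (ℕP.≤-reflexive (ℕP.*-distribʳ-+ K (suc q) (growth (suc m))))))
    where
    J′ : ℕ
    J′ = suc j ℕ.^ suc m
    K≡ : K ≡ J′ ℕ.* suc q ℕ.^ suc m
    K≡ = ^-distribʳ-* (suc j) (suc q) (suc m)
    K′≡ : K′ ≡ J′ ℕ.* suc (suc q) ℕ.^ suc m
    K′≡ = trans (cong (ℕ._^ suc m) (trans (ℕP.+-comm A (suc j)) (sym (ℕP.*-suc (suc j) (suc q))))) (^-distribʳ-* (suc j) (suc (suc q)) (suc m))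
    swap : ∀ x y z → x ℕ.* (y ℕ.* z) ≡ y ℕ.* (x ℕ.* z)
    swap = ℕS.solve 3 (λ x y z → x ℕS.:* (y ℕS.:* z) ℕS.:= y ℕS.:* (x ℕS.:* z)) refl
    scaled : suc q ℕ.* K′ ℕ.≤ (suc q ℕ.+ growth (suc m)) ℕ.* K
    scaled = subst₂ ℕ._≤_ (trans (swap J′ (suc q) (suc (suc q) ℕ.^ suc m)) (cong (suc q ℕ.*_) (sym K′≡)))
      (trans (swap J′ (suc q ℕ.+ growth (suc m)) (suc q ℕ.^ suc m)) (cong ((suc q ℕ.+ growth (suc m)) ℕ.*_) (sym K≡)))
      (ℕP.*-monoʳ-≤ J′ (growth-≤ q (suc m)))

  T*D≤⅓ : T * (L K′ - L K) ≤ ⅓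
  T*D≤⅓ = *-cancelˡ (0<fromℕ-suc q) (begin
    fromℕ (suc q) * (T * D)            ≡⟨ solve 3 (λ q t d → q :* (t :* d) := t :* (q :* d)) refl (fromℕ (suc q)) T D ⟩
    T * (fromℕ (suc q) * D)            ≤⟨ *-monoˡ 0≤T qD≤c ⟩
    T * fromℕ (growth (suc m))         ≤⟨ T-small ⟩
    fromℕ (suc q) * ⅓                  ∎)
    where
    D : ℚ
    D = L K′ - L K
    0<K : 0ℚ < fromℕ K
    0<K = positive⁻¹ (fromℕ K) {{normalize-pos K 1}}
    qD≤c : fromℕ (suc q) * D ≤ fromℕ (growth (suc m))
    qD≤c = *-cancelˡ 0<K (begin
      fromℕ K * (fromℕ (suc q) * D)            ≡⟨ solve 3 (λ k q d → k :* (q :* d) := q :* (k :* d)) refl (fromℕ K) (fromℕ (suc q)) D ⟩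
      fromℕ (suc q) * (fromℕ K * D)            ≤⟨ *-monoˡ (0≤fromℕ (suc q)) (lnSeq-difference n K≤K′) ⟩
      fromℕ (suc q) * fromℕ (K′ ℕ.∸ K)         ≡⟨ sym (fromℕ-* (suc q) (K′ ℕ.∸ K)) ⟩
      fromℕ (suc q ℕ.* (K′ ℕ.∸ K))             ≤⟨ fromℕ-mono gap ⟩
      fromℕ (growth (suc m) ℕ.* K)             ≡⟨ trans (fromℕ-* (growth (suc m)) K) (*-comm (fromℕ (growth (suc m))) (fromℕ K)) ⟩
      fromℕ K * fromℕ (growth (suc m))         ∎)

  τ : ℚ
  τ = L K * t

  angle-≤⅓ : ∀ k → K ℕ.≤ k → k ℕ.≤ K′ → ∣ τ + (- L k) * t ∣ ≤ ⅓
  angle-≤⅓ k K≤k k≤K′ = begin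
    ∣ L K * t + (- L k) * t ∣          ≡⟨ cong ∣_∣ (solve 3 (λ x y t → x :* t :+ (:- y) :* t := :- ((y :- x) :* t)) refl (L K) (L k) t) ⟩
    ∣ - ((L k - L K) * t) ∣            ≡⟨ ∣-p∣≡∣p∣ ((L k - L K) * t) ⟩
    ∣ (L k - L K) * t ∣                ≡⟨ ∣p*q∣≡∣p∣*∣q∣ (L k - L K) t ⟩
    ∣ L k - L K ∣ * ∣ t ∣              ≡⟨ cong (_* ∣ t ∣) (0≤p⇒∣p∣≡p 0≤d) ⟩
    (L k - L K) * ∣ t ∣                ≤⟨ *-mono₂ {L k - L K} {L K′ - L K} {∣ t ∣} {T} 0≤d 0≤T (+-monoˡ-≤ (- L K) (lnSeq-mono n {{ℕ.>-nonZero (ℕP.<-≤-trans (ℕ.>-nonZero⁻¹ K) K≤k)}} k≤K′)) t≤T ⟩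
    (L K′ - L K) * T                   ≡⟨ *-comm (L K′ - L K) T ⟩
    T * (L K′ - L K)                   ≤⟨ T*D≤⅓ ⟩
    ⅓                                  ∎
    where
    0≤d : 0ℚ ≤ L k - L K
    0≤d = p≤q⇒0≤q-p (lnSeq-mono n K≤k)

  x : ℕ → ℚ
  x k = (- L k) * σ

  ∣x∣≤R : ∀ k .{{_ : ℕ.NonZero k}} → k ℕ.≤ K′ → ∣ x k ∣ ≤ R
  ∣x∣≤R k k≤K′ = ≤-trans (-L*-≤ k k≤K′ σ≤S) k′S≤R

  -- The partner `L k * S` makes the sum of the arguments nonnegative because σ ≤ S.
  0≤e-x : ∀ k .{{_ : ℕ.NonZero k}} → k ℕ.≤ K′ → 0ℚ ≤ e (x k)
  0≤e-x k k≤K′ = 0≤e (x k) (L k * S) (∣x∣≤R k k≤K′) (≤-trans (L*-≤ k k≤K′ (≤-reflexive (0≤p⇒∣p∣≡p 0≤S))) k′S≤R)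
    (0≤* (0≤L k) 0≤S)
    (subst (0ℚ ≤_) (solve 3 (λ l s σ → l :* (s :- σ) := (:- l) :* σ :+ l :* s) refl (L k) S σ)
      (0≤* (0≤L k) (p≤q⇒0≤q-p (≤-trans (p≤∣p∣ σ) σ≤S))))

  term : ℕ → ℚ [i]
  term k = E (x k +i (- L k) * t)

  rotation : ℚ [i]
  rotation = E (0ℚ +i τ)

  i-norm : ∀ {u} → ∣ u ∣ ≤ R → ∥ 0ℚ +i u ∥ ≤ R
  i-norm {u} = subst (_≤ R) (sym (+-identityˡ (∣ u ∣)))

  term-lower : ∀ k .{{_ : ℕ.NonZero k}} → K ℕ.≤ k → k ℕ.≤ K′ → ½ * e (x k) ≤ Re (rotation *ᴳ term k) + (δ + δ)
  term-lower k K≤k k≤K′ = rotated-lower τ (x k) ((- L k) * t)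
    (i-norm (≤-trans (L*-≤ K K≤K′ t≤T) k′T≤R))
    (≤-trans (+-mono-≤ (-L*-≤ k k≤K′ σ≤S) (-L*-≤ k k≤K′ t≤T)) R-large)
    (∣x∣≤R k k≤K′) (i-norm (≤-trans (angle-≤⅓ k K≤k k≤K′) ⅓≤R)) (angle-≤⅓ k K≤k k≤K′) (0≤e-x k k≤K′)

  -- For k = Nᵐ the number X = (a + 1) ln N + ½ dominates σ ln k, the ½ absorbing the slack η. So
  -- e(- σ ln k) e(X) ≥ ½, while e(X) ≤ 2 Nᵃ⁺¹.
  power-lower : ∀ N → suc N ℕ.^ suc m ℕ.≤ K′ → ¼ ≤ fromℕ (suc N ℕ.^ suc a) * e (x (suc N ℕ.^ suc m))
  power-lower N k≤K′ = *-cancelˡ {2ℚ} (positive⁻¹ 2ℚ) (begin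
    ½                                        ≤⟨ e-lower (x k) X (∣x∣≤R k k≤K′) X≤R 0≤x+X ⟩
    e (x k) * e X                            ≤⟨ *-monoˡ (0≤e-x k k≤K′) eX≤ ⟩
    e (x k) * (P * 2ℚ)                       ≡⟨ solve 3 (λ e p c → e :* (p :* c) := c :* (p :* e)) refl (e (x k)) P 2ℚ ⟩
    2ℚ * (P * e (x k))                       ∎)
    where
    k M : ℕ
    k = suc N ℕ.^ suc m
    M = k ℕ.* r
    instance
      k≢0 : ℕ.NonZero k
      k≢0 = ℕP.m^n≢0 (suc N) (suc m)
      M≢0 : ℕ.NonZero M
      M≢0 = ℕP.m*n≢0 k r
    Λ P X : ℚ
    -- The logarithm of N is taken at the index k r, as `lnSeq-power` requires; `realExpSum-power`
    -- applies at every positive index.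
    Λ = lnSeq (suc N) M
    P = fromℕ (suc N ℕ.^ suc a)
    X = s′ * Λ + ½
    0≤λ : 0ℚ ≤ Λ
    0≤λ = 0≤lnSeq N M
    λ≤k′ : Λ ≤ k′
    λ≤k′ = ≤-trans (subst (λ M → lnSeq (suc N) M ≤ fromℕ N) (ℕP.suc-pred M) (lnSeq-≤ N (ℕ.pred M)))
      (fromℕ-mono (ℕP.<⇒≤ (ℕP.≤-trans (subst (ℕ._≤ k) (ℕP.*-identityʳ (suc N)) (ℕP.^-monoʳ-≤ (suc N) {1} {suc m} (ℕ.s≤s ℕ.z≤n))) k≤K′)))
    0≤X : 0ℚ ≤ X
    0≤X = 0≤+ (0≤* (0≤fromℕ (suc a)) 0≤λ) (nonNegative⁻¹ ½)
    X≤R : ∣ X ∣ ≤ R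
    X≤R = subst (_≤ R) (sym (0≤p⇒∣p∣≡p 0≤X)) (≤-trans (+-monoˡ-≤ ½ (*-monoˡ (0≤fromℕ (suc a)) λ≤k′)) R-large′)
    eX≤ : e X ≤ P * 2ℚ
    eX≤ = ≤-trans (subst (λ M → e (s′ * lnSeq (suc N) M + ½) ≤ P * e ½) (ℕP.suc-pred M) (realExpSum-power (suc n) (nonNegative⁻¹ ½) N (ℕ.pred M) (suc a)))
      (*-monoˡ (0≤fromℕ (suc N ℕ.^ suc a)) (realExpSum-halves 1 (suc n)))
    Lσ≤X : L k * σ ≤ X
    Lσ≤X = begin
      L k * σ
        ≤⟨ *-monoˡ (0≤L k) σ≤b+η ⟩
      L k * (s′ * (int 1 / suc m) + η)
        ≡⟨ *-distribˡ-+ (L k) (s′ * (int 1 / suc m)) η ⟩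
      L k * (s′ * (int 1 / suc m)) + L k * η
        ≤⟨ +-mono-≤ (*-monoʳ (0≤* (0≤fromℕ (suc a)) (<⇒≤ (0<1/suc m))) (lnSeq-power N r (suc m) (suc m) ℕP.≤-refl))
                    (≤-trans (*-monoʳ 0≤η (L≤k′ k k≤K′)) (≤-trans (≤-reflexive (*-comm k′ η)) η-small)) ⟩
      fromℕ (suc m) * Λ * (s′ * (int 1 / suc m)) + ½
        ≡⟨ cong (_+ ½) (solve 4 (λ m l s i → m :* l :* (s :* i) := m :* i :* (s :* l)) refl (fromℕ (suc m)) Λ s′ (int 1 / suc m)) ⟩
      fromℕ (suc m) * (int 1 / suc m) * (s′ * Λ) + ½
        ≡⟨ cong (λ y → y * (s′ * Λ) + ½) (fromℕ-*-1/ m) ⟩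
      1ℚ * (s′ * Λ) + ½
        ≡⟨ cong (_+ ½) (*-identityˡ (s′ * Λ)) ⟩
      X ∎
    0≤x+X : 0ℚ ≤ x k + X
    0≤x+X = subst (0ℚ ≤_) (solve 3 (λ X l σ → X :- l :* σ := (:- l) :* σ :+ X) refl X (L k) σ) (p≤q⇒0≤q-p Lσ≤X)

  g : ℕ → ℚ
  g k = fromℕ (f k) * (Re (rotation *ᴳ term k) + (δ + δ))

  0≤g : ∀ k → K ℕ.< k → k ℕ.≤ K′ → 0ℚ ≤ g k
  0≤g k@(suc _) K<k k≤K′ = 0≤* (0≤fromℕ (f k)) (≤-trans (0≤* (nonNegative⁻¹ ½) (0≤e-x k k≤K′)) (term-lower k (ℕP.<⇒≤ K<k) k≤K′))

  -- The factor ⅛ is ½ from the cosine times ¼ from `power-lower`. Since f(Nᵐ) ≥ Nᵃ, a factor 1 / N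
  -- remains, and N is at most (j + 1) (q + 2) in the block.
  weight : ℚ
  weight = ⅛ * (int 1 / (suc j ℕ.* suc (suc q)))

  B≡ : A ℕ.+ suc j ≡ suc j ℕ.* suc (suc q)
  B≡ = trans (ℕP.+-comm A (suc j)) (sym (ℕP.*-suc (suc j) (suc q)))

  weight≤g : ∀ N → A ℕ.< N → N ℕ.≤ A ℕ.+ suc j → weight ≤ g (N ℕ.^ suc m)
  weight≤g N@(suc N₋) A<N N≤ = *-cancelˡ {fromℕ B} (0<fromℕ-suc (suc q ℕ.+ j ℕ.* suc (suc q))) (begin
    fromℕ B * (⅛ * (int 1 / B))                   ≡⟨ solve 3 (λ b c i → b :* (c :* i) := b :* i :* c) refl (fromℕ B) ⅛ (int 1 / B) ⟩
    fromℕ B * (int 1 / B) * ⅛                     ≡⟨ cong (_* ⅛) (fromℕ-*-1/ (suc q ℕ.+ j ℕ.* suc (suc q))) ⟩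
    1ℚ * ⅛                                        ≡⟨ *-identityˡ ⅛ ⟩
    ½ * ¼                                         ≤⟨ *-monoˡ (nonNegative⁻¹ ½) (power-lower N₋ k≤K′) ⟩
    ½ * (fromℕ (N ℕ.^ suc a) * e (x k))           ≡⟨ cong (λ y → ½ * (y * e (x k))) (fromℕ-* N (N ℕ.^ a)) ⟩
    ½ * (fromℕ N * fromℕ (N ℕ.^ a) * e (x k))     ≡⟨ solve 4 (λ h n p e → h :* (n :* p :* e) := n :* (p :* (h :* e))) refl ½ (fromℕ N) (fromℕ (N ℕ.^ a)) (e (x k)) ⟩
    fromℕ N * (fromℕ (N ℕ.^ a) * (½ * e (x k)))   ≤⟨ *-mono₂ {fromℕ N} {fromℕ B} {fromℕ (N ℕ.^ a) * (½ * e (x k))} {g k} (0≤fromℕ N) (0≤g k K<k k≤K′)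
                                                       (fromℕ-mono (subst (N ℕ.≤_) B≡ N≤))
                                                       (*-mono₂ {fromℕ (N ℕ.^ a)} {fromℕ (f k)} {½ * e (x k)} {Re (rotation *ᴳ term k) + (δ + δ)}
                                                         (0≤fromℕ (N ℕ.^ a)) (≤-trans (0≤* (nonNegative⁻¹ ½) (0≤e-x k k≤K′)) lower) (fromℕ-mono (f-≥ N₋)) lower) ⟩
    fromℕ B * g k                                 ∎)
    where
    B k : ℕ
    B = suc j ℕ.* suc (suc q)
    k = N ℕ.^ suc m
    instance
      k≢0 : ℕ.NonZero k
      k≢0 = ℕP.m^n≢0 N (suc m)
    K<k : K ℕ.< k
    K<k = ℕP.^-monoˡ-< (suc m) A<N
    k≤K′ : k ℕ.≤ K′
    k≤K′ = ℕP.^-monoˡ-≤ (suc m) N≤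
    lower : ½ * e (x k) ≤ Re (rotation *ᴳ term k) + (δ + δ)
    lower = term-lower k (ℕP.<⇒≤ K<k) k≤K′

  -- The block contains j + 1 values of N, each contributing at least `weight`, so j cancels and the
  -- bound depends on q alone.
  block-lower : ⅛ * (int 1 / suc (suc q)) ≤
    Re (rotation *ᴳ (weightedSum f term K′ -ᴳ weightedSum f term K)) + (δ + δ) * sumTo (λ k → fromℕ (f k)) K′
  block-lower = begin
    ⅛ * (int 1 / suc (suc q))
      ≡⟨ cong (⅛ *_) (sym (fromℕ-*-1/* j (suc q))) ⟩
    ⅛ * (fromℕ (suc j) * (int 1 / (suc j ℕ.* suc (suc q))))
      ≡⟨ solve 3 (λ c j i → c :* (j :* i) := j :* (c :* i)) refl ⅛ (fromℕ (suc j)) (int 1 / (suc j ℕ.* suc (suc q))) ⟩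
    J′
      ≤⟨ +-cancelʳ-≤ (W K + Δ * F K) (begin
           J′ + (W K + Δ * F K)             ≡⟨ cong (J′ +_) (Re-weightedSum f term rotation Δ K) ⟩
           J′ + sumTo g K                   ≡⟨ +-comm J′ (sumTo g K) ⟩
           sumTo g K + J′                   ≤⟨ sumTo-powers g weight A m (suc j) 0≤g weight≤g ⟩
           sumTo g K′                      ≡⟨ sym (Re-weightedSum f term rotation Δ K′) ⟩
           W K′ + Δ * F K′                 ≡⟨ solve 5 (λ u v d x y → u :+ d :* x := ((u :- v) :+ d :* x :- d :* y) :+ (v :+ d :* y)) refl (W K′) (W K) Δ (F K′) (F K) ⟩
           ((W K′ - W K) + Δ * F K′ - Δ * F K) + (W K + Δ * F K) ∎) ⟩
    (W K′ - W K) + Δ * F K′ - Δ * F K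
      ≤⟨ +-monoʳ-≤ ((W K′ - W K) + Δ * F K′) (neg-antimono-≤ (0≤* (0≤+ 0≤δ 0≤δ) (0≤sumTo (λ k → 0≤fromℕ (f k)) K))) ⟩
    (W K′ - W K) + Δ * F K′ - 0ℚ
      ≡⟨ +-identityʳ ((W K′ - W K) + Δ * F K′) ⟩
    (W K′ - W K) + Δ * F K′
      ≡⟨ cong (_+ Δ * F K′) (solve 6 (λ a b x y u v → (a :* x :- b :* y) :- (a :* u :- b :* v) := a :* (x :- u) :- b :* (y :- v)) refl
           (Re rotation) (Im rotation) (Re (weightedSum f term K′)) (Im (weightedSum f term K′)) (Re (weightedSum f term K)) (Im (weightedSum f term K))) ⟩
    Re (rotation *ᴳ (weightedSum f term K′ -ᴳ weightedSum f term K)) + Δ * F K′ ∎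
    where
    J′ Δ : ℚ
    J′ = fromℕ (suc j) * weight
    Δ = δ + δ
    W F : ℕ → ℚ
    W k = Re (rotation *ᴳ weightedSum f term k)
    F = sumTo (λ k → fromℕ (f k))

-- From the block estimate to divergence

approxTerm : ℂ → ℕ → ℕ → ℚ [i]
approxTerm s r k = expSum r ((- lnSeq k r) * seq (Re s) r +i (- lnSeq k r) * seq (Im s) r)

module _ (f : ℕ → ℕ) (s : ℂ) (r : ℕ) where

  -- Real operations act index by index and `exp` is taken along the diagonal, so the r-th
  -- approximant of a partial sum is a finite sum of r-th approximants, without any error.
  seq-Re-dirichletSum : ∀ K → seq (Re (dirichletSum f s K)) r ≡ Re (weightedSum f (approxTerm s r) K)
  seq-Re-dirichletSum zero    = refl
  seq-Re-dirichletSum (suc K) = cong (_+ fromℕ (f (suc K)) * Re (approxTerm s r (suc K))) (seq-Re-dirichletSum K)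

  seq-Im-dirichletSum : ∀ K → seq (Im (dirichletSum f s K)) r ≡ Im (weightedSum f (approxTerm s r) K)
  seq-Im-dirichletSum zero    = refl
  seq-Im-dirichletSum (suc K) = cong (_+ fromℕ (f (suc K)) * Im (approxTerm s r (suc K))) (seq-Im-dirichletSum K)

-- `≤ᴿ` permits an additive slack; the choice 3 ε² completes ε² to the square of 2 ε.
norm-from-squares : ∀ {p q ε} → 0ℚ ≤ ε → p * p + q * q ≤ ε * ε + fromℕ 3 * (ε * ε) → ∥ p +i q ∥ ≤ fromℕ 4 * ε
norm-from-squares {p} {q} {ε} 0≤ε le = ≤-trans (+-mono-≤ (component {p} {q} le) (component {q} {p} (≤-trans (≤-reflexive (+-comm (q * q) (p * p))) le)))
  (≤-reflexive (solve 1 (λ ε → con 2ℚ :* ε :+ con 2ℚ :* ε := con (fromℕ 4) :* ε) refl ε))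
  where
  component : ∀ {p q} → p * p + q * q ≤ ε * ε + fromℕ 3 * (ε * ε) → ∣ p ∣ ≤ 2ℚ * ε
  component {p} {q} le = ∣p∣≤-from-square (0≤* 0≤2 0≤ε) (≤-trans (p≤p+q (0≤p*p q)) (≤-trans le
    (≤-reflexive (solve 1 (λ ε → ε :* ε :+ con (fromℕ 3) :* (ε :* ε) := con 2ℚ :* ε :* (con 2ℚ :* ε)) refl ε))))

-- The Cauchy criterion. The index `M` comes after `K` and `K′` because the inequality between reals
-- holds for the approximants only from an index on that depends on the partial sum.
blocks-vanish : ∀ f s L → dirichletSum f s ⟶ L → ∀ {ε} → 0ℚ < ε → ∃ λ N → ∀ K K′ → N ℕ.≤ K → N ℕ.≤ K′ →
  ∃ λ M → ∀ r → M ℕ.≤ r → ∥ weightedSum f (approxTerm s r) K′ -ᴳ weightedSum f (approxTerm s r) K ∥ ≤ fromℕ 8 * ε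
blocks-vanish f s L conv {ε} 0<ε = N , λ K K′ N≤K N≤K′ → M K N≤K ℕ.⊔ M K′ N≤K′ , λ r M≤r → begin
  ∥ W r K′ -ᴳ W r K ∥                                ≤⟨ triangleᴳ (W r K′) (ℓ r) (W r K) ⟩
  ∥ W r K′ -ᴳ ℓ r ∥ + ∥ ℓ r -ᴳ W r K ∥               ≤⟨ +-mono-≤ (close K′ N≤K′ r (ℕP.m⊔n≤o⇒n≤o (M K N≤K) (M K′ N≤K′) M≤r))
                                                          (subst (_≤ fromℕ 4 * ε) (norm-swap (W r K) (ℓ r)) (close K N≤K r (ℕP.m⊔n≤o⇒m≤o (M K N≤K) (M K′ N≤K′) M≤r))) ⟩
  fromℕ 4 * ε + fromℕ 4 * ε                          ≡⟨ solve 1 (λ ε → con (fromℕ 4) :* ε :+ con (fromℕ 4) :* ε := con (fromℕ 8) :* ε) refl ε ⟩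
  fromℕ 8 * ε                                        ∎
  where
  open ≤-Reasoning
  W : ℕ → ℕ → ℚ [i]
  W r = weightedSum f (approxTerm s r)
  ℓ : ℕ → ℚ [i]
  ℓ r = seq (Re L) r +i seq (Im L) r
  0<3ε² : 0ℚ < fromℕ 3 * (ε * ε)
  0<3ε² = 0<* (positive⁻¹ (fromℕ 3)) (0<* 0<ε 0<ε)
  N : ℕ
  N = proj₁ (conv ε 0<ε)
  level : ∀ K → N ℕ.≤ K → _
  level K N≤K = proj₂ (conv ε 0<ε) K N≤K (fromℕ 3 * (ε * ε)) 0<3ε²
  M : ∀ K → N ℕ.≤ K → ℕ
  M K N≤K = proj₁ (level K N≤K)
  close : ∀ K N≤K r → M K N≤K ℕ.≤ r → ∥ W r K -ᴳ ℓ r ∥ ≤ fromℕ 4 * ε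
  close K N≤K r M≤r = subst₂ (λ u v → ∥ (u - seq (Re L) r) +i (v - seq (Im L) r) ∥ ≤ fromℕ 4 * ε)
    (seq-Re-dirichletSum f s r K) (seq-Im-dirichletSum f s r K)
    (norm-from-squares {seq (Re (dirichletSum f s K)) r - seq (Re L) r} {seq (Im (dirichletSum f s K)) r - seq (Im L) r} (<⇒≤ 0<ε) (proj₂ (level K N≤K) r M≤r))

shrink-½ : ∀ C {ε} → 0ℚ ≤ C → 0ℚ < ε → ∃ λ δ → 0ℚ < δ × δ ≤ ½ × C * δ ≤ ε
shrink-½ C {ε} 0≤C 0<ε with shrink C 0<ε
... | δ , 0<δ , Cδ≤ε with ≤-total δ ½
...   | inj₁ δ≤½ = δ , 0<δ , δ≤½ , Cδ≤ε
...   | inj₂ ½≤δ = ½ , positive⁻¹ ½ , ≤-refl , ≤-trans (*-monoˡ 0≤C ½≤δ) Cδ≤ε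

-- The choices are not circular: `q` depends on m and the bound for Im s, `κ` and `ε` on `q`, `j` on
-- `ε`; then the block fixes `F`, `η` and `R`, `F` and `κ` fix `δ`, and `n` is last.
dirichletSeries-diverges : ∀ (f : ℕ → ℕ) a m → (∀ N → suc N ℕ.^ a ℕ.≤ f (suc N ℕ.^ suc m)) →
  ∀ s → Re s ≤ᴿ fromℚ (fromℕ (suc a) * (int 1 / suc m)) → DirichletSeriesDiverges f s
dirichletSeries-diverges f a m f-≥ s Re-s≤ (lim , conv) = <⇒≱ 0<κ (*-cancelˡ (positive⁻¹ ¼) (+-cancelʳ-≤ (¼ * κ + ½ * κ) contradiction))
  where
  open ≤-Reasoning
  Bσ = bounded (seq (Re s)) (cauchy (Re s))
  Bt = bounded (seq (Im s)) (cauchy (Im s))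
  S T : ℚ
  S = proj₁ Bσ
  T = proj₁ Bt
  c : ℚ
  c = fromℕ (growth (suc m))
  q : ℕ
  q = proj₁ (archimedean (T * c) (positive⁻¹ ⅓))
  T-small : T * c ≤ fromℕ (suc q) * ⅓
  T-small = ≤-trans (proj₂ (archimedean (T * c) (positive⁻¹ ⅓))) (*-monoʳ (nonNegative⁻¹ ⅓) (fromℕ-mono (ℕP.n≤1+n q)))
  κ ε : ℚ
  κ = ⅛ * (int 1 / suc (suc q))
  -- The rotation has norm at most 4 and the block sum at most 8 ε; 32 ε = ½ κ leaves room for the
  -- error ¼ κ.
  ε = ⅛ * ⅛ * κ
  0<κ : 0ℚ < κ
  0<κ = 0<* (positive⁻¹ ⅛) (0<1/suc (suc q))
  0<ε : 0ℚ < ε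
  0<ε = 0<* (positive⁻¹ (⅛ * ⅛)) 0<κ
  blocks = blocks-vanish f s lim conv 0<ε
  j A K K′ : ℕ
  -- The index from the Cauchy criterion itself serves as multiplier, since `K` and `K′` are at
  -- least as large.
  j  = proj₁ blocks
  A  = suc j ℕ.* suc q
  K  = A ℕ.^ suc m
  K′ = blockEnd j q m
  j≤A : j ℕ.≤ A
  j≤A = ℕP.≤-trans (ℕP.n≤1+n j) (ℕP.m≤m*n (suc j) (suc q))
  base≤power : ∀ b .{{_ : ℕ.NonZero b}} → b ℕ.≤ b ℕ.^ suc m
  base≤power b = subst (ℕ._≤ b ℕ.^ suc m) (ℕP.*-identityʳ b) (ℕP.^-monoʳ-≤ b {1} {suc m} (ℕ.s≤s ℕ.z≤n))
  j≤K : j ℕ.≤ K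
  j≤K = ℕP.≤-trans j≤A (base≤power A)
  j≤K′ : j ℕ.≤ K′
  j≤K′ = ℕP.≤-trans j≤K (ℕP.^-monoˡ-≤ (suc m) (ℕP.m≤m+n A (suc j)))
  level = proj₂ blocks K K′ j≤K j≤K′
  F : ℚ
  F = sumTo (λ k → fromℕ (f k)) K′
  0≤F : 0ℚ ≤ F
  0≤F = 0≤sumTo (λ k → 0≤fromℕ (f k)) K′
  small = shrink-½ (2ℚ * F) (0≤* 0≤2 0≤F) (0<* (positive⁻¹ ¼) 0<κ)
  δ : ℚ
  δ = proj₁ small
  0<δ : 0ℚ < δ
  0<δ = proj₁ (proj₂ small)
  tiny = shrink (fromℕ K′) (positive⁻¹ ½)
  η R : ℚ
  η = proj₁ tiny
  R = (fromℕ K′ * S + fromℕ K′ * T) + (fromℕ (suc a) * fromℕ K′ + ½)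
  0≤first : 0ℚ ≤ fromℕ K′ * S + fromℕ K′ * T
  0≤first = 0≤+ (0≤* (0≤fromℕ K′) (proj₁ (proj₂ Bσ))) (0≤* (0≤fromℕ K′) (proj₁ (proj₂ Bt)))
  0≤second : 0ℚ ≤ fromℕ (suc a) * fromℕ K′ + ½
  0≤second = 0≤+ (0≤* (0≤fromℕ (suc a)) (0≤fromℕ K′)) (nonNegative⁻¹ ½)
  exponential = expSum-+ R {δ} (0≤+ 0≤first 0≤second) 0<δ
  below = Re-s≤ η (proj₁ (proj₂ tiny))
  n : ℕ
  n = proj₁ level ℕ.⊔ (proj₁ below ℕ.⊔ proj₁ exponential)
  level≤n : proj₁ level ℕ.≤ suc n
  level≤n = ℕP.m≤n⇒m≤1+n (ℕP.m≤m⊔n (proj₁ level) _)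
  below≤n : proj₁ below ℕ.≤ suc n
  below≤n = ℕP.m≤n⇒m≤1+n (ℕP.≤-trans (ℕP.m≤m⊔n (proj₁ below) (proj₁ exponential)) (ℕP.m≤n⊔m (proj₁ level) _))
  exponential≤n : proj₁ exponential ℕ.≤ suc n
  exponential≤n = ℕP.m≤n⇒m≤1+n (ℕP.≤-trans (ℕP.m≤n⊔m (proj₁ below) (proj₁ exponential)) (ℕP.m≤n⊔m (proj₁ level) _))
  δ≤½ : δ ≤ ½
  δ≤½ = proj₁ (proj₂ (proj₂ small))
  module B = Block f a m f-≥ n R δ (<⇒≤ 0<δ) δ≤½ (proj₂ exponential (suc n) exponential≤n)
    (seq (Re s) (suc n)) (seq (Im s) (suc n)) S T η (proj₂ (proj₂ Bσ) (suc n)) (proj₂ (proj₂ Bt) (suc n))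
    (<⇒≤ (proj₁ (proj₂ tiny))) (proj₂ below (suc n) below≤n) q j T-small
    (≤-trans (≤-reflexive (*-comm η (fromℕ K′))) (proj₂ (proj₂ tiny)))
    (p≤p+q 0≤second)
    (subst (_≤ R) (+-identityˡ (fromℕ (suc a) * fromℕ K′ + ½)) (+-monoˡ-≤ (fromℕ (suc a) * fromℕ K′ + ½) 0≤first))
  block : ℚ [i]
  block = weightedSum f (approxTerm s (suc n)) K′ -ᴳ weightedSum f (approxTerm s (suc n)) K
  rotation≤4 : ∥ B.rotation ∥ ≤ fromℕ 4
  rotation≤4 = ExpEstimates.rotation-≤4 n R δ δ≤½ (proj₂ exponential (suc n) exponential≤n) B.τ
    (≤-trans (B.L*-≤ K B.K≤K′ (proj₂ (proj₂ Bt) (suc n))) B.k′T≤R)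
  -- This is κ ≤ ½ κ + ¼ κ, arranged so that cancellation leaves κ ≤ 0.
  contradiction : ¼ * κ + (¼ * κ + ½ * κ) ≤ ¼ * 0ℚ + (¼ * κ + ½ * κ)
  contradiction = begin
    ¼ * κ + (¼ * κ + ½ * κ)
      ≡⟨ solve 1 (λ k → con ¼ :* k :+ (con ¼ :* k :+ con ½ :* k) := k) refl κ ⟩
    κ
      ≤⟨ B.block-lower ⟩
    Re (B.rotation *ᴳ block) + (δ + δ) * F
      ≤⟨ +-mono-≤ (≤-trans (p≤∣p∣ (Re (B.rotation *ᴳ block))) (≤-trans (∣Re∣≤∥∥ (B.rotation *ᴳ block)) (norm-* B.rotation block)))
                  (≤-trans (≤-reflexive (solve 2 (λ d f → (d :+ d) :* f := con 2ℚ :* f :* d) refl δ F)) (proj₂ (proj₂ (proj₂ small)))) ⟩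
    ∥ B.rotation ∥ * ∥ block ∥ + ¼ * κ
      ≤⟨ +-monoˡ-≤ (¼ * κ) (*-mono₂ {∥ B.rotation ∥} {fromℕ 4} {∥ block ∥} {fromℕ 8 * ε} 0≤∥ B.rotation ∥ (0≤* (0≤fromℕ 8) (<⇒≤ 0<ε)) rotation≤4 (proj₂ level (suc n) level≤n)) ⟩
    fromℕ 4 * (fromℕ 8 * ε) + ¼ * κ
      ≡⟨ solve 1 (λ k → con (fromℕ 4) :* (con (fromℕ 8) :* (con (⅛ * ⅛) :* k)) :+ con ¼ :* k := con ¼ :* con 0ℚ :+ (con ¼ :* k :+ con ½ :* k)) refl κ ⟩
    ¼ * 0ℚ + (¼ * κ + ½ * κ)
      ∎

-- The exponents and the maximum over d

maximum-attained : ∀ m (g : ℕ → ℚ) → ∃ λ d → d ℕ.≤ m × max₀≤d≤ m g ≡ g d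
maximum-attained zero    g = 0 , ℕ.z≤n , refl
maximum-attained (suc m) g with ≤-total (max₀≤d≤ m g) (g (suc m)) | maximum-attained m g
... | inj₁ le | _              = suc m , ℕP.≤-refl , p≤q⇒p⊔q≡q le
... | inj₂ ge | d , d≤m , eq   = d , ℕP.m≤n⇒m≤1+n d≤m , trans (p≥q⇒p⊔q≡p ge) eq

int/ : ∀ a b → int a / suc b ≡ fromℕ a * (int 1 / suc b)
int/ a b = sym (trans (/-mult a 0 1 b) (cong₂ (λ x y → int x / suc y) (ℕP.*-identityʳ a) (ℕP.+-identityʳ b)))

boundTerm-≡ : ∀ n d → boundTerm (suc (suc n)) d ≡ fromℕ (suc (d ℕ.* (suc n ℕ.∸ d))) * (int 1 / suc (n ℕ.+ d))
boundTerm-≡ n d = begin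
  int a / suc (n ℕ.+ d) + u     ≡⟨ cong (_+ u) (int/ a (n ℕ.+ d)) ⟩
  fromℕ a * u + u               ≡⟨ solve 2 (λ a u → a :* u :+ u := (con 1ℚ :+ a) :* u) refl (fromℕ a) u ⟩
  (1ℚ + fromℕ a) * u            ≡⟨ cong (_* u) (sym (fromℕ-suc a)) ⟩
  fromℕ (suc a) * u             ∎
  where
  open ≡-Reasoning
  a : ℕ
  a = d ℕ.* (suc n ℕ.∸ d)
  u : ℚ
  u = int 1 / suc (n ℕ.+ d)

power-≤-subringCount : ∀ n d → d ℕ.≤ n → ∀ N .{{_ : ℕ.NonZero N}} → N ℕ.^ (d ℕ.* (n ℕ.∸ d)) ℕ.≤ subringCount (suc n) (N ℕ.^ (n ℕ.+ d))
power-≤-subringCount n d d≤n N = subst (λ l → N ℕ.^ (d ℕ.* (n ℕ.∸ d)) ℕ.≤ subringCount (suc l) (N ℕ.^ (l ℕ.+ d))) (ℕP.m∸n+n≡m d≤n)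
  (subringCount-≥ N (n ℕ.∸ d) d)

corollary2p7 : (n : ℕ) .{{_ : NonTrivial n}} (s : ℂ) →
    Re s ≤ᴿ fromℚ (bound n) → DirichletSeriesDiverges (subringCount n) s
corollary2p7 (suc (suc n)) s Re-s≤ with maximum-attained (suc n) (boundTerm (suc (suc n)))
-- With `suc (suc n)` coordinates the exponent is `suc (n ℕ.+ d)`; its predecessor is passed as `m`.
... | d , d≤n , eq = dirichletSeries-diverges (subringCount (suc (suc n))) (d ℕ.* (suc n ℕ.∸ d)) (n ℕ.+ d)
  (λ N → power-≤-subringCount (suc n) d d≤n (suc N)) s
  (subst (λ b → Re s ≤ᴿ fromℚ b) (trans eq (boundTerm-≡ n d)) Re-s≤)
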